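{- Let $q\ge5$ be odd. The $\mathrm{Un}\Gamma$-lines (lines meeting the twisted cubic $\mathcal{C}$ in exactly one point and contained in no osculating plane) form two orbits under $G_q$, each of size $(q^3-q)/2$, namely $\{\ell_j\varphi:\varphi\in G_q\}$, $j=1,2$, where $P_0=P(0,0,0,1)$, $\ell_1$ is the line through $P_0$ and $P(1,0,1,0)$, $\ell_2$ is the line through $P_0$ and $P(1,0,\rho,0)$, and $\rho$ is a non-square in $\mathbb{F}_q$. Moreover, $\ell_1$ and $\ell_2$ are fixed by the same subgroup of $G_q$, of size $2$, each element of which has a matrix of the form $\begin{pmatrix}1&0&0&0\\0&d&0&0\\0&0&d^2&0\\0&0&0&d^3\end{pmatrix}$, $d\in\{1,-1\}$.
   Context: $\mathrm{PG}(3,q)$ has points $P(x_0,x_1,x_2,x_3)$; $\boldsymbol{\pi}(c_0,c_1,c_2,c_3)$ is the plane $c_0x_0+c_1x_1+c_2x_2+c_3x_3=0$. The twisted cubic is $\mathcal{C}=\{P(t^3,t^2,t,1):t\in\mathbb{F}_q\}\cup\{P(1,0,0,0)\}$; the osculating planes are $\boldsymbol{\pi}(1,-3t,3t^2,-t^3)$, $t\in\mathbb{F}_q$, and $\boldsymbol{\pi}(0,0,0,1)$. $G_q$ is the group of projectivities mapping $\mathcal{C}$ to itself; for $q\ge5$ its elements are $x\mapsto xM$ on row coordinate vectors, $M=\begin{pmatrix} a^3&a^2c&ac^2&c^3\\ 3a^2b&a^2d+2abc&bc^2+2acd&3c^2d\\ 3ab^2&b^2c+2abd&ad^2+2bcd&3cd^2\\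 b^3&b^2d&bd^2&d^3\end{pmatrix}$, $ad-bc\ne0$, up to scalar. -}

module Defs where

open import Level using (Level; suc; _⊔_)
open import Algebra.Bundles using (CommutativeRing; Group; Semiring)
open import Algebra.Core using (Op₁; Op₂)
import Algebra.Definitions.RawSemiring as RawSemiringDefinitions
import Algebra.Properties.Semiring.Sum as SemiringSum
open import Algebra.Structures using (IsCommutativeRing)
open import Data.Fin.Base using (Fin)
open import Data.Fin.Patterns using (0F; 1F; 2F; 3F)
open import Data.Nat.Base using (ℕ)
open import Data.Product.Base using (Σ; ∃; ∃-syntax; _×_; _,_; proj₁; proj₂)
open import Data.Product using (∃!)
open import Data.Sum.Base using (_⊎_; inj₁; inj₂)
open import Data.Vec.Functional using (Vector; []; _∷_)
open import Function.Base using (_∘_)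
open import Function.Bundles using (_⇔_; mk⇔; Equivalence; Inverse)
import Function.Properties.Equivalence as ⇔
open import Relation.Binary.Bundles using (Setoid)
open import Relation.Binary.Structures using (IsEquivalence)
import Relation.Binary.Construct.On as On
open import Relation.Binary.PropositionalEquality
open import Relation.Nullary.Negation using (¬_)
open import Relation.Unary using (Pred)

Restrict : ∀ {a ℓ p} (S : Setoid a ℓ) → Pred (Setoid.Carrier S) p →
           Setoid (a ⊔ p) ℓ
Restrict S P = On.setoid S (proj₁ {B = P})

-- The members of P, counted up to the equality of S, are n in number.

HasSize : ∀ {a ℓ p} (S : Setoid a ℓ) → Pred (Setoid.Carrier S) p → ℕ →
          Set (a ⊔ ℓ ⊔ p)
HasSize S P n = Inverse (setoid (Fin n)) (Restrict S P)

record Subgroup {a ℓ} (G : Group a ℓ) (p : Level) : Set (a ⊔ ℓ ⊔ suc p) where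
  open Group G
  field
    Member    : Pred Carrier p
    respects  : ∀ {x y} → x ≈ y → Member x → Member y
    ε-closed  : Member ε
    ∙-closed  : ∀ {x y} → Member x → Member y → Member (x ∙ y)
    ⁻¹-closed : ∀ {x} → Member x → Member (x ⁻¹)

record Field c : Set (suc c) where
  infixl 7 _*_
  infixl 6 _+_
  infix  8 -_
  field
    Carrier           : Set c
    _+_ _*_           : Op₂ Carrier
    -_                : Op₁ Carrier
    0# 1#             : Carrier
    isCommutativeRing : IsCommutativeRing _≡_ _+_ _*_ -_ 0# 1#
    1≢0               : 1# ≢ 0#
    inverse           : ∀ x → x ≢ 0# → ∃[ y ] y * x ≡ 1#

  commutativeRing : CommutativeRing c c
  commutativeRing = record { isCommutativeRing = isCommutativeRing }

module PG3 {c} (F : Field c) where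

  open Field F public using (1≢0; inverse)
  open CommutativeRing (Field.commutativeRing F) public
    using ( Carrier; _+_; _*_; -_; 0#; 1#; semiring
          ; *-assoc; *-comm; *-identityˡ; *-identityʳ
          ; +-identityˡ; +-identityʳ; zeroˡ; zeroʳ)
  open RawSemiringDefinitions (Semiring.rawSemiring semiring) public using (_^_)
  open SemiringSum semiring
    using (sum; sum-cong-≗; sum-replicate-zero; ∑-comm; *-distribˡ-sum; *-distribʳ-sum)

  NonSquare : Pred Carrier c
  NonSquare ρ = ∀ x → x * x ≢ ρ

  Coordinates : Set c
  Coordinates = Vector Carrier 4

  Matrix : Set c
  Matrix = Vector Coordinates 4

  infixl 7 _·ᵥ_ _·ₘ_

  _·ᵥ_ : Coordinates → Matrix → Coordinates
  (x ·ᵥ M) j = sum (λ i → x i * M i j)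

  _·ₘ_ : Matrix → Matrix → Matrix
  (M ·ₘ N) i = M i ·ᵥ N

  I : Matrix
  I = (1# ∷ 0# ∷ 0# ∷ 0# ∷ [])
    ∷ (0# ∷ 1# ∷ 0# ∷ 0# ∷ [])
    ∷ (0# ∷ 0# ∷ 1# ∷ 0# ∷ [])
    ∷ (0# ∷ 0# ∷ 0# ∷ 1# ∷ [])
    ∷ []

  infix 4 _∝_ _∝ₘ_

  _∝_ : Coordinates → Coordinates → Set c
  x ∝ y = ∃[ k ] (k ≢ 0# × ∀ i → x i ≡ k * y i)

  _∝ₘ_ : Matrix → Matrix → Set c
  M ∝ₘ N = ∃[ k ] (k ≢ 0# × ∀ i j → M i j ≡ k * N i j)

  nonzero-* : ∀ {a b} → a ≢ 0# → b ≢ 0# → a * b ≢ 0#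
  nonzero-* {a} {b} a≢0 b≢0 ab≡0 with inverse a a≢0
  ... | a⁻¹ , e = b≢0 (begin
    b               ≡⟨ *-identityˡ b ⟨
    1# * b          ≡⟨ cong (_* b) e ⟨
    a⁻¹ * a * b     ≡⟨ *-assoc a⁻¹ a b ⟩
    a⁻¹ * (a * b)   ≡⟨ cong (a⁻¹ *_) ab≡0 ⟩
    a⁻¹ * 0#        ≡⟨ zeroʳ a⁻¹ ⟩
    0#              ∎)
    where open ≡-Reasoning

  nonzero-inverse : ∀ {a} (a≢0 : a ≢ 0#) → proj₁ (inverse a a≢0) ≢ 0#
  nonzero-inverse {a} a≢0 e = 1≢0 (trans (sym (proj₂ (inverse a a≢0)))
                                 (trans (cong (_* a) e) (zeroˡ a)))

  ∝-refl : ∀ {x y} → (∀ i → x i ≡ y i) → x ∝ y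
  ∝-refl e = 1# , 1≢0 , λ i → trans (e i) (sym (*-identityˡ _))

  ∝ₘ-refl : ∀ {M N} → (∀ i j → M i j ≡ N i j) → M ∝ₘ N
  ∝ₘ-refl e = 1# , 1≢0 , λ i j → trans (e i j) (sym (*-identityˡ _))

  unscale : ∀ {k a b} (k≢0 : k ≢ 0#) → a ≡ k * b →
            b ≡ proj₁ (inverse k k≢0) * a
  unscale {k} {a} {b} k≢0 e = let k⁻¹ , i = inverse k k≢0 in begin
    b              ≡⟨ *-identityˡ b ⟨
    1# * b         ≡⟨ cong (_* b) i ⟨
    k⁻¹ * k * b    ≡⟨ *-assoc k⁻¹ k b ⟩
    k⁻¹ * (k * b)  ≡⟨ cong (k⁻¹ *_) e ⟨
    k⁻¹ * a        ∎
    where open ≡-Reasoning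

  rescale : ∀ {k l a b d} → a ≡ k * b → b ≡ l * d → a ≡ (k * l) * d
  rescale {k} {l} {d = d} e f =
    trans e (trans (cong (k *_) f) (sym (*-assoc k l d)))

  ∝-isEquivalence : IsEquivalence _∝_
  ∝-isEquivalence = record
    { refl  = ∝-refl (λ _ → refl)
    ; sym   = λ (k , k≢0 , e) → _ , nonzero-inverse k≢0 , unscale k≢0 ∘ e
    ; trans = λ (k , k≢0 , e) (l , l≢0 , f) →
        k * l , nonzero-* k≢0 l≢0 , λ i → rescale (e i) (f i)
    }

  ∝ₘ-isEquivalence : IsEquivalence _∝ₘ_
  ∝ₘ-isEquivalence = record
    { refl  = ∝ₘ-refl (λ _ _ → refl)
    ; sym   = λ (k , k≢0 , e) →
        _ , nonzero-inverse k≢0 , λ i j → unscale k≢0 (e i j)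
    ; trans = λ (k , k≢0 , e) (l , l≢0 , f) →
        k * l , nonzero-* k≢0 l≢0 , λ i j → rescale (e i j) (f i j)
    }

  ·ᵥ-congˡ : ∀ x {M N} → (∀ i j → M i j ≡ N i j) → ∀ j → (x ·ᵥ M) j ≡ (x ·ᵥ N) j
  ·ᵥ-congˡ x f j = sum-cong-≗ (λ i → cong (x i *_) (f i j))

  ·ᵥ-congʳ : ∀ M {x y} → (∀ i → x i ≡ y i) → ∀ j → (x ·ᵥ M) j ≡ (y ·ᵥ M) j
  ·ᵥ-congʳ M e j = sum-cong-≗ (λ i → cong (_* M i j) (e i))

  ·ᵥ-assoc : ∀ x M N j → ((x ·ᵥ M) ·ᵥ N) j ≡ (x ·ᵥ (M ·ₘ N)) j
  ·ᵥ-assoc x M N k = begin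
    sum (λ j → sum (λ i → x i * M i j) * N j k)
      ≡⟨ sum-cong-≗ (λ j → *-distribʳ-sum (N j k) (λ i → x i * M i j)) ⟩
    sum (λ j → sum (λ i → x i * M i j * N j k))
      ≡⟨ ∑-comm (λ j i → x i * M i j * N j k) ⟩
    sum (λ i → sum (λ j → x i * M i j * N j k))
      ≡⟨ sum-cong-≗ (λ i → sum-cong-≗ (λ j → *-assoc (x i) (M i j) (N j k))) ⟩
    sum (λ i → sum (λ j → x i * (M i j * N j k)))
      ≡⟨ sum-cong-≗ (λ i → *-distribˡ-sum (x i) (λ j → M i j * N j k)) ⟨
    sum (λ i → x i * sum (λ j → M i j * N j k))
      ∎
    where open ≡-Reasoning

  ·ᵥ-scaleˡ : ∀ k x M j → ((λ i → k * x i) ·ᵥ M) j ≡ k * (x ·ᵥ M) j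
  ·ᵥ-scaleˡ k x M j = begin
    sum (λ i → k * x i * M i j)
      ≡⟨ sum-cong-≗ (λ i → *-assoc k (x i) (M i j)) ⟩
    sum (λ i → k * (x i * M i j))
      ≡⟨ *-distribˡ-sum k (λ i → x i * M i j) ⟨
    k * sum (λ i → x i * M i j)
      ∎
    where open ≡-Reasoning

  ·ᵥ-scaleʳ : ∀ k x M j → (x ·ᵥ (λ i j → k * M i j)) j ≡ k * (x ·ᵥ M) j
  ·ᵥ-scaleʳ k x M j = begin
    sum (λ i → x i * (k * M i j))
      ≡⟨ sum-cong-≗ (λ i → trans (sym (*-assoc (x i) k (M i j)))
           (trans (cong (_* M i j) (*-comm (x i) k)) (*-assoc k (x i) (M i j)))) ⟩
    sum (λ i → k * (x i * M i j))
      ≡⟨ *-distribˡ-sum k (λ i → x i * M i j) ⟨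
    k * sum (λ i → x i * M i j)
      ∎
    where open ≡-Reasoning

  ·ᵥ-cong-∝ : ∀ {x y M N} → x ∝ y → M ∝ₘ N → (x ·ᵥ M) ∝ (y ·ᵥ N)
  ·ᵥ-cong-∝ {x} {y} {M} {N} (k , k≢0 , e) (l , l≢0 , f) =
    l * k , nonzero-* l≢0 k≢0 , λ j → rescale {l} {k}
      (trans (·ᵥ-congˡ x {M} {λ i j → l * N i j} f j) (·ᵥ-scaleʳ l x N j))
      (trans (·ᵥ-congʳ N {x} {λ i → k * y i} e j) (·ᵥ-scaleˡ k y N j))

  ·ₘ-cong-∝ : ∀ {M M′ N N′} → M ∝ₘ M′ → N ∝ₘ N′ → (M ·ₘ N) ∝ₘ (M′ ·ₘ N′)
  ·ₘ-cong-∝ {M} {M′} {N} {N′} (k , k≢0 , e) (l , l≢0 , f) =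
    l * k , nonzero-* l≢0 k≢0 , λ i j → rescale {l} {k}
      (trans (·ᵥ-congˡ (M i) {N} {λ i j → l * N′ i j} f j) (·ᵥ-scaleʳ l (M i) N′ j))
      (trans (·ᵥ-congʳ N′ {M i} {λ j → k * M′ i j} (e i) j) (·ᵥ-scaleˡ k (M′ i) N′ j))

  pick : ∀ {a b} → a ≡ b → ∀ y → y * 0# + a ≡ b
  pick e y = trans (cong₂ _+_ (zeroʳ y) e) (+-identityˡ _)

  hit : ∀ {a} → a ≡ 0# → ∀ y → y * 1# + a ≡ y
  hit e y = trans (cong₂ _+_ (*-identityʳ y) e) (+-identityʳ y)

  pickˡ : ∀ {a b} → a ≡ b → ∀ y → 0# * y + a ≡ b
  pickˡ e y = trans (cong₂ _+_ (zeroˡ y) e) (+-identityˡ _)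

  hitˡ : ∀ {a} → a ≡ 0# → ∀ y → 1# * y + a ≡ y
  hitˡ e y = trans (cong₂ _+_ (*-identityˡ y) e) (+-identityʳ y)

  ·ᵥ-identityʳ : ∀ x j → (x ·ᵥ I) j ≡ x j
  ·ᵥ-identityʳ x 0F = hit (pick (pick (pick refl _) _) _) _
  ·ᵥ-identityʳ x 1F = pick (hit (pick (pick refl _) _) _) _
  ·ᵥ-identityʳ x 2F = pick (pick (hit (pick refl _) _) _) _
  ·ᵥ-identityʳ x 3F = pick (pick (pick (hit refl _) _) _) _

  ·ₘ-identityˡ : ∀ M i j → (I ·ₘ M) i j ≡ M i j
  ·ₘ-identityˡ M 0F j = hitˡ (pickˡ (pickˡ (pickˡ refl _) _) _) _
  ·ₘ-identityˡ M 1F j = pickˡ (hitˡ (pickˡ (pickˡ refl _) _) _) _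
  ·ₘ-identityˡ M 2F j = pickˡ (pickˡ (hitˡ (pickˡ refl _) _) _) _
  ·ₘ-identityˡ M 3F j = pickˡ (pickˡ (pickˡ (hitˡ refl _) _) _) _

  -- Acts by x ↦ x M on row vectors; identified up to a scalar by _≈ₚ_.

  record Projectivity : Set c where
    field
      matrix   : Matrix
      matrix⁻¹ : Matrix
      inverseˡ : ∀ i j → (matrix⁻¹ ·ₘ matrix) i j ≡ I i j
      inverseʳ : ∀ i j → (matrix ·ₘ matrix⁻¹) i j ≡ I i j

  open Projectivity public

  undo : ∀ x M N → (∀ i j → (M ·ₘ N) i j ≡ I i j) →
         ∀ j → ((x ·ᵥ M) ·ᵥ N) j ≡ x j
  undo x M N e j = trans (·ᵥ-assoc x M N j)
    (trans (·ᵥ-congˡ x {M ·ₘ N} {I} e j) (·ᵥ-identityʳ x j))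

  cancel : ∀ M M′ N N′ → (∀ i j → (M′ ·ₘ M) i j ≡ I i j) →
           (∀ i j → (N′ ·ₘ N) i j ≡ I i j) →
           ∀ i j → ((N′ ·ₘ M′) ·ₘ (M ·ₘ N)) i j ≡ I i j
  cancel M M′ N N′ e f i j =
    trans (sym (·ᵥ-assoc (N′ i ·ᵥ M′) M N j))
    (trans (·ᵥ-congʳ N (undo (N′ i) M′ M e) j) (f i j))

  -- φ is applied first.

  _∘ₚ_ : Op₂ Projectivity
  φ ∘ₚ ψ = record
    { matrix   = matrix φ ·ₘ matrix ψ
    ; matrix⁻¹ = matrix⁻¹ ψ ·ₘ matrix⁻¹ φ
    ; inverseˡ = cancel (matrix φ) (matrix⁻¹ φ) (matrix ψ) (matrix⁻¹ ψ)
                   (inverseˡ φ) (inverseˡ ψ)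
    ; inverseʳ = cancel (matrix⁻¹ ψ) (matrix ψ) (matrix⁻¹ φ) (matrix φ)
                   (inverseʳ ψ) (inverseʳ φ)
    }

  idₚ : Projectivity
  idₚ = record
    { matrix   = I
    ; matrix⁻¹ = I
    ; inverseˡ = λ i → ·ᵥ-identityʳ (I i)
    ; inverseʳ = λ i → ·ᵥ-identityʳ (I i)
    }

  _⁻¹ₚ : Op₁ Projectivity
  φ ⁻¹ₚ = record
    { matrix   = matrix⁻¹ φ
    ; matrix⁻¹ = matrix φ
    ; inverseˡ = inverseʳ φ
    ; inverseʳ = inverseˡ φ
    }

  infix 4 _≈ₚ_ _≈ₗ_ _≈_

  _≈ₚ_ : Projectivity → Projectivity → Set c
  φ ≈ₚ ψ = matrix φ ∝ₘ matrix ψ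

  private
    module ∝ₘ = IsEquivalence ∝ₘ-isEquivalence

  ⁻¹ₚ-cong : ∀ {φ ψ} → φ ≈ₚ ψ → φ ⁻¹ₚ ≈ₚ ψ ⁻¹ₚ
  ⁻¹ₚ-cong {φ} {ψ} φ≈ψ =
    ∝ₘ.trans {M⁻¹} {(M⁻¹ ·ₘ M) ·ₘ N⁻¹} {N⁻¹}
      (∝ₘ.trans {M⁻¹} {(M⁻¹ ·ₘ N) ·ₘ N⁻¹}
        (∝ₘ-refl (λ i j → sym (undo (M⁻¹ i) N N⁻¹ (inverseʳ ψ) j)))
        (·ₘ-cong-∝ {M⁻¹ ·ₘ N} {M⁻¹ ·ₘ M} {N⁻¹} {N⁻¹}
          (·ₘ-cong-∝ {M⁻¹} {M⁻¹} {N} {M} ∝ₘ.refl (∝ₘ.sym {M} {N} φ≈ψ))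
          ∝ₘ.refl))
      (∝ₘ.trans {(M⁻¹ ·ₘ M) ·ₘ N⁻¹} {I ·ₘ N⁻¹} {N⁻¹}
        (·ₘ-cong-∝ {M⁻¹ ·ₘ M} {I} {N⁻¹} {N⁻¹} (∝ₘ-refl (inverseˡ φ)) ∝ₘ.refl)
        (∝ₘ-refl (·ₘ-identityˡ N⁻¹)))
    where
    M = matrix φ
    M⁻¹ = matrix⁻¹ φ
    N = matrix ψ
    N⁻¹ = matrix⁻¹ ψ

  PGL : Group c c
  PGL = record
    { Carrier = Projectivity
    ; _≈_     = _≈ₚ_
    ; _∙_     = _∘ₚ_
    ; ε       = idₚ
    ; _⁻¹     = _⁻¹ₚ
    ; isGroup = record
      { isMonoid = record
        { isSemigroup = record
          { isMagma = record
            { isEquivalence = On.isEquivalence matrix ∝ₘ-isEquivalence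
            ; ∙-cong = λ {φ} {φ′} {ψ} {ψ′} →
                ·ₘ-cong-∝ {matrix φ} {matrix φ′} {matrix ψ} {matrix ψ′}
            }
          ; assoc = λ φ ψ χ →
              ∝ₘ-refl (λ i → ·ᵥ-assoc (matrix φ i) (matrix ψ) (matrix χ))
          }
        ; identity = (λ φ → ∝ₘ-refl (·ₘ-identityˡ (matrix φ)))
                   , (λ φ → ∝ₘ-refl (λ i → ·ᵥ-identityʳ (matrix φ i)))
        }
      ; inverse = (λ φ → ∝ₘ-refl (inverseˡ φ)) , (λ φ → ∝ₘ-refl (inverseʳ φ))
      ; ⁻¹-cong = λ {φ} {ψ} → ⁻¹ₚ-cong {φ} {ψ}
      }
    }

  record Point : Set c where
    field
      coords  : Coordinates
      nonzero : ¬ (∀ i → coords i ≡ 0#)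

  open Point public

  _≈_ : Point → Point → Set c
  P ≈ Q = coords P ∝ coords Q

  ≈-isEquivalence : IsEquivalence _≈_
  ≈-isEquivalence = On.isEquivalence coords ∝-isEquivalence

  infixl 7 _·_ _·ₗ_

  _·_ : Point → Projectivity → Point
  coords  (P · φ)   = coords P ·ᵥ matrix φ
  nonzero (P · φ) e = nonzero P λ j → begin
    coords P j
      ≡⟨ undo (coords P) (matrix φ) (matrix⁻¹ φ) (inverseʳ φ) j ⟨
    sum (λ i → (coords P ·ᵥ matrix φ) i * matrix⁻¹ φ i j)
      ≡⟨ sum-cong-≗ (λ i → trans (cong (_* matrix⁻¹ φ i j) (e i)) (zeroˡ _)) ⟩
    sum {4} (λ _ → 0#)
      ≡⟨ sum-replicate-zero 4 ⟩
    0# ∎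
    where open ≡-Reasoning

  ·-injective : ∀ φ P Q → P · φ ≈ Q · φ → P ≈ Q
  ·-injective φ P Q (k , k≢0 , e) = k , k≢0 , λ j → begin
    coords P j
      ≡⟨ undo (coords P) M M⁻¹ (inverseʳ φ) j ⟨
    ((coords P ·ᵥ M) ·ᵥ M⁻¹) j
      ≡⟨ ·ᵥ-congʳ M⁻¹ e j ⟩
    ((λ i → k * (coords Q ·ᵥ M) i) ·ᵥ M⁻¹) j
      ≡⟨ ·ᵥ-scaleˡ k (coords Q ·ᵥ M) M⁻¹ j ⟩
    k * ((coords Q ·ᵥ M) ·ᵥ M⁻¹) j
      ≡⟨ cong (k *_) (undo (coords Q) M M⁻¹ (inverseʳ φ) j) ⟩
    k * coords Q j ∎
    where
    open ≡-Reasoning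
    M = matrix φ
    M⁻¹ = matrix⁻¹ φ

  -- A line is presented by two distinct points on it; presentations are
  -- identified by _≈ₗ_ when they carry the same points.

  record Line : Set c where
    constructor join
    field
      p₁ p₂    : Point
      distinct : ¬ (p₁ ≈ p₂)

  open Line public

  infix 4 _∈_ _⊂_

  _∈_ : Point → Line → Set c
  R ∈ ℓ = ∃[ a ] ∃[ b ] ∀ i → coords R i ≡ a * coords (p₁ ℓ) i + b * coords (p₂ ℓ) i

  _≈ₗ_ : Line → Line → Set c
  ℓ ≈ₗ m = ∀ R → R ∈ ℓ ⇔ R ∈ m

  lines : Setoid c c
  lines = record
    { Carrier = Line
    ; _≈_ = _≈ₗ_
    ; isEquivalence = record
      { refl  = λ _ → ⇔.refl
      ; sym   = λ e R → ⇔.sym (e R)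
      ; trans = λ e f R → ⇔.trans (e R) (f R)
      }
    }

  _·ₗ_ : Line → Projectivity → Line
  ℓ ·ₗ φ = join (p₁ ℓ · φ) (p₂ ℓ · φ) (distinct ℓ ∘ ·-injective φ (p₁ ℓ) (p₂ ℓ))

  record Plane : Set c where
    field
      coeffs    : Coordinates
      coeffs≢0  : ¬ (∀ i → coeffs i ≡ 0#)

  open Plane public

  _⊂_ : Line → Plane → Set c
  ℓ ⊂ π = ∀ R → R ∈ ℓ → sum (λ i → coeffs π i * coords R i) ≡ 0#

  cubicPoint : Carrier → Point
  cubicPoint t = record
    { coords  = t ^ 3 ∷ t ^ 2 ∷ t ∷ 1# ∷ []
    ; nonzero = λ e → 1≢0 (e 3F)
    }

  cubicPoint∞ : Point
  cubicPoint∞ = record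
    { coords  = 1# ∷ 0# ∷ 0# ∷ 0# ∷ []
    ; nonzero = λ e → 1≢0 (e 0F)
    }

  OnCubic : Pred Point c
  OnCubic P = (∃[ t ] P ≈ cubicPoint t) ⊎ P ≈ cubicPoint∞

  3# : Carrier
  3# = 1# + 1# + 1#

  osculatingPlane : Carrier → Plane
  osculatingPlane t = record
    { coeffs   = 1# ∷ - (3# * t) ∷ 3# * t ^ 2 ∷ - (t ^ 3) ∷ []
    ; coeffs≢0 = λ e → 1≢0 (e 0F)
    }

  osculatingPlane∞ : Plane
  osculatingPlane∞ = record
    { coeffs   = 0# ∷ 0# ∷ 0# ∷ 1# ∷ []
    ; coeffs≢0 = λ e → 1≢0 (e 3F)
    }

  UnΓ : Pred Line c
  UnΓ ℓ = ∃! _≈_ (λ P → OnCubic P × P ∈ ℓ)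
        × (∀ t → ¬ (ℓ ⊂ osculatingPlane t))
        × ¬ (ℓ ⊂ osculatingPlane∞)

  private
    module ≈ = IsEquivalence ≈-isEquivalence

  OnCubic-resp : ∀ {P Q} → P ≈ Q → OnCubic P → OnCubic Q
  OnCubic-resp {P} {Q} e (inj₁ (t , f)) =
    inj₁ (t , ≈.trans {Q} {P} {cubicPoint t} (≈.sym {P} {Q} e) f)
  OnCubic-resp {P} {Q} e (inj₂ f) =
    inj₂ (≈.trans {Q} {P} {cubicPoint∞} (≈.sym {P} {Q} e) f)

  OnCubic-≈ : ∀ {P Q} → P ≈ Q → OnCubic P ⇔ OnCubic Q
  OnCubic-≈ {P} {Q} e =
    mk⇔ (OnCubic-resp {P} {Q} e) (OnCubic-resp {Q} {P} (≈.sym {P} {Q} e))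

  -- Projectivities act bijectively on points, so the equivalence in Member
  -- says that φ maps the twisted cubic onto itself.

  G : Subgroup PGL c
  G = record
    { Member    = λ φ → ∀ P → OnCubic P ⇔ OnCubic (P · φ)
    ; respects  = λ {φ} {ψ} e h P → ⇔.trans (h P) (OnCubic-≈ {P · φ} {P · ψ}
        (·ᵥ-cong-∝ {coords P} {coords P} {matrix φ} {matrix ψ}
          (∝-refl (λ _ → refl)) e))
    ; ε-closed  = λ P → OnCubic-≈ {P} {P · idₚ}
        (∝-refl (λ i → sym (·ᵥ-identityʳ (coords P) i)))
    ; ∙-closed  = λ {φ} {ψ} h k P → ⇔.trans (h P) (⇔.trans (k (P · φ))
        (OnCubic-≈ {(P · φ) · ψ} {P · (φ ∘ₚ ψ)}
          (∝-refl (·ᵥ-assoc (coords P) (matrix φ) (matrix ψ)))))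
    ; ⁻¹-closed = λ {φ} h P → ⇔.trans
        (OnCubic-≈ {P} {(P · (φ ⁻¹ₚ)) · φ}
          (∝-refl (λ i → sym (undo (coords P) (matrix⁻¹ φ) (matrix φ) (inverseˡ φ) i))))
        (⇔.sym (h (P · (φ ⁻¹ₚ))))
    }

  Orbit : Line → Pred Line c
  Orbit ℓ m = ∃[ φ ] (Subgroup.Member G φ × m ≈ₗ ℓ ·ₗ φ)

  -- With s = 1 and s = ρ this joins P(0,0,0,1) to P(1,0,1,0) and P(1,0,ρ,0).

  lineP₀ : Carrier → Line
  lineP₀ s = record
    { p₁ = record
      { coords  = 0# ∷ 0# ∷ 0# ∷ 1# ∷ []
      ; nonzero = λ e → 1≢0 (e 3F)
      }
    ; p₂ = record
      { coords  = 1# ∷ 0# ∷ s ∷ 0# ∷ []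
      ; nonzero = λ e → 1≢0 (e 0F)
      }
    ; distinct = λ (k , _ , e) → 1≢0 (trans (e 3F) (zeroʳ k))
    }

  ℓ₁ : Line
  ℓ₁ = lineP₀ 1#

  ℓ₂ : Carrier → Line
  ℓ₂ ρ = lineP₀ ρ

  diagonal : Carrier → Matrix
  diagonal d = (1# ∷ 0# ∷ 0#    ∷ 0#    ∷ [])
             ∷ (0# ∷ d  ∷ 0#    ∷ 0#    ∷ [])
             ∷ (0# ∷ 0# ∷ d ^ 2 ∷ 0#    ∷ [])
             ∷ (0# ∷ 0# ∷ 0#    ∷ d ^ 3 ∷ [])
             ∷ []

{-# OPTIONS --safe #-}

-- The group G is transitive on the points of the cubic, so every line of the
-- class can be moved to one through O = P(0,0,0,1).  There the osculating plane
-- is x₀ = 0, and a line through O off it contains a point P(1,y,z,0); it meets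
-- the cubic again exactly when w = z − y² is zero.  An element of G fixing O and
-- P(1,0,0,0) preserves the quadrics x₀x₂ = x₁² and x₁x₃ = x₂²; as a cubic
-- polynomial with four roots vanishes, it is a diagonal matrix diag(1,d,d²,d³).
-- Hence every element of G is some diag(1,d,d²,d³), followed by an element that
-- fixes O and moves P(1,0,0,0), followed by one that moves O.  It takes the line
-- through O and P(1,0,s,0) to the line with parameters (point, y, w) where
-- w = s d².  So the orbits are the classes of w ≠ 0 modulo squares, each of size
-- (q + 1) q (q − 1)/2, and a stabiliser is given by d² = 1.

module Submission where

open import Defs
import Level
open import Algebra.Bundles using (CommutativeRing; Group)
import Algebra.Properties.AbelianGroup as AbelianGroupProperties
import Algebra.Properties.Group as GroupProperties
import Algebra.Properties.Ring as RingProperties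
import Algebra.Properties.Semiring.Mult.TCOptimised as Mult
import Algebra.Properties.Semiring.Sum as SemiringSum
import Algebra.Solver.Ring as RingSolver
open import Algebra.Solver.Ring.AlmostCommutativeRing using (fromCommutativeRing; _-Raw-AlmostCommutative⟶_)
open import Data.Fin.Base as Fin using (Fin; splitAt; _↑ˡ_; _↑ʳ_)
open import Data.Fin.Patterns using (0F; 1F; 2F; 3F)
import Data.Fin.Properties as Fin
open import Data.Integer.Base as ℤ using (ℤ)
import Data.Integer.Properties as ℤ
open import Data.List.Base as List using (filter; allFin; length)
import Data.List.Membership.Propositional as List
open import Data.List.Membership.Propositional.Properties using (∈-lookup; ∈-filter⁺; ∈-filter⁻; ∈-allFin)
import Data.List.Relation.Unary.All as All
import Data.List.Relation.Unary.AllPairs as AllPairs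
import Data.List.Relation.Unary.Any as Any
open import Data.List.Relation.Unary.Any.Properties using (lookup-index)
open import Data.List.Relation.Unary.Unique.Propositional using (Unique)
open import Data.List.Relation.Unary.Unique.Propositional.Properties using (filter⁺; allFin⁺)
open import Data.Maybe.Base as Maybe using (Maybe; just; nothing)
open import Data.Nat.Base as ℕ using (ℕ; zero; suc)
open import Data.Nat.DivMod using (_/_; m*n/n≡m)
open import Data.Nat.Divisibility using (_∣_; divides)
import Data.Nat.Properties as ℕ
import Data.Nat.Solver as ℕSolver
open import Data.Product.Base using (_×_; _,_; ∃; ∃-syntax; Σ-syntax; proj₁; proj₂)
open import Data.Product.Function.NonDependent.Propositional using (_×-↔_)
open import Data.Sum.Base using (_⊎_; inj₁; inj₂; [_,_]; [_,_]′)
import Data.Vec.Base as Vec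
open import Data.Vec.Functional using (Vector; []; _∷_; _++_)
open import Data.Vec.N-ary using (N-ary; _$ⁿ_; Eq; Eqʰ; curryⁿ)
open import Function.Base using (_∘_; id)
open import Function.Bundles using (_⇔_; _↔_; mk⇔; mk↔ₛ′; Equivalence; Inverse)
open import Function.Construct.Identity using (↔-id)
open import Function.Definitions using (Injective)
open import Function.Properties.Bijection using (Bijection⇒Inverse)
open import Function.Properties.Inverse using (↔-sym; ↔-trans; ↔⇒↣)
open import Relation.Binary.Bundles using (Setoid)
open import Relation.Binary.Consequences using (dec⇒weaklyDec)
open import Relation.Binary.Definitions using (DecidableEquality; tri<; tri≈; tri>)
open import Relation.Binary.PropositionalEquality hiding ([_]; setoid)
open import Relation.Binary.Structures using (IsEquivalence)
open import Relation.Nullary using (¬_; Dec; yes; no; contradiction)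
open import Relation.Unary using (Pred; Decidable)

-- `G` is defined as the set of projectivities preserving the cubic, not by matrices, so its
-- elements have to be found. The two quadrics used for this contain, besides the cubic, the line x₁
-- = x₂ = 0; maps into that line satisfy the same equations and are excluded only by invertibility.
-- Everything about orbits rests on one uniqueness statement, `normal-injective`: a line with w ≠ 0
-- determines its parameters. The point is recovered because each osculating plane meets the cubic
-- in a single point, and w ≠ 0 leaves the line no other cubic point. Uniqueness then serves three
-- times: it separates the two orbits, it counts each of them, and applied to the line itself it
-- gives the stabiliser. The order of `G` never enters. Odd order enters through 1 + 1 ≠ 0: the
-- nonzero elements split into pairs of opposites, and one member of each pair lists the nonzero
-- squares without repetition.

-- Enumerations and injective families.

HasSize-enumeration : ∀ {a ℓ p n} (S : Setoid a ℓ) {P : Pred (Setoid.Carrier S) p} →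
  let open Setoid S in
  (f : Fin n → Carrier) → (∀ i → P (f i)) →
  (∀ i j → f i ≈ f j → i ≡ j) → (∀ x → P x → ∃[ i ] f i ≈ x) → HasSize S P n
HasSize-enumeration S f f∈P injective surjective = Bijection⇒Inverse record
  { to        = λ i → f i , f∈P i
  ; cong      = λ i≡j → Setoid.reflexive S (cong f i≡j)
  ; bijective = injective _ _
              , λ (x , x∈P) → let i , e = surjective x x∈P in i , λ { refl → e }
  }

module _ {a} {A : Set a} where

  ∷-injective : ∀ {n} {x : A} {f : Vector A n} → (∀ i → x ≢ f i) →
                Injective _≡_ _≡_ f → Injective _≡_ _≡_ (x ∷ f)
  ∷-injective x∉f f-inj {0F}        {0F}        _ = refl
  ∷-injective x∉f f-inj {0F}        {Fin.suc j} e = contradiction e (x∉f j)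
  ∷-injective x∉f f-inj {Fin.suc i} {0F}        e = contradiction (sym e) (x∉f i)
  ∷-injective x∉f f-inj {Fin.suc i} {Fin.suc j} e = cong Fin.suc (f-inj e)

  ++-injective : ∀ {m n} {f : Vector A m} {g : Vector A n} → (∀ i j → f i ≢ g j) →
                 Injective _≡_ _≡_ f → Injective _≡_ _≡_ g →
                 Injective _≡_ _≡_ (f ++ g)
  ++-injective {m = m} {n = n} disjoint f-inj g-inj {i} {j} e
    with splitAt m i in i≡ | splitAt m j in j≡
  ... | inj₁ k | inj₁ l = trans (sym (Fin.splitAt⁻¹-↑ˡ i≡))
                          (trans (cong (_↑ˡ n) (f-inj e)) (Fin.splitAt⁻¹-↑ˡ j≡))
  ... | inj₁ k | inj₂ l = contradiction e (disjoint k l)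
  ... | inj₂ k | inj₁ l = contradiction (sym e) (disjoint l k)
  ... | inj₂ k | inj₂ l = trans (sym (Fin.splitAt⁻¹-↑ʳ i≡))
                          (trans (cong (m ↑ʳ_) (g-inj e)) (Fin.splitAt⁻¹-↑ʳ j≡))

  ++-coversˡ : ∀ {m n} {f : Vector A m} {g : Vector A n} {x} → ∃[ i ] f i ≡ x → ∃[ i ] (f ++ g) i ≡ x
  ++-coversˡ {m = m} {n = n} {f = f} {g} (i , e) =
    i ↑ˡ n , trans (cong [ f , g ] (Fin.splitAt-↑ˡ m i n)) e

  ++-coversʳ : ∀ {m n} {f : Vector A m} {g : Vector A n} {x} → ∃[ i ] g i ≡ x → ∃[ i ] (f ++ g) i ≡ x
  ++-coversʳ {m = m} {n = n} {f = f} {g} (i , e) =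
    m ↑ʳ i , trans (cong [ f , g ] (Fin.splitAt-↑ʳ m n i)) e

  lookup-injective : ∀ {xs : List.List A} → Unique xs → Injective _≡_ _≡_ (List.lookup xs)
  lookup-injective {x List.∷ xs} (x∉ AllPairs.∷ u) {0F}        {0F}        e = refl
  lookup-injective {x List.∷ xs} (x∉ AllPairs.∷ u) {0F}        {Fin.suc j} e =
    contradiction e (All.lookup x∉ (∈-lookup j))
  lookup-injective {x List.∷ xs} (x∉ AllPairs.∷ u) {Fin.suc i} {0F}        e =
    contradiction (sym e) (All.lookup x∉ (∈-lookup i))
  lookup-injective {x List.∷ xs} (x∉ AllPairs.∷ u) {Fin.suc i} {Fin.suc j} e =
    cong Fin.suc (lookup-injective u e)

-- Sets in bijection with `Fin q`, and transversals of involutions.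

module Finite {a} {A : Set a} {q : ℕ} (A↔Fin : A ↔ Fin q) where

  open Inverse A↔Fin using (to; from; strictlyInverseˡ; strictlyInverseʳ)

  to-injective : Injective _≡_ _≡_ to
  to-injective {x} {y} e =
    trans (sym (strictlyInverseʳ x)) (trans (cong from e) (strictlyInverseʳ y))

  from-injective : Injective _≡_ _≡_ from
  from-injective {i} {j} e =
    trans (sym (strictlyInverseˡ i)) (trans (cong to e) (strictlyInverseˡ j))

  infix 4 _≟_

  _≟_ : DecidableEquality A
  _≟_ = Fin.inj⇒≟ (↔⇒↣ A↔Fin)

  any? : ∀ {p} {P : Pred A p} → Decidable P → Dec (∃ P)
  any? {P = P} P? with Fin.any? (λ i → P? (from i))
  ... | yes (i , Pi) = yes (from i , Pi)
  ... | no ¬P        = no λ (x , Px) → ¬P (to x , subst P (sym (strictlyInverseʳ x)) Px)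

  injective⇒≤ : ∀ {m} {f : Fin m → A} → Injective _≡_ _≡_ f → m ℕ.≤ q
  injective⇒≤ f-inj = Fin.injective⇒≤ (f-inj ∘ to-injective)

  covering⇒≡ : ∀ {m} {f : Fin m → A} → Injective _≡_ _≡_ f → (∀ x → ∃[ i ] f i ≡ x) → m ≡ q
  covering⇒≡ {f = f} f-inj covers = ℕ.≤-antisym (injective⇒≤ f-inj)
    -- Choosing an index for every element is injective, since the family returns the element from
    -- its index.
    (Fin.injective⇒≤ {f = proj₁ ∘ covers ∘ from} λ {i} {j} e →
      from-injective (trans (sym (proj₂ (covers (from i))))
                     (trans (cong f e) (proj₂ (covers (from j))))))

  -- A transversal of the two-element orbits of `σ`. For i = j the field `disjoint` says that no
  -- fixed point is listed.
  record Half (σ : A → A) : Set a where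
    field
      {size}    : ℕ
      half      : Fin size → A
      injective : Injective _≡_ _≡_ half
      disjoint  : ∀ i j → half i ≢ σ (half j)
      covers    : ∀ x → x ≢ σ x → (∃[ i ] half i ≡ x) ⊎ (∃[ i ] σ (half i) ≡ x)

  -- Of each pair {x , σ x} take the member numbered first.

  opaque
    halve : (σ : A → A) → (∀ x → σ (σ x) ≡ x) → Half σ
    halve σ σσ = record
      { half      = h
      ; injective = λ e → lookup-injective
          (filter⁺ P? (allFin⁺ q)) (from-injective e)
      ; disjoint  = disjoint
      ; covers    = covers
      }
      where
      P : Pred (Fin q) Level.zero
      P i = i Fin.< to (σ (from i))

      P? : Decidable P
      P? i = i Fin.<? to (σ (from i))

      xs : List.List (Fin q)
      xs = filter P? (allFin q)

      h : Fin (length xs) → A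
      h i = from (List.lookup xs i)

      first : ∀ i → to (h i) Fin.< to (σ (h i))
      first i = subst (Fin._< to (σ (h i))) (sym (strictlyInverseˡ _))
        (proj₂ (∈-filter⁻ P? {xs = allFin q} (∈-lookup i)))

      disjoint : ∀ i j → h i ≢ σ (h j)
      disjoint i j e = Fin.<-asym (first j)
        (subst₂ Fin._<_ (cong to e) (cong to (trans (cong σ e) (σσ (h j)))) (first i))

      enumerated : ∀ x → to x Fin.< to (σ x) → ∃[ i ] h i ≡ x
      enumerated x x<σx = Any.index x∈ ,
        trans (cong from (sym (lookup-index x∈))) (strictlyInverseʳ x)
        where
        x∈ : to x List.∈ xs
        x∈ = ∈-filter⁺ P? (∈-allFin (to x))
               (subst (λ y → to x Fin.< to (σ y)) (sym (strictlyInverseʳ x)) x<σx)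

      covers : ∀ x → x ≢ σ x → (∃[ i ] h i ≡ x) ⊎ (∃[ i ] σ (h i) ≡ x)
      covers x x≢σx with Fin.<-cmp (to x) (to (σ x))
      ... | tri< lt _ _ = inj₁ (enumerated x lt)
      ... | tri≈ _ e _  = contradiction (to-injective e) x≢σx
      ... | tri> _ _ gt = let i , e = enumerated (σ x)
                                        (subst (λ y → to (σ x) Fin.< to y) (sym (σσ x)) gt)
                          in inj₂ (i , trans (cong σ e) (σσ x))

-- Polynomial identities with integer coefficients.

module IntegerSolver {c ℓ} (R : CommutativeRing c ℓ) where

  open import Data.Integer.Base using (+_; -[1+_])

  open CommutativeRing R
    using ( Carrier; _≈_; _+_; _*_; -_; 0#; 1#; ring; semiring; setoid; +-abelianGroup
          ; +-identityˡ; +-identityʳ; +-cong; +-congˡ; +-comm; +-assoc; -‿cong; -‿inverseʳ )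
    renaming (refl to ≈-refl; sym to ≈-sym; trans to ≈-trans; reflexive to ≈-reflexive)
  open RingProperties ring using (-‿distribˡ-*; -‿distribʳ-*)
  open AbelianGroupProperties +-abelianGroup
    using () renaming (ε⁻¹≈ε to -0≈0; ⁻¹-involutive to -‿involutive; ⁻¹-∙-comm to -‿+-comm)
  open Mult semiring using (×-homo-+; ×1-homo-*; 1+×) renaming (_×_ to _×′_)
  open import Relation.Binary.Reasoning.Setoid setoid

  -- Coefficients are integers and not ring elements, so that cancellation is decided by computation
  -- even though the ring is abstract. With this form of multiple, 1 is sent to `1#` definitionally,
  -- and `𝟏` matches the `1#` of a goal.
  ⟦_⟧ℤ : ℤ → Carrier
  ⟦ + n      ⟧ℤ = n ×′ 1#
  ⟦ -[1+ n ] ⟧ℤ = - (suc n ×′ 1#)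

  ⟦⟧-neg : ∀ i → ⟦ ℤ.- i ⟧ℤ ≈ - ⟦ i ⟧ℤ
  ⟦⟧-neg (+ zero)  = ≈-sym -0≈0
  ⟦⟧-neg (+ suc n) = ≈-refl
  ⟦⟧-neg -[1+ n ]  = ≈-sym (-‿involutive _)

  ⟦⟧-⊖ : ∀ m n → ⟦ m ℤ.⊖ n ⟧ℤ ≈ m ×′ 1# + - (n ×′ 1#)
  ⟦⟧-⊖ zero    zero    = ≈-sym (-‿inverseʳ _)
  ⟦⟧-⊖ zero    (suc n) = ≈-sym (+-identityˡ _)
  ⟦⟧-⊖ (suc m) zero    = ≈-sym (≈-trans (+-congˡ -0≈0) (+-identityʳ _))
  ⟦⟧-⊖ (suc m) (suc n) = begin
    ⟦ suc m ℤ.⊖ suc n ⟧ℤ                    ≡⟨ cong ⟦_⟧ℤ (ℤ.[1+m]⊖[1+n]≡m⊖n m n) ⟩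
    ⟦ m ℤ.⊖ n ⟧ℤ                            ≈⟨ ⟦⟧-⊖ m n ⟩
    M + - N                                 ≈⟨ +-congˡ (+-identityˡ _) ⟨
    M + (0# + - N)                          ≈⟨ +-congˡ (+-cong (-‿inverseʳ 1#) ≈-refl) ⟨
    M + ((1# + - 1#) + - N)                 ≈⟨ +-congˡ (+-assoc 1# (- 1#) (- N)) ⟩
    M + (1# + (- 1# + - N))                 ≈⟨ +-assoc M 1# _ ⟨
    (M + 1#) + (- 1# + - N)                 ≈⟨ +-cong (+-comm M 1#) (-‿+-comm 1# N) ⟩
    (1# + M) + - (1# + N)                   ≈⟨ +-cong (1+× m 1#) (-‿cong (1+× n 1#)) ⟨
    suc m ×′ 1# + - (suc n ×′ 1#)           ∎
    where
    M = m ×′ 1#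
    N = n ×′ 1#

  ⟦⟧-+ : ∀ i j → ⟦ i ℤ.+ j ⟧ℤ ≈ ⟦ i ⟧ℤ + ⟦ j ⟧ℤ
  ⟦⟧-+ (+ m)    (+ n)    = ×-homo-+ 1# m n
  ⟦⟧-+ (+ m)    -[1+ n ] = ⟦⟧-⊖ m (suc n)
  ⟦⟧-+ -[1+ m ] (+ n)    = ≈-trans (⟦⟧-⊖ n (suc m)) (+-comm _ _)
  ⟦⟧-+ -[1+ m ] -[1+ n ] = begin
    - (suc (suc (m ℕ.+ n)) ×′ 1#)        ≡⟨ cong (λ k → - (suc k ×′ 1#)) (ℕ.+-suc m n) ⟨
    - ((suc m ℕ.+ suc n) ×′ 1#)          ≈⟨ -‿cong (×-homo-+ 1# (suc m) (suc n)) ⟩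
    - (suc m ×′ 1# + suc n ×′ 1#)        ≈⟨ -‿+-comm _ _ ⟨
    - (suc m ×′ 1#) + - (suc n ×′ 1#)    ∎

  ⟦⟧-*-pos : ∀ m j → ⟦ + m ℤ.* j ⟧ℤ ≈ ⟦ + m ⟧ℤ * ⟦ j ⟧ℤ
  ⟦⟧-*-pos m (+ n)    = ≈-trans (≈-reflexive (cong ⟦_⟧ℤ (sym (ℤ.pos-* m n)))) (×1-homo-* m n)
  ⟦⟧-*-pos m -[1+ n ] = begin
    ⟦ + m ℤ.* -[1+ n ] ⟧ℤ             ≡⟨ cong ⟦_⟧ℤ (ℤ.neg-distribʳ-* (+ m) (+ suc n)) ⟨
    ⟦ ℤ.- (+ m ℤ.* + suc n) ⟧ℤ        ≈⟨ ⟦⟧-neg (+ m ℤ.* + suc n) ⟩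
    - ⟦ + m ℤ.* + suc n ⟧ℤ            ≈⟨ -‿cong (⟦⟧-*-pos m (+ suc n)) ⟩
    - (⟦ + m ⟧ℤ * ⟦ + suc n ⟧ℤ)       ≈⟨ -‿distribʳ-* _ _ ⟩
    ⟦ + m ⟧ℤ * ⟦ -[1+ n ] ⟧ℤ          ∎

  ⟦⟧-* : ∀ i j → ⟦ i ℤ.* j ⟧ℤ ≈ ⟦ i ⟧ℤ * ⟦ j ⟧ℤ
  ⟦⟧-* (+ m)    j = ⟦⟧-*-pos m j
  ⟦⟧-* -[1+ m ] j = begin
    ⟦ -[1+ m ] ℤ.* j ⟧ℤ               ≡⟨ cong ⟦_⟧ℤ (ℤ.neg-distribˡ-* (+ suc m) j) ⟨
    ⟦ ℤ.- (+ suc m ℤ.* j) ⟧ℤ          ≈⟨ ⟦⟧-neg (+ suc m ℤ.* j) ⟩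
    - ⟦ + suc m ℤ.* j ⟧ℤ              ≈⟨ -‿cong (⟦⟧-*-pos (suc m) j) ⟩
    - (⟦ + suc m ⟧ℤ * ⟦ j ⟧ℤ)         ≈⟨ -‿distribˡ-* _ _ ⟩
    ⟦ -[1+ m ] ⟧ℤ * ⟦ j ⟧ℤ            ∎

  ⟦⟧-morphism : ℤ.+-*-rawRing -Raw-AlmostCommutative⟶ fromCommutativeRing R
  ⟦⟧-morphism = record
    { ⟦_⟧    = ⟦_⟧ℤ
    ; +-homo = ⟦⟧-+
    ; *-homo = ⟦⟧-*
    ; -‿homo = ⟦⟧-neg
    ; 0-homo = ≈-refl
    ; 1-homo = ≈-refl
    }

  private
    module Solver = RingSolver ℤ.+-*-rawRing (fromCommutativeRing R) ⟦⟧-morphism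
      (λ i j → Maybe.map (≈-reflexive ∘ cong ⟦_⟧ℤ) (dec⇒weaklyDec ℤ._≟_ i j))
  open Solver public hiding (solve)

  -- Opaque because with-abstraction would otherwise normalise every proof
  -- found by the solver.
  opaque
    solve : ∀ n (f : N-ary n (Polynomial n) (Polynomial n × Polynomial n)) →
      let lhs , rhs = f $ⁿ Vec.map var (Vec.allFin n) in
      Eqʰ n _≈_ (curryⁿ ⟦ lhs ⟧↓) (curryⁿ ⟦ rhs ⟧↓) →
      Eq  n _≈_ (curryⁿ ⟦ lhs ⟧) (curryⁿ ⟦ rhs ⟧)
    solve = Solver.solve

  𝟎 𝟏 : ∀ {n} → Polynomial n
  𝟎 = con (+ 0)
  𝟏 = con (+ 1)

-- Cancellation in a field, and polynomials of degree at most three with too many roots.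

module FieldProperties {c} (F : Field c) where

  open CommutativeRing (Field.commutativeRing F) hiding (refl; sym; trans)
  open Field F using (1≢0; inverse)
  open IntegerSolver (Field.commutativeRing F)

  *-cancelˡ-nonzero : ∀ {a x y} → a ≢ 0# → a * x ≡ a * y → x ≡ y
  *-cancelˡ-nonzero {a} {x} {y} a≢0 e = let a⁻¹ , i = inverse a a≢0 in begin
    x              ≡⟨ lemma a⁻¹ i x ⟨
    a⁻¹ * (a * x)  ≡⟨ cong (a⁻¹ *_) e ⟩
    a⁻¹ * (a * y)  ≡⟨ lemma a⁻¹ i y ⟩
    y              ∎
    where
    open ≡-Reasoning
    lemma : ∀ a⁻¹ → a⁻¹ * a ≡ 1# → ∀ z → a⁻¹ * (a * z) ≡ z
    lemma a⁻¹ i z = trans (sym (*-assoc a⁻¹ a z)) (trans (cong (_* z) i) (*-identityˡ z))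

  *≡0⇒≡0 : ∀ {a x} → a ≢ 0# → a * x ≡ 0# → x ≡ 0#
  *≡0⇒≡0 {a} a≢0 e = *-cancelˡ-nonzero a≢0 (trans e (sym (zeroʳ a)))

  x-y≡0⇒x≡y : ∀ {x y} → x + - y ≡ 0# → x ≡ y
  x-y≡0⇒x≡y {x} {y} e = begin
    x              ≡⟨ solve 2 (λ x y → x := (x :+ (:- y)) :+ y) refl x y ⟩
    (x + - y) + y  ≡⟨ cong (_+ y) e ⟩
    0# + y         ≡⟨ +-identityˡ y ⟩
    y              ∎
    where open ≡-Reasoning

  x≡y⇒x-y≡0 : ∀ {x y} → x ≡ y → x + - y ≡ 0#
  x≡y⇒x-y≡0 {x} refl = -‿inverseʳ x

  -‿involutive : ∀ x → - (- x) ≡ x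
  -‿involutive = solve 1 (λ x → :- (:- x) := x) refl

  linear-roots : ∀ {a b x y} → x ≢ y →
    a + b * x ≡ 0# → a + b * y ≡ 0# → a ≡ 0# × b ≡ 0#
  linear-roots {a} {b} {x} {y} x≢y ex ey = a≡0 , b≡0
    where
    open ≡-Reasoning
    b≡0 : b ≡ 0#
    b≡0 = *≡0⇒≡0 (x≢y ∘ x-y≡0⇒x≡y) (begin
      (x + - y) * b
        ≡⟨ solve 4 (λ a b x y → (x :+ (:- y)) :* b :=
             (a :+ b :* x) :+ (:- (a :+ b :* y))) refl a b x y ⟩
      (a + b * x) + - (a + b * y)
        ≡⟨ x≡y⇒x-y≡0 (trans ex (sym ey)) ⟩
      0# ∎)
    a≡0 : a ≡ 0#
    a≡0 = begin
      a           ≡⟨ solve 2 (λ a x → a := a :+ 𝟎 :* x) refl a x ⟩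
      a + 0# * x  ≡⟨ cong (λ b → a + b * x) b≡0 ⟨
      a + b * x   ≡⟨ ex ⟩
      0#          ∎

  -- Here and for cubics, the differences p(x) − p(xᵢ) are divided by x − xᵢ.

  quadratic-roots : ∀ {a b c x y z} → x ≢ y → x ≢ z → y ≢ z →
    a + b * x + c * (x * x) ≡ 0# → a + b * y + c * (y * y) ≡ 0# →
    a + b * z + c * (z * z) ≡ 0# → a ≡ 0# × b ≡ 0# × c ≡ 0#
  quadratic-roots {a} {b} {c} {x} {y} {z} x≢y x≢z y≢z ex ey ez = a≡0 , b≡0 , c≡0
    where
    open ≡-Reasoning
    quotient : ∀ t → x ≢ t → a + b * t + c * (t * t) ≡ 0# → (b + c * x) + c * t ≡ 0#
    quotient t x≢t et = *≡0⇒≡0 (x≢t ∘ x-y≡0⇒x≡y) (begin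
      (x + - t) * ((b + c * x) + c * t)
        ≡⟨ solve 5 (λ a b c x t → (x :+ (:- t)) :* ((b :+ c :* x) :+ c :* t) :=
             (a :+ b :* x :+ c :* (x :* x)) :+ (:- (a :+ b :* t :+ c :* (t :* t))))
             refl a b c x t ⟩
      (a + b * x + c * (x * x)) + - (a + b * t + c * (t * t))
        ≡⟨ x≡y⇒x-y≡0 (trans ex (sym et)) ⟩
      0# ∎)
    linear = linear-roots y≢z (quotient y x≢y ey) (quotient z x≢z ez)
    c≡0 = proj₂ linear
    b≡0 : b ≡ 0#
    b≡0 = begin
      b           ≡⟨ solve 2 (λ b x → b := b :+ 𝟎 :* x) refl b x ⟩
      b + 0# * x  ≡⟨ cong (λ c → b + c * x) c≡0 ⟨
      b + c * x   ≡⟨ proj₁ linear ⟩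
      0#          ∎
    a≡0 : a ≡ 0#
    a≡0 = begin
      a                         ≡⟨ solve 2 (λ a x → a := a :+ 𝟎 :* x :+ 𝟎 :* (x :* x)) refl a x ⟩
      a + 0# * x + 0# * (x * x) ≡⟨ cong₂ (λ b c → a + b * x + c * (x * x)) b≡0 c≡0 ⟨
      a + b * x + c * (x * x)   ≡⟨ ex ⟩
      0#                        ∎

  cubic : Carrier → Carrier → Carrier → Carrier → Carrier → Carrier
  cubic a b c d x = a + b * x + c * (x * x) + d * (x * x * x)

  cubic-roots : ∀ {a b c d} {r : Fin 4 → Carrier} → Injective _≡_ _≡_ r →
    (∀ i → cubic a b c d (r i) ≡ 0#) → a ≡ 0# × b ≡ 0# × c ≡ 0# × d ≡ 0#
  cubic-roots {a} {b} {c} {d} {r} r-inj root = a≡0 , b≡0 , c≡0 , d≡0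
    where
    open ≡-Reasoning
    x = r 0F
    quotient : ∀ i → 0F ≢ i →
      (b + c * x + d * (x * x)) + (c + d * x) * r i + d * (r i * r i) ≡ 0#
    quotient i 0≢i = *≡0⇒≡0 (0≢i ∘ r-inj ∘ x-y≡0⇒x≡y) (begin
      (x + - r i) * ((b + c * x + d * (x * x)) + (c + d * x) * r i + d * (r i * r i))
        ≡⟨ solve 6 (λ a b c d x t →
             (x :+ (:- t)) :* ((b :+ c :* x :+ d :* (x :* x)) :+ (c :+ d :* x) :* t :+ d :* (t :* t)) :=
             (a :+ b :* x :+ c :* (x :* x) :+ d :* (x :* x :* x)) :+
             (:- (a :+ b :* t :+ c :* (t :* t) :+ d :* (t :* t :* t))))
             refl a b c d x (r i) ⟩
      cubic a b c d x + - cubic a b c d (r i)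
        ≡⟨ x≡y⇒x-y≡0 (trans (root 0F) (sym (root i))) ⟩
      0# ∎)
    quadratic = quadratic-roots
      ((λ ()) ∘ r-inj) ((λ ()) ∘ r-inj) ((λ ()) ∘ r-inj)
      (quotient 1F λ ()) (quotient 2F λ ()) (quotient 3F λ ())
    -- The division keeps the leading coefficient; the lower ones follow by back substitution.
    d≡0 = proj₂ (proj₂ quadratic)
    c≡0 : c ≡ 0#
    c≡0 = begin
      c           ≡⟨ solve 2 (λ c x → c := c :+ 𝟎 :* x) refl c x ⟩
      c + 0# * x  ≡⟨ cong (λ d → c + d * x) d≡0 ⟨
      c + d * x   ≡⟨ proj₁ (proj₂ quadratic) ⟩
      0#          ∎
    b≡0 : b ≡ 0#
    b≡0 = begin
      b                         ≡⟨ solve 2 (λ a x → a := a :+ 𝟎 :* x :+ 𝟎 :* (x :* x)) refl b x ⟩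
      b + 0# * x + 0# * (x * x) ≡⟨ cong₂ (λ c d → b + c * x + d * (x * x)) c≡0 d≡0 ⟨
      b + c * x + d * (x * x)   ≡⟨ proj₁ quadratic ⟩
      0#                        ∎
    a≡0 : a ≡ 0#
    a≡0 = begin
      a
        ≡⟨ solve 2 (λ a x → a := a :+ 𝟎 :* x :+ 𝟎 :* (x :* x) :+ 𝟎 :* (x :* x :* x)) refl a x ⟩
      cubic a 0# 0# 0# x
        ≡⟨ cong₂ (λ c d → cubic a 0# c d x) c≡0 d≡0 ⟨
      cubic a 0# c d x
        ≡⟨ cong (λ b → cubic a b c d x) b≡0 ⟨
      cubic a b c d x
        ≡⟨ root 0F ⟩
      0# ∎

-- Squares in a finite field of odd order.

module OddFiniteField {c} (F : Field c) {q : ℕ} (F↔Fin : Field.Carrier F ↔ Fin q)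
  (5≤q : 5 ℕ.≤ q) (2∤q : ¬ 2 ∣ q) where

  open CommutativeRing (Field.commutativeRing F) hiding (refl; sym; trans)
  open Field F using (1≢0; inverse)
  open IntegerSolver (Field.commutativeRing F)
  open FieldProperties F
  open PG3 F using (nonzero-*; NonSquare)
  open Finite F↔Fin public using (_≟_; any?)
  open Finite F↔Fin using (halve; module Half; injective⇒≤; covering⇒≡)

  *-zero-product : ∀ {a b} → a * b ≡ 0# → a ≡ 0# ⊎ b ≡ 0#
  *-zero-product {a} e with a ≟ 0#
  ... | yes a≡0 = inj₁ a≡0
  ... | no a≢0  = inj₂ (*≡0⇒≡0 a≢0 e)

  x²≡0⇒x≡0 : ∀ {x} → x * x ≡ 0# → x ≡ 0#
  x²≡0⇒x≡0 = [ id , id ]′ ∘ *-zero-product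

  x²≡y²⇒x≡±y : ∀ {x y} → x * x ≡ y * y → x ≡ y ⊎ x ≡ - y
  x²≡y²⇒x≡±y {x} {y} e = [ inj₁ ∘ x-y≡0⇒x≡y , inj₂ ∘ x+y≡0 ]′ (*-zero-product (begin
    (x + - y) * (x + y)  ≡⟨ solve 2 (λ x y → (x :+ (:- y)) :* (x :+ y) :=
                              x :* x :+ (:- (y :* y))) refl x y ⟩
    x * x + - (y * y)    ≡⟨ x≡y⇒x-y≡0 e ⟩
    0#                   ∎))
    where
    open ≡-Reasoning
    x+y≡0 : x + y ≡ 0# → x ≡ - y
    x+y≡0 e = x-y≡0⇒x≡y (trans (solve 2 (λ x y → x :+ (:- (:- y)) := x :+ y) refl x y) e)

  -- Otherwise x ↦ x + 1 would be an involution without fixed points.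
  1+1≢0 : 1# + 1# ≢ 0#
  1+1≢0 1+1≡0 = 2∤q (divides size (trans (sym (covering⇒≡ injective′ covers′)) n+n≡n*2))
    where
    open ≡-Reasoning
    σ : Carrier → Carrier
    σ x = x + 1#
    σσ : ∀ x → σ (σ x) ≡ x
    σσ x = trans (+-assoc x 1# 1#) (trans (cong (x +_) 1+1≡0) (+-identityʳ x))
    open Half (halve σ σσ)
    injective′ : Injective _≡_ _≡_ (half ++ (σ ∘ half))
    injective′ = ++-injective disjoint injective
      (λ {i} {j} e → injective (trans (sym (σσ _)) (trans (cong σ e) (σσ _))))
    fixed-point-free : ∀ x → x ≢ σ x
    fixed-point-free x e = 1≢0 (begin
      1#              ≡⟨ solve 1 (λ x → 𝟏 := (x :+ 𝟏) :+ (:- x)) refl x ⟩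
      (x + 1#) + - x  ≡⟨ cong (_+ - x) e ⟨
      x + - x         ≡⟨ -‿inverseʳ x ⟩
      0#              ∎)
    covers′ : ∀ x → ∃[ i ] (half ++ (σ ∘ half)) i ≡ x
    covers′ x = [ ++-coversˡ {f = half} , ++-coversʳ {f = half} ]′ (covers x (fixed-point-free x))
    n+n≡n*2 : size ℕ.+ size ≡ size ℕ.* 2
    n+n≡n*2 = trans (cong (size ℕ.+_) (sym (ℕ.+-identityʳ size))) (ℕ.*-comm 2 size)

  x≡-x⇒x≡0 : ∀ {x} → x ≡ - x → x ≡ 0#
  x≡-x⇒x≡0 {x} e = *≡0⇒≡0 1+1≢0 (begin
    (1# + 1#) * x  ≡⟨ solve 1 (λ x → (𝟏 :+ 𝟏) :* x := x :+ x) refl x ⟩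
    x + x          ≡⟨ cong (x +_) e ⟩
    x + - x        ≡⟨ -‿inverseʳ x ⟩
    0#             ∎)
    where open ≡-Reasoning

  x≢0⇒-x≢0 : ∀ {x} → x ≢ 0# → - x ≢ 0#
  x≢0⇒-x≢0 {x} x≢0 e = x≢0 (begin
    x        ≡⟨ -‿involutive x ⟨
    - (- x)  ≡⟨ cong -_ e ⟩
    - 0#     ≡⟨ solve 0 (:- 𝟎 := 𝟎) refl ⟩
    0#       ∎)
    where open ≡-Reasoning

  -- From here on `half` holds one of each pair of opposite nonzero elements, so its squares are the
  -- nonzero squares without repetition, and `size` is (q - 1)/2.
  open Half (halve -_ -‿involutive) public

  half≢0 : ∀ i → half i ≢ 0#
  half≢0 i e = disjoint i i (trans e (sym (trans (cong -_ e) (solve 0 (:- 𝟎 := 𝟎) refl))))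

  half-square-injective : ∀ {i j} → half i * half i ≡ half j * half j → i ≡ j
  half-square-injective {i} {j} e =
    [ injective , (λ e′ → contradiction e′ (disjoint i j)) ]′ (x²≡y²⇒x≡±y e)

  half-squares : ∀ {x} → x ≢ 0# → ∃[ i ] half i * half i ≡ x * x
  half-squares {x} x≢0 =
    [ (λ (i , e) → i , cong (λ y → y * y) e)
    , (λ (i , e) → i , trans (solve 1 (λ y → y :* y := (:- y) :* (:- y)) refl (half i))
                             (cong (λ y → y * y) e))
    ]′ (covers x (x≢0 ∘ x≡-x⇒x≡0))

  -- Zero is the only element equal to its opposite, so zero, `half` and the negatives of `half`
  -- exhaust the field.
  order : suc (size ℕ.+ size) ≡ q
  order = covering⇒≡ {f = 0# ∷ (half ++ (-_ ∘ half))}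
    (∷-injective 0∉ (++-injective disjoint injective
      (λ {i} {j} e → injective (trans (sym (-‿involutive _)) (trans (cong -_ e) (-‿involutive _))))))
    covers′
    where
    0∉ : ∀ i → 0# ≢ (half ++ (-_ ∘ half)) i
    0∉ i with Fin.splitAt size i
    ... | inj₁ j = half≢0 j ∘ sym
    ... | inj₂ j = x≢0⇒-x≢0 (half≢0 j) ∘ sym
    covers′ : ∀ x → ∃[ i ] (0# ∷ (half ++ (-_ ∘ half))) i ≡ x
    covers′ x with x ≟ 0#
    ... | yes x≡0 = 0F , sym x≡0
    ... | no x≢0  =
      let i , e = [ ++-coversˡ {f = half} , ++-coversʳ {f = half} ]′ (covers x (x≢0 ∘ x≡-x⇒x≡0))
      in Fin.suc i , e

  -- Zero, the half squares and ρ times the half squares are q distinct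
  -- elements, so they exhaust the field.
  square-classes : ∀ {ρ} → NonSquare ρ → ∀ {w} → w ≢ 0# →
    (∃[ u ] (u ≢ 0# × w ≡ 1# * (u * u))) ⊎ (∃[ u ] (u ≢ 0# × w ≡ ρ * (u * u)))
  square-classes {ρ} ρ-nonsquare {w} w≢0 =
    classify (any? (λ u → w ≟ 1# * (u * u))) (any? (λ u → w ≟ ρ * (u * u)))
    where
    ρ≢0 : ρ ≢ 0#
    ρ≢0 e = ρ-nonsquare 0# (trans (zeroˡ 0#) (sym e))
    squares nonsquares : Fin size → Carrier
    squares i    = half i * half i
    nonsquares i = ρ * (half i * half i)
    0∉ : ∀ i → 0# ≢ (squares ++ nonsquares) i
    0∉ i with Fin.splitAt size i
    ... | inj₁ j = half≢0 j ∘ x²≡0⇒x≡0 ∘ sym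
    ... | inj₂ j = nonzero-* ρ≢0 (nonzero-* (half≢0 j) (half≢0 j)) ∘ sym
    w∉ : ¬ (∃[ u ] w ≡ 1# * (u * u)) → ¬ (∃[ u ] w ≡ ρ * (u * u)) →
         ∀ i → w ≢ (squares ++ nonsquares) i
    w∉ w∉1 w∉ρ i with Fin.splitAt size i
    ... | inj₁ j = λ e → w∉1 (half j , trans e (sym (*-identityˡ _)))
    ... | inj₂ j = λ e → w∉ρ (half j , e)
    squares≢nonsquares : ∀ i j → squares i ≢ nonsquares j
    squares≢nonsquares i j e = let h = half j ; h⁻¹ , h⁻¹h≡1 = inverse h (half≢0 j) in
      ρ-nonsquare (half i * h⁻¹) (begin
        (half i * h⁻¹) * (half i * h⁻¹)
          ≡⟨ solve 2 (λ x y → (x :* y) :* (x :* y) := (y :* y) :* (x :* x)) refl (half i) h⁻¹ ⟩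
        (h⁻¹ * h⁻¹) * (half i * half i)
          ≡⟨ cong ((h⁻¹ * h⁻¹) *_) e ⟩
        (h⁻¹ * h⁻¹) * (ρ * (h * h))
          ≡⟨ solve 3 (λ x y ρ → (y :* y) :* (ρ :* (x :* x)) := (y :* x) :* (y :* x) :* ρ) refl h h⁻¹ ρ ⟩
        (h⁻¹ * h) * (h⁻¹ * h) * ρ
          ≡⟨ cong (λ z → z * z * ρ) h⁻¹h≡1 ⟩
        1# * 1# * ρ
          ≡⟨ solve 1 (λ ρ → 𝟏 :* 𝟏 :* ρ := ρ) refl ρ ⟩
        ρ ∎)
      where open ≡-Reasoning
    family-injective : ¬ (∃[ u ] w ≡ 1# * (u * u)) → ¬ (∃[ u ] w ≡ ρ * (u * u)) →
                       Injective _≡_ _≡_ (0# ∷ (w ∷ (squares ++ nonsquares)))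
    family-injective w∉1 w∉ρ = ∷-injective
      (λ { 0F → w≢0 ∘ sym ; (Fin.suc i) → 0∉ i })
      (∷-injective (w∉ w∉1 w∉ρ) (++-injective squares≢nonsquares half-square-injective
        (half-square-injective ∘ *-cancelˡ-nonzero ρ≢0)))
    nonzero : ∀ {s u} → w ≡ s * (u * u) → u ≢ 0#
    nonzero {s} e refl = w≢0 (trans e (solve 1 (λ s → s :* (𝟎 :* 𝟎) := 𝟎) refl s))
    classify : Dec (∃[ u ] w ≡ 1# * (u * u)) → Dec (∃[ u ] w ≡ ρ * (u * u)) →
      (∃[ u ] (u ≢ 0# × w ≡ 1# * (u * u))) ⊎ (∃[ u ] (u ≢ 0# × w ≡ ρ * (u * u)))
    classify (yes (u , e)) _             = inj₁ (u , nonzero e , e)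
    classify (no _)        (yes (u , e)) = inj₂ (u , nonzero e , e)
    classify (no w∉1)      (no w∉ρ)      = contradiction
      (subst (2 ℕ.+ (size ℕ.+ size) ℕ.≤_) (sym order)
        (injective⇒≤ (family-injective w∉1 w∉ρ)))
      ℕ.1+n≰n

  -- Here q ≥ 5 is spent: a cubic polynomial needs four roots to vanish, and the roots available
  -- later are the nonzero parameters.
  four-nonzero : Σ[ r ∈ (Fin 4 → Carrier) ] Injective _≡_ _≡_ r × (∀ i → r i ≢ 0#)
  four-nonzero = avoid-zero F↔Fin 5≤q
    where
    -- The module fixes `q`; it is generalised here so that it can be split as a successor, after
    -- which `punchIn` skips the number of zero.
    avoid-zero : ∀ {q} → Carrier ↔ Fin q → 5 ℕ.≤ q →
                 Σ[ r ∈ (Fin 4 → Carrier) ] Injective _≡_ _≡_ r × (∀ i → r i ≢ 0#)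
    avoid-zero {suc q} iso (ℕ.s≤s 4≤q) =
        from ∘ Fin.punchIn (to 0#) ∘ (λ i → Fin.inject≤ i 4≤q)
      , (λ e → Fin.inject≤-injective 4≤q 4≤q _ _
                 (Fin.punchIn-injective (to 0#) _ _ (Finite.from-injective iso e)))
      , (λ i e → Fin.punchInᵢ≢i (to 0#) (Fin.inject≤ i 4≤q)
                   (trans (sym (strictlyInverseˡ _)) (cong to e)))
      where
      open Inverse iso using (to; from; strictlyInverseˡ)

-- Lines as spans, and the action of projectivities on them.

module LineGeometry {c} (F : Field c) where

  open PG3 F
  open SemiringSum semiring using (sum; sum-cong-≗; ∑-distrib-+)
  open CommutativeRing (Field.commutativeRing F) using (distribʳ)
  open IntegerSolver (Field.commutativeRing F)

  infix 4 _∈ᵥ_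

  -- Incidence for bare vectors, so that combinations can be formed without showing them nonzero.
  -- For the coordinates of a point it is `_∈_` by definition.
  _∈ᵥ_ : Coordinates → Line → Set c
  v ∈ᵥ ℓ = ∃[ a ] ∃[ b ] ∀ i → v i ≡ a * coords (p₁ ℓ) i + b * coords (p₂ ℓ) i

  ∈ᵥ-combination : ∀ {ℓ u v w} a b → u ∈ᵥ ℓ → v ∈ᵥ ℓ → (∀ i → w i ≡ a * u i + b * v i) → w ∈ᵥ ℓ
  ∈ᵥ-combination {ℓ} a b (x , y , e) (z , t , f) g =
    a * x + b * z , a * y + b * t , λ i → trans (g i)
      (trans (cong₂ (λ u v → a * u + b * v) (e i) (f i))
      (solve 8 (λ a b x y z t p q → a :* (x :* p :+ y :* q) :+ b :* (z :* p :+ t :* q) :=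
         (a :* x :+ b :* z) :* p :+ (a :* y :+ b :* t) :* q) refl
         a b x y z t (coords (p₁ ℓ) i) (coords (p₂ ℓ) i)))

  ∈ᵥ-scale : ∀ {ℓ v w} a → v ∈ᵥ ℓ → (∀ i → w i ≡ a * v i) → w ∈ᵥ ℓ
  ∈ᵥ-scale {ℓ} {v} a v∈ e = ∈ᵥ-combination {ℓ} a 0# v∈ v∈ (λ i → trans (e i)
    (solve 2 (λ a v → a :* v := a :* v :+ 𝟎 :* v) refl a (v i)))

  ∈ᵥ-resp : ∀ {ℓ v w} → v ∈ᵥ ℓ → (∀ i → w i ≡ v i) → w ∈ᵥ ℓ
  ∈ᵥ-resp {ℓ} v∈ e = ∈ᵥ-scale {ℓ} 1# v∈ (λ i → trans (e i) (sym (*-identityˡ _)))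

  p₁∈ : ∀ ℓ → coords (p₁ ℓ) ∈ᵥ ℓ
  p₁∈ ℓ = 1# , 0# , λ i →
    solve 2 (λ p q → p := 𝟏 :* p :+ 𝟎 :* q) refl (coords (p₁ ℓ) i) (coords (p₂ ℓ) i)

  p₂∈ : ∀ ℓ → coords (p₂ ℓ) ∈ᵥ ℓ
  p₂∈ ℓ = 0# , 1# , λ i →
    solve 2 (λ p q → q := 𝟎 :* p :+ 𝟏 :* q) refl (coords (p₁ ℓ) i) (coords (p₂ ℓ) i)

  ⊆-intro : ∀ ℓ m → coords (p₁ ℓ) ∈ᵥ m → coords (p₂ ℓ) ∈ᵥ m → ∀ {v} → v ∈ᵥ ℓ → v ∈ᵥ m
  ⊆-intro ℓ m p∈ q∈ (a , b , e) = ∈ᵥ-combination {m} a b p∈ q∈ e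

  -- Asking for both inclusions on spanning points avoids the exchange argument by which one
  -- inclusion between two-dimensional spans would suffice.
  ≈ₗ-intro : ∀ ℓ m → coords (p₁ ℓ) ∈ᵥ m → coords (p₂ ℓ) ∈ᵥ m →
             coords (p₁ m) ∈ᵥ ℓ → coords (p₂ m) ∈ᵥ ℓ → ℓ ≈ₗ m
  ≈ₗ-intro ℓ m a b c d R = mk⇔ (⊆-intro ℓ m a b) (⊆-intro m ℓ c d)

  ≈ₗ-points : ∀ {ℓ m} → p₁ ℓ ≈ p₁ m → p₂ ℓ ≈ p₂ m → ℓ ≈ₗ m
  ≈ₗ-points {ℓ} {m} e@(k , _ , f) e′@(l , _ , g) = ≈ₗ-intro ℓ m
    (∈ᵥ-scale {m} k (p₁∈ m) f) (∈ᵥ-scale {m} l (p₂∈ m) g)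
    (let k , _ , f = ≈.sym {p₁ ℓ} {p₁ m} e in ∈ᵥ-scale {ℓ} k (p₁∈ ℓ) f)
    (let l , _ , g = ≈.sym {p₂ ℓ} {p₂ m} e′ in ∈ᵥ-scale {ℓ} l (p₂∈ ℓ) g)
    where module ≈ = IsEquivalence ≈-isEquivalence

  ·ᵥ-linear : ∀ a b u v w M → (∀ i → w i ≡ a * u i + b * v i) →
              ∀ j → (w ·ᵥ M) j ≡ a * (u ·ᵥ M) j + b * (v ·ᵥ M) j
  ·ᵥ-linear a b u v w M e j = begin
    sum (λ i → w i * M i j)
      ≡⟨ sum-cong-≗ (λ i → trans (cong (_* M i j) (e i)) (distribʳ (M i j) (a * u i) (b * v i))) ⟩
    sum (λ i → a * u i * M i j + b * v i * M i j)
      ≡⟨ ∑-distrib-+ (λ i → a * u i * M i j) (λ i → b * v i * M i j) ⟩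
    sum (λ i → a * u i * M i j) + sum (λ i → b * v i * M i j)
      ≡⟨ cong₂ _+_ (·ᵥ-scaleˡ a u M j) (·ᵥ-scaleˡ b v M j) ⟩
    a * (u ·ᵥ M) j + b * (v ·ᵥ M) j ∎
    where open ≡-Reasoning

  ∈ᵥ-· : ∀ {ℓ v} φ → v ∈ᵥ ℓ → (v ·ᵥ matrix φ) ∈ᵥ (ℓ ·ₗ φ)
  ∈ᵥ-· {ℓ} {v} φ (a , b , e) =
    a , b , ·ᵥ-linear a b (coords (p₁ ℓ)) (coords (p₂ ℓ)) v (matrix φ) e

  ·ₗ-congˡ : ∀ φ {ℓ m} → ℓ ≈ₗ m → (ℓ ·ₗ φ) ≈ₗ (m ·ₗ φ)
  ·ₗ-congˡ φ {ℓ} {m} e = ≈ₗ-intro (ℓ ·ₗ φ) (m ·ₗ φ)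
    (∈ᵥ-· {m} φ (Equivalence.to (e (p₁ ℓ)) (p₁∈ ℓ)))
    (∈ᵥ-· {m} φ (Equivalence.to (e (p₂ ℓ)) (p₂∈ ℓ)))
    (∈ᵥ-· {ℓ} φ (Equivalence.from (e (p₁ m)) (p₁∈ m)))
    (∈ᵥ-· {ℓ} φ (Equivalence.from (e (p₂ m)) (p₂∈ m)))

  ·-congʳ : ∀ P φ ψ → φ ≈ₚ ψ → P · φ ≈ P · ψ
  ·-congʳ P φ ψ = ·ᵥ-cong-∝ {coords P} {coords P} {matrix φ} {matrix ψ} (∝-refl (λ _ → refl))

  ·-congˡ : ∀ {P Q} φ → P ≈ Q → P · φ ≈ Q · φ
  ·-congˡ {P} {Q} φ P≈Q =
    ·ᵥ-cong-∝ {coords P} {coords Q} {matrix φ} {matrix φ} P≈Q (∝ₘ-refl (λ _ _ → refl))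

  ·-∘ : ∀ P φ ψ → (P · φ) · ψ ≈ P · (φ ∘ₚ ψ)
  ·-∘ P φ ψ = ∝-refl (·ᵥ-assoc (coords P) (matrix φ) (matrix ψ))

  ·-id : ∀ P → P · idₚ ≈ P
  ·-id P = ∝-refl (·ᵥ-identityʳ (coords P))

  ·ₗ-congʳ : ∀ ℓ {φ ψ} → φ ≈ₚ ψ → (ℓ ·ₗ φ) ≈ₗ (ℓ ·ₗ ψ)
  ·ₗ-congʳ ℓ {φ} {ψ} e = ≈ₗ-points {ℓ ·ₗ φ} {ℓ ·ₗ ψ}
    (·-congʳ (p₁ ℓ) φ ψ e) (·-congʳ (p₂ ℓ) φ ψ e)

  ·ₗ-∘ : ∀ ℓ φ ψ → ((ℓ ·ₗ φ) ·ₗ ψ) ≈ₗ (ℓ ·ₗ (φ ∘ₚ ψ))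
  ·ₗ-∘ ℓ φ ψ = ≈ₗ-points {(ℓ ·ₗ φ) ·ₗ ψ} {ℓ ·ₗ (φ ∘ₚ ψ)}
    (·-∘ (p₁ ℓ) φ ψ) (·-∘ (p₂ ℓ) φ ψ)

  ·ₗ-id : ∀ ℓ → (ℓ ·ₗ idₚ) ≈ₗ ℓ
  ·ₗ-id ℓ = ≈ₗ-points {ℓ ·ₗ idₚ} {ℓ} (·-id (p₁ ℓ)) (·-id (p₂ ℓ))

  module ≈ = IsEquivalence ≈-isEquivalence
  module ≈ₗ = Setoid lines
  module PGL = Group PGL

  ·ₗ-cancel : ∀ ℓ φ ψ → (φ ∘ₚ ψ) ≈ₚ idₚ → ((ℓ ·ₗ φ) ·ₗ ψ) ≈ₗ ℓ
  ·ₗ-cancel ℓ φ ψ e = ≈ₗ.trans {(ℓ ·ₗ φ) ·ₗ ψ} {ℓ ·ₗ (φ ∘ₚ ψ)} {ℓ} (·ₗ-∘ ℓ φ ψ)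
    (≈ₗ.trans {ℓ ·ₗ (φ ∘ₚ ψ)} {ℓ ·ₗ idₚ} {ℓ} (·ₗ-congʳ ℓ {φ ∘ₚ ψ} {idₚ} e) (·ₗ-id ℓ))

  ·-cancel : ∀ P φ ψ → (φ ∘ₚ ψ) ≈ₚ idₚ → (P · φ) · ψ ≈ P
  ·-cancel P φ ψ e = ≈.trans {(P · φ) · ψ} {P · (φ ∘ₚ ψ)} {P} (·-∘ P φ ψ)
    (≈.trans {P · (φ ∘ₚ ψ)} {P · idₚ} {P} (·-congʳ P (φ ∘ₚ ψ) idₚ e) (·-id P))

-- Explicit projectivities acting on the parameter of the cubic.

module Generators {c} (F : Field c) where

  open PG3 F
  open LineGeometry F
  open IntegerSolver (Field.commutativeRing F)
  open FieldProperties F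

  -- Cancellation is asked on an arbitrary row vector, where each coordinate is a single polynomial
  -- identity; the matrix identities are its instances at the rows of `I`.
  mkProjectivity : (M N : Matrix) → (∀ x j → ((x ·ᵥ M) ·ᵥ N) j ≡ x j) →
                   (∀ x j → ((x ·ᵥ N) ·ᵥ M) j ≡ x j) → Projectivity
  mkProjectivity M N MN NM = record
    { matrix   = M
    ; matrix⁻¹ = N
    ; inverseˡ = rows N M NM
    ; inverseʳ = rows M N MN
    }
    where
    rows : ∀ M N → (∀ x j → ((x ·ᵥ M) ·ᵥ N) j ≡ x j) → ∀ i j → (M ·ₘ N) i j ≡ I i j
    rows M N MN i j =
      trans (·ᵥ-congʳ N (λ k → sym (·ₘ-identityˡ M i k)) j) (MN (I i) j)

  Vectorᴾ Matrixᴾ : ℕ → Set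
  Vectorᴾ n = Vector (Polynomial n) 4
  Matrixᴾ n = Vector (Vectorᴾ n) 4

  infixl 8 _·ᴾ_

  -- Nested to the right with a final zero, exactly as `sum` unfolds on four terms, so that its
  -- value is definitionally that of `_·ᵥ_`.
  _·ᴾ_ : ∀ {n} → Vectorᴾ n → Matrixᴾ n → Vectorᴾ n
  (x ·ᴾ M) j = x 0F :* M 0F j :+ (x 1F :* M 1F j :+ (x 2F :* M 2F j :+ (x 3F :* M 3F j :+ 𝟎)))

  𝟐 𝟑 : ∀ {n} → Polynomial n
  𝟐 = 𝟏 :+ 𝟏
  𝟑 = 𝟏 :+ 𝟏 :+ 𝟏

  2# : Carrier
  2# = 1# + 1#

  -- On the parameters of the cubic, lower t acts by s ↦ s + t and upper y by
  -- s ↦ s/(1 + y s); the names ending in ᴾ are copies of terms for the solver.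
  lower : Carrier → Matrix
  lower t = (1#           ∷ 0#     ∷ 0# ∷ 0# ∷ [])
          ∷ (3# * t       ∷ 1#     ∷ 0# ∷ 0# ∷ [])
          ∷ (3# * (t * t) ∷ 2# * t ∷ 1# ∷ 0# ∷ [])
          ∷ (t * t * t    ∷ t * t  ∷ t  ∷ 1# ∷ [])
          ∷ []

  lowerᴾ : ∀ {n} → Polynomial n → Matrixᴾ n
  lowerᴾ t = (𝟏             ∷ 𝟎      ∷ 𝟎 ∷ 𝟎 ∷ [])
           ∷ (𝟑 :* t        ∷ 𝟏      ∷ 𝟎 ∷ 𝟎 ∷ [])
           ∷ (𝟑 :* (t :* t) ∷ 𝟐 :* t ∷ 𝟏 ∷ 𝟎 ∷ [])
           ∷ (t :* t :* t   ∷ t :* t ∷ t ∷ 𝟏 ∷ [])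
           ∷ []

  upper : Carrier → Matrix
  upper y = (1# ∷ y  ∷ y * y  ∷ y * y * y    ∷ [])
          ∷ (0# ∷ 1# ∷ 2# * y ∷ 3# * (y * y) ∷ [])
          ∷ (0# ∷ 0# ∷ 1#     ∷ 3# * y       ∷ [])
          ∷ (0# ∷ 0# ∷ 0#     ∷ 1#           ∷ [])
          ∷ []

  upperᴾ : ∀ {n} → Polynomial n → Matrixᴾ n
  upperᴾ y = (𝟏 ∷ y ∷ y :* y ∷ y :* y :* y   ∷ [])
           ∷ (𝟎 ∷ 𝟏 ∷ 𝟐 :* y ∷ 𝟑 :* (y :* y) ∷ [])
           ∷ (𝟎 ∷ 𝟎 ∷ 𝟏      ∷ 𝟑 :* y        ∷ [])
           ∷ (𝟎 ∷ 𝟎 ∷ 𝟎      ∷ 𝟏             ∷ [])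
           ∷ []

  -- On the parameters this is s ↦ 1/s; it supplies the move from 0 to infinity, which no
  -- translation makes.
  reversal : Matrix
  reversal = I 3F ∷ I 2F ∷ I 1F ∷ I 0F ∷ []

  reversalᴾ : ∀ {n} → Matrixᴾ n
  reversalᴾ = (𝟎 ∷ 𝟎 ∷ 𝟎 ∷ 𝟏 ∷ [])
            ∷ (𝟎 ∷ 𝟎 ∷ 𝟏 ∷ 𝟎 ∷ [])
            ∷ (𝟎 ∷ 𝟏 ∷ 𝟎 ∷ 𝟎 ∷ [])
            ∷ (𝟏 ∷ 𝟎 ∷ 𝟎 ∷ 𝟎 ∷ [])
            ∷ []

  diagonalᴾ : ∀ {n} → Polynomial n → Matrixᴾ n
  diagonalᴾ d = (𝟏 ∷ 𝟎 ∷ 𝟎      ∷ 𝟎      ∷ [])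
              ∷ (𝟎 ∷ d ∷ 𝟎      ∷ 𝟎      ∷ [])
              ∷ (𝟎 ∷ 𝟎 ∷ d :^ 2 ∷ 𝟎      ∷ [])
              ∷ (𝟎 ∷ 𝟎 ∷ 𝟎      ∷ d :^ 3 ∷ [])
              ∷ []

  lower-cancel : ∀ t x j → ((x ·ᵥ lower t) ·ᵥ lower (- t)) j ≡ x j
  lower-cancel t x 0F = solve 5 (λ a b c d t → let x = a ∷ b ∷ c ∷ d ∷ [] in
    (x ·ᴾ lowerᴾ t ·ᴾ lowerᴾ (:- t)) 0F := a) refl (x 0F) (x 1F) (x 2F) (x 3F) t
  lower-cancel t x 1F = solve 5 (λ a b c d t → let x = a ∷ b ∷ c ∷ d ∷ [] in
    (x ·ᴾ lowerᴾ t ·ᴾ lowerᴾ (:- t)) 1F := b) refl (x 0F) (x 1F) (x 2F) (x 3F) t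
  lower-cancel t x 2F = solve 5 (λ a b c d t → let x = a ∷ b ∷ c ∷ d ∷ [] in
    (x ·ᴾ lowerᴾ t ·ᴾ lowerᴾ (:- t)) 2F := c) refl (x 0F) (x 1F) (x 2F) (x 3F) t
  lower-cancel t x 3F = solve 5 (λ a b c d t → let x = a ∷ b ∷ c ∷ d ∷ [] in
    (x ·ᴾ lowerᴾ t ·ᴾ lowerᴾ (:- t)) 3F := d) refl (x 0F) (x 1F) (x 2F) (x 3F) t

  upper-cancel : ∀ t x j → ((x ·ᵥ upper t) ·ᵥ upper (- t)) j ≡ x j
  upper-cancel t x 0F = solve 5 (λ a b c d t → let x = a ∷ b ∷ c ∷ d ∷ [] in
    (x ·ᴾ upperᴾ t ·ᴾ upperᴾ (:- t)) 0F := a) refl (x 0F) (x 1F) (x 2F) (x 3F) t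
  upper-cancel t x 1F = solve 5 (λ a b c d t → let x = a ∷ b ∷ c ∷ d ∷ [] in
    (x ·ᴾ upperᴾ t ·ᴾ upperᴾ (:- t)) 1F := b) refl (x 0F) (x 1F) (x 2F) (x 3F) t
  upper-cancel t x 2F = solve 5 (λ a b c d t → let x = a ∷ b ∷ c ∷ d ∷ [] in
    (x ·ᴾ upperᴾ t ·ᴾ upperᴾ (:- t)) 2F := c) refl (x 0F) (x 1F) (x 2F) (x 3F) t
  upper-cancel t x 3F = solve 5 (λ a b c d t → let x = a ∷ b ∷ c ∷ d ∷ [] in
    (x ·ᴾ upperᴾ t ·ᴾ upperᴾ (:- t)) 3F := d) refl (x 0F) (x 1F) (x 2F) (x 3F) t

  reversal-cancel : ∀ x j → ((x ·ᵥ reversal) ·ᵥ reversal) j ≡ x j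
  reversal-cancel x 0F = solve 4 (λ a b c d → let x = a ∷ b ∷ c ∷ d ∷ [] in
    (x ·ᴾ reversalᴾ ·ᴾ reversalᴾ) 0F := a) refl (x 0F) (x 1F) (x 2F) (x 3F)
  reversal-cancel x 1F = solve 4 (λ a b c d → let x = a ∷ b ∷ c ∷ d ∷ [] in
    (x ·ᴾ reversalᴾ ·ᴾ reversalᴾ) 1F := b) refl (x 0F) (x 1F) (x 2F) (x 3F)
  reversal-cancel x 2F = solve 4 (λ a b c d → let x = a ∷ b ∷ c ∷ d ∷ [] in
    (x ·ᴾ reversalᴾ ·ᴾ reversalᴾ) 2F := c) refl (x 0F) (x 1F) (x 2F) (x 3F)
  reversal-cancel x 3F = solve 4 (λ a b c d → let x = a ∷ b ∷ c ∷ d ∷ [] in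
    (x ·ᴾ reversalᴾ ·ᴾ reversalᴾ) 3F := d) refl (x 0F) (x 1F) (x 2F) (x 3F)

  diagonal-· : ∀ d x j → (x ·ᵥ diagonal d) j ≡ (x 0F ∷ x 1F * d ∷ x 2F * d ^ 2 ∷ x 3F * d ^ 3 ∷ []) j
  diagonal-· d x 0F = solve 5 (λ a b c e d → ((a ∷ b ∷ c ∷ e ∷ []) ·ᴾ diagonalᴾ d) 0F := a)
    refl (x 0F) (x 1F) (x 2F) (x 3F) d
  diagonal-· d x 1F = solve 5 (λ a b c e d → ((a ∷ b ∷ c ∷ e ∷ []) ·ᴾ diagonalᴾ d) 1F := b :* d)
    refl (x 0F) (x 1F) (x 2F) (x 3F) d
  diagonal-· d x 2F = solve 5 (λ a b c e d → ((a ∷ b ∷ c ∷ e ∷ []) ·ᴾ diagonalᴾ d) 2F := c :* d :^ 2)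
    refl (x 0F) (x 1F) (x 2F) (x 3F) d
  diagonal-· d x 3F = solve 5 (λ a b c e d → ((a ∷ b ∷ c ∷ e ∷ []) ·ᴾ diagonalᴾ d) 3F := e :* d :^ 3)
    refl (x 0F) (x 1F) (x 2F) (x 3F) d

  diagonal-cancel : ∀ {d e} → d * e ≡ 1# → ∀ x j → ((x ·ᵥ diagonal d) ·ᵥ diagonal e) j ≡ x j
  diagonal-cancel {d} {e} de≡1 x j = trans (diagonal-· e (x ·ᵥ diagonal d) j) (lemma j)
    where
    -- The equation d e = 1 is a hypothesis and not a polynomial identity, so powers are first
    -- collected into (d e)ⁿ and the hypothesis is substituted there.
    power : ∀ n x y → y ≡ x * d ^ n → d ^ n * e ^ n ≡ (d * e) ^ n → y * e ^ n ≡ x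
    power n x y y≡ h = begin
      y * e ^ n              ≡⟨ cong (_* e ^ n) y≡ ⟩
      x * d ^ n * e ^ n      ≡⟨ *-assoc x (d ^ n) (e ^ n) ⟩
      x * (d ^ n * e ^ n)    ≡⟨ cong (x *_) (trans h (trans (cong (_^ n) de≡1) (1^ n))) ⟩
      x * 1#                 ≡⟨ *-identityʳ x ⟩
      x                      ∎
      where
      open ≡-Reasoning
      1^ : ∀ n → 1# ^ n ≡ 1#
      1^ zero    = refl
      1^ (suc n) = trans (*-identityˡ _) (1^ n)
    lemma : ∀ j → ((x ·ᵥ diagonal d) 0F ∷ (x ·ᵥ diagonal d) 1F * e ∷ (x ·ᵥ diagonal d) 2F * e ^ 2
                    ∷ (x ·ᵥ diagonal d) 3F * e ^ 3 ∷ []) j ≡ x j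
    lemma 0F = diagonal-· d x 0F
    lemma 1F = trans (cong ((x ·ᵥ diagonal d) 1F *_) (sym (*-identityʳ e)))
      (power 1 (x 1F) _ (trans (diagonal-· d x 1F) (cong (x 1F *_) (sym (*-identityʳ d))))
        (solve 2 (λ d e → d :^ 1 :* e :^ 1 := (d :* e) :^ 1) refl d e))
    lemma 2F = power 2 (x 2F) _ (diagonal-· d x 2F)
      (solve 2 (λ d e → d :^ 2 :* e :^ 2 := (d :* e) :^ 2) refl d e)
    lemma 3F = power 3 (x 3F) _ (diagonal-· d x 3F)
      (solve 2 (λ d e → d :^ 3 :* e :^ 3 := (d :* e) :^ 3) refl d e)

  shift : Carrier → Projectivity
  shift t = mkProjectivity (lower t) (lower (- t)) (lower-cancel t)
    (subst (λ s → ∀ x j → ((x ·ᵥ lower (- t)) ·ᵥ lower s) j ≡ x j) (-‿involutive t) (lower-cancel (- t)))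

  shear : Carrier → Projectivity
  shear y = mkProjectivity (upper y) (upper (- y)) (upper-cancel y)
    (subst (λ s → ∀ x j → ((x ·ᵥ upper (- y)) ·ᵥ upper s) j ≡ x j) (-‿involutive y) (upper-cancel (- y)))

  flip : Projectivity
  flip = mkProjectivity reversal reversal reversal-cancel reversal-cancel

  dilation : ∀ d → d ≢ 0# → Projectivity
  dilation d d≢0 = let e , ed≡1 = inverse d d≢0 in
    mkProjectivity (diagonal d) (diagonal e)
      (diagonal-cancel (trans (*-comm d e) ed≡1)) (diagonal-cancel ed≡1)

-- A rearrangement in groups.

module GroupLemma {a ℓ} (𝒢 : Group a ℓ) where

  open Group 𝒢
  open GroupProperties 𝒢 using (//-rightDividesˡ)
  open import Relation.Binary.Reasoning.Setoid setoid

  -- Reads a normalisation backwards: an element reduced to `d` by undoing `f` and then `s` is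
  -- recovered as a product.
  //-//⇒∙∙ : ∀ x f s {d} → (x ∙ f ⁻¹) ∙ s ⁻¹ ≈ d → x ≈ d ∙ (s ∙ f)
  //-//⇒∙∙ x f s {d} e = begin
    x                                    ≈⟨ //-rightDividesˡ f x ⟨
    (x ∙ f ⁻¹) ∙ f                       ≈⟨ ∙-congʳ (//-rightDividesˡ s (x ∙ f ⁻¹)) ⟨
    (((x ∙ f ⁻¹) ∙ s ⁻¹) ∙ s) ∙ f        ≈⟨ assoc _ s f ⟩
    ((x ∙ f ⁻¹) ∙ s ⁻¹) ∙ (s ∙ f)        ≈⟨ ∙-congʳ e ⟩
    d ∙ (s ∙ f)                          ∎

-- The twisted cubic in homogeneous parameters.

module TwistedCubic {c} (F : Field c) {q : ℕ} (F↔Fin : Field.Carrier F ↔ Fin q)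
  (5≤q : 5 ℕ.≤ q) (2∤q : ¬ 2 ∣ q) where

  open PG3 F
  open SemiringSum semiring using (sum)
  open IntegerSolver (Field.commutativeRing F)
  open FieldProperties F
  open LineGeometry F
  open Generators F
  open OddFiniteField F F↔Fin 5≤q 2∤q
  open Subgroup G using (Member)
  open GroupLemma PGL

  -- The cubic in homogeneous parameters (a : b), where infinity is the ordinary value (1 : 0). The
  -- pair (0, 0) need not be excluded: it gives the zero vector, and only multiples that are
  -- coordinates of points are turned into cubic points.
  form : Carrier → Carrier → Coordinates
  form a b = a * a * a ∷ a * a * b ∷ a * b * b ∷ b * b * b ∷ []

  formᴾ : ∀ {n} → Polynomial n → Polynomial n → Vectorᴾ n
  formᴾ a b = a :* a :* a ∷ a :* a :* b ∷ a :* b :* b ∷ b :* b :* b ∷ []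

  form-lower : ∀ t a b j → (form a b ·ᵥ lower t) j ≡ form (a + t * b) b j
  form-lower t a b 0F = solve 3
      (λ t a b → (formᴾ a b ·ᴾ lowerᴾ t) 0F := formᴾ (a :+ t :* b) b 0F) refl t a b
  form-lower t a b 1F = solve 3
      (λ t a b → (formᴾ a b ·ᴾ lowerᴾ t) 1F := formᴾ (a :+ t :* b) b 1F) refl t a b
  form-lower t a b 2F = solve 3
      (λ t a b → (formᴾ a b ·ᴾ lowerᴾ t) 2F := formᴾ (a :+ t :* b) b 2F) refl t a b
  form-lower t a b 3F = solve 3
      (λ t a b → (formᴾ a b ·ᴾ lowerᴾ t) 3F := formᴾ (a :+ t :* b) b 3F) refl t a b

  form-upper : ∀ y a b j → (form a b ·ᵥ upper y) j ≡ form a (b + y * a) j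
  form-upper y a b 0F = solve 3
      (λ y a b → (formᴾ a b ·ᴾ upperᴾ y) 0F := formᴾ a (b :+ y :* a) 0F) refl y a b
  form-upper y a b 1F = solve 3
      (λ y a b → (formᴾ a b ·ᴾ upperᴾ y) 1F := formᴾ a (b :+ y :* a) 1F) refl y a b
  form-upper y a b 2F = solve 3
      (λ y a b → (formᴾ a b ·ᴾ upperᴾ y) 2F := formᴾ a (b :+ y :* a) 2F) refl y a b
  form-upper y a b 3F = solve 3
      (λ y a b → (formᴾ a b ·ᴾ upperᴾ y) 3F := formᴾ a (b :+ y :* a) 3F) refl y a b

  form-reversal : ∀ a b j → (form a b ·ᵥ reversal) j ≡ form b a j
  form-reversal a b 0F = solve 2 (λ a b → (formᴾ a b ·ᴾ reversalᴾ) 0F := formᴾ b a 0F) refl a b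
  form-reversal a b 1F = solve 2 (λ a b → (formᴾ a b ·ᴾ reversalᴾ) 1F := formᴾ b a 1F) refl a b
  form-reversal a b 2F = solve 2 (λ a b → (formᴾ a b ·ᴾ reversalᴾ) 2F := formᴾ b a 2F) refl a b
  form-reversal a b 3F = solve 2 (λ a b → (formᴾ a b ·ᴾ reversalᴾ) 3F := formᴾ b a 3F) refl a b

  form-diagonal : ∀ d a b j → (form a b ·ᵥ diagonal d) j ≡ form a (d * b) j
  form-diagonal d a b 0F = solve 3
      (λ d a b → (formᴾ a b ·ᴾ diagonalᴾ d) 0F := formᴾ a (d :* b) 0F) refl d a b
  form-diagonal d a b 1F = solve 3
      (λ d a b → (formᴾ a b ·ᴾ diagonalᴾ d) 1F := formᴾ a (d :* b) 1F) refl d a b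
  form-diagonal d a b 2F = solve 3
      (λ d a b → (formᴾ a b ·ᴾ diagonalᴾ d) 2F := formᴾ a (d :* b) 2F) refl d a b
  form-diagonal d a b 3F = solve 3
      (λ d a b → (formᴾ a b ·ᴾ diagonalᴾ d) 3F := formᴾ a (d :* b) 3F) refl d a b

  cubicPoint≡form : ∀ t i → coords (cubicPoint t) i ≡ form t 1# i
  cubicPoint≡form t 0F = solve 1 (λ t → t :^ 3 := t :* t :* t) refl t
  cubicPoint≡form t 1F = solve 1 (λ t → t :^ 2 := t :* t :* 𝟏) refl t
  cubicPoint≡form t 2F = solve 1 (λ t → t := t :* 𝟏 :* 𝟏) refl t
  cubicPoint≡form t 3F = solve 0 (𝟏 := 𝟏 :* 𝟏 :* 𝟏) refl

  cubicPoint∞≡form : ∀ i → coords cubicPoint∞ i ≡ form 1# 0# i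
  cubicPoint∞≡form 0F = solve 0 (𝟏 := 𝟏 :* 𝟏 :* 𝟏) refl
  cubicPoint∞≡form 1F = solve 0 (𝟎 := 𝟏 :* 𝟏 :* 𝟎) refl
  cubicPoint∞≡form 2F = solve 0 (𝟎 := 𝟏 :* 𝟎 :* 𝟎) refl
  cubicPoint∞≡form 3F = solve 0 (𝟎 := 𝟎 :* 𝟎 :* 𝟎) refl

  OnCubic⇒form : ∀ {P} → OnCubic P → ∃[ k ] ∃[ a ] ∃[ b ] (∀ i → coords P i ≡ k * form a b i)
  OnCubic⇒form (inj₁ (t , k , _ , e)) =
    k , t , 1# , λ i → trans (e i) (cong (k *_) (cubicPoint≡form t i))
  OnCubic⇒form (inj₂ (k , _ , e)) =
    k , 1# , 0# , λ i → trans (e i) (cong (k *_) (cubicPoint∞≡form i))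

  -- Lets scalars go untracked: a factor exhibiting a point as a multiple of some vector is nonzero
  -- because the point is.
  ∝-nonzero : ∀ P {k} {v : Coordinates} → (∀ i → coords P i ≡ k * v i) → k ≢ 0#
  ∝-nonzero P {k} {v} e refl = nonzero P (λ i → trans (e i) (zeroˡ (v i)))

  form⇒OnCubic : ∀ P {k} a b → (∀ i → coords P i ≡ k * form a b i) → OnCubic P
  form⇒OnCubic P {k} a b e with b ≟ 0#
  ... | yes refl = inj₂ (k * (a * a * a) , ∝-nonzero P {v = I 0F} e′ , e′)
    where
    e′ : ∀ i → coords P i ≡ k * (a * a * a) * coords cubicPoint∞ i
    e′ 0F = trans (e 0F) (solve 2 (λ k a → k :* (a :* a :* a) := k :* (a :* a :* a) :* 𝟏) refl k a)
    e′ 1F = trans (e 1F) (solve 2 (λ k a → k :* (a :* a :* 𝟎) := k :* (a :* a :* a) :* 𝟎) refl k a)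
    e′ 2F = trans (e 2F) (solve 2 (λ k a → k :* (a :* 𝟎 :* 𝟎) := k :* (a :* a :* a) :* 𝟎) refl k a)
    e′ 3F = trans (e 3F) (solve 2 (λ k a → k :* (𝟎 :* 𝟎 :* 𝟎) := k :* (a :* a :* a) :* 𝟎) refl k a)
  ... | no b≢0 = inj₁ (t , k * (b * b * b)
                      , ∝-nonzero P {v = coords (cubicPoint t)} e′ , e′)
    where
    b⁻¹ = proj₁ (inverse b b≢0)
    t = a * b⁻¹
    tb≡a : t * b ≡ a
    tb≡a = trans (*-assoc a b⁻¹ b) (trans (cong (a *_) (proj₂ (inverse b b≢0))) (*-identityʳ a))
    e″ : ∀ i → coords P i ≡ k * form (t * b) b i
    e″ i = trans (e i) (cong (λ a → k * form a b i) (sym tb≡a))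
    e′ : ∀ i → coords P i ≡ k * (b * b * b) * coords (cubicPoint t) i
    e′ 0F = trans (e″ 0F) (solve 3
        (λ k b t → k :* formᴾ (t :* b) b 0F := k :* (b :* b :* b) :* t :^ 3) refl k b t)
    e′ 1F = trans (e″ 1F) (solve 3
        (λ k b t → k :* formᴾ (t :* b) b 1F := k :* (b :* b :* b) :* t :^ 2) refl k b t)
    e′ 2F = trans (e″ 2F) (solve 3
        (λ k b t → k :* formᴾ (t :* b) b 2F := k :* (b :* b :* b) :* t) refl k b t)
    e′ 3F = trans (e″ 3F) (solve 3
        (λ k b t → k :* formᴾ (t :* b) b 3F := k :* (b :* b :* b) :* 𝟏) refl k b t)

  -- Only a necessary condition: the two quadrics also share the line x₁ = x₂ = 0.
  OnCubic⇒quadrics : ∀ {P} → OnCubic P → let x = coords P in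
                     x 0F * x 2F ≡ x 1F * x 1F × x 1F * x 3F ≡ x 2F * x 2F
  OnCubic⇒quadrics {P} on with OnCubic⇒form {P} on
  ... | k , a , b , e =
      trans (cong₂ _*_ (e 0F) (e 2F)) (trans
        (solve 3 (λ k a b → k :* formᴾ a b 0F :* (k :* formᴾ a b 2F) :=
                            k :* formᴾ a b 1F :* (k :* formᴾ a b 1F)) refl k a b)
        (sym (cong₂ _*_ (e 1F) (e 1F))))
    , trans (cong₂ _*_ (e 1F) (e 3F)) (trans
        (solve 3 (λ k a b → k :* formᴾ a b 1F :* (k :* formᴾ a b 3F) :=
                            k :* formᴾ a b 2F :* (k :* formᴾ a b 2F)) refl k a b)
        (sym (cong₂ _*_ (e 2F) (e 2F))))

  -- Membership of the generators in `G`.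

  FormPreserving : Matrix → Set c
  FormPreserving M = ∀ a b → ∃[ a′ ] ∃[ b′ ] (∀ j → (form a b ·ᵥ M) j ≡ form a′ b′ j)

  -- Reflecting the cubic is preserving it under the inverse, so membership splits into the same
  -- condition on the two matrices.
  G-intro : ∀ φ → FormPreserving (matrix φ) → FormPreserving (matrix⁻¹ φ) → Member φ
  G-intro φ pres pres⁻¹ P = mk⇔ (forward φ pres P) λ on →
    OnCubic-resp {(P · φ) · (φ ⁻¹ₚ)} {P} (·-cancel P φ (φ ⁻¹ₚ) (∝ₘ-refl (inverseʳ φ)))
      (forward (φ ⁻¹ₚ) pres⁻¹ (P · φ) on)
    where
    forward : ∀ φ → FormPreserving (matrix φ) → ∀ P → OnCubic P → OnCubic (P · φ)
    forward φ pres P on =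
      let k , a , b , e = OnCubic⇒form {P} on
          a′ , b′ , f = pres a b
      in form⇒OnCubic (P · φ) {k} a′ b′ λ j →
           trans (·ᵥ-congʳ (matrix φ) e j)
           (trans (·ᵥ-scaleˡ k (form a b) (matrix φ) j) (cong (k *_) (f j)))

  shift∈G : ∀ t → Member (shift t)
  shift∈G t = G-intro (shift t) (pres t) (pres (- t))
    where
    pres : ∀ t → FormPreserving (lower t)
    pres t a b = a + t * b , b , form-lower t a b

  shear∈G : ∀ y → Member (shear y)
  shear∈G y = G-intro (shear y) (pres y) (pres (- y))
    where
    pres : ∀ y → FormPreserving (upper y)
    pres y a b = a , b + y * a , form-upper y a b

  flip∈G : Member flip
  flip∈G = G-intro flip pres pres
    where
    pres : FormPreserving reversal
    pres a b = b , a , form-reversal a b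

  dilation∈G : ∀ d d≢0 → Member (dilation d d≢0)
  dilation∈G d d≢0 = G-intro (dilation d d≢0) (pres d) (pres (proj₁ (inverse d d≢0)))
    where
    pres : ∀ d → FormPreserving (diagonal d)
    pres d a b = a , d * b , form-diagonal d a b

  -- Transitivity on the cubic, and osculating planes.

  O : Point
  O = p₁ ℓ₁

  -- `Maybe Carrier` is the projective line of parameters with `nothing` as infinity; `frame r` is a
  -- chosen element taking `O` to the cubic point of parameter `r`.
  frame : Maybe Carrier → Projectivity
  frame (just t) = shift t
  frame nothing  = flip

  frame∈G : ∀ r → Member (frame r)
  frame∈G (just t) = shift∈G t
  frame∈G nothing  = flip∈G

  O∈cubic : OnCubic O
  O∈cubic = form⇒OnCubic O {1#} 0# 1# λ
    { 0F → solve 0 (𝟎 := 𝟏 :* formᴾ 𝟎 𝟏 0F) refl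
    ; 1F → solve 0 (𝟎 := 𝟏 :* formᴾ 𝟎 𝟏 1F) refl
    ; 2F → solve 0 (𝟎 := 𝟏 :* formᴾ 𝟎 𝟏 2F) refl
    ; 3F → solve 0 (𝟏 := 𝟏 :* formᴾ 𝟎 𝟏 3F) refl
    }

  O·shift : ∀ t → O · shift t ≈ cubicPoint t
  O·shift t = ∝-refl λ j → trans (·ₘ-identityˡ (lower t) 3F j) (lemma j)
    where
    lemma : ∀ j → lower t 3F j ≡ coords (cubicPoint t) j
    lemma 0F = solve 1 (λ t → t :* t :* t := t :^ 3) refl t
    lemma 1F = solve 1 (λ t → t :* t := t :^ 2) refl t
    lemma 2F = refl
    lemma 3F = refl

  O·flip : O · flip ≈ cubicPoint∞
  O·flip = ∝-refl (·ₘ-identityˡ reversal 3F)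

  OnCubic⇒frame : ∀ {P} → OnCubic P → ∃[ r ] O · frame r ≈ P
  OnCubic⇒frame {P} (inj₁ (t , e)) =
    just t , ≈.trans {O · shift t} {cubicPoint t} {P} (O·shift t) (≈.sym {P} {cubicPoint t} e)
  OnCubic⇒frame {P} (inj₂ e) =
    nothing , ≈.trans {O · flip} {cubicPoint∞} {P} O·flip (≈.sym {P} {cubicPoint∞} e)

  osculating : Maybe Carrier → Plane
  osculating (just t) = osculatingPlane t
  osculating nothing  = osculatingPlane∞

  -- The osculating plane at O is x₀ = 0.
  osculating-frame : ∀ r v →
    sum (λ i → coeffs (osculating r) i * v i) ≡ (v ·ᵥ matrix⁻¹ (frame r)) 0F
  osculating-frame (just t) v = solve 5 (λ a b c d t →
      𝟏 :* a :+ ((:- (𝟑 :* t)) :* b :+ (𝟑 :* t :^ 2 :* c :+ ((:- (t :^ 3)) :* d :+ 𝟎))) :=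
      ((a ∷ b ∷ c ∷ d ∷ []) ·ᴾ lowerᴾ (:- t)) 0F)
    refl (v 0F) (v 1F) (v 2F) (v 3F) t
  osculating-frame nothing v = solve 4 (λ a b c d →
      𝟎 :* a :+ (𝟎 :* b :+ (𝟎 :* c :+ (𝟏 :* d :+ 𝟎))) :=
      ((a ∷ b ∷ c ∷ d ∷ []) ·ᴾ reversalᴾ) 0F)
    refl (v 0F) (v 1F) (v 2F) (v 3F)

  Oᴾ : ∀ {n} → Vectorᴾ n
  Oᴾ = 𝟎 ∷ 𝟎 ∷ 𝟎 ∷ 𝟏 ∷ []

  -- The contact of an osculating plane is triple: for finite parameters the incidence is (t - u)³ =
  -- 0. If exactly one parameter is infinite the value is 1.
  osculating-unique : ∀ r u → sum (λ i → coeffs (osculating u) i * coords (O · frame r) i) ≡ 0# → r ≡ u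
  osculating-unique r u e = lemma r u (trans (sym (osculating-frame u (coords (O · frame r)))) e)
    where
    lemma : ∀ r u → (coords (O · frame r) ·ᵥ matrix⁻¹ (frame u)) 0F ≡ 0# → r ≡ u
    lemma (just t) (just u) e = cong just (x-y≡0⇒x≡y
      ([ id , x²≡0⇒x≡0 ]′ (*-zero-product (trans
        (solve 2 (λ t u → (t :+ (:- u)) :* ((t :+ (:- u)) :* (t :+ (:- u))) :=
                          (Oᴾ ·ᴾ lowerᴾ t ·ᴾ lowerᴾ (:- u)) 0F) refl t u) e))))
    lemma (just t) nothing e = contradiction (trans
        (solve 1 (λ t → 𝟏 := (Oᴾ ·ᴾ lowerᴾ t ·ᴾ reversalᴾ) 0F) refl t) e) 1≢0
    lemma nothing (just u) e = contradiction (trans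
        (solve 1 (λ t → 𝟏 := (Oᴾ ·ᴾ reversalᴾ ·ᴾ lowerᴾ (:- t)) 0F) refl u) e) 1≢0
    lemma nothing nothing e = refl

  -- Elements of `G` that fix two points of the cubic.

  module _ (φ : Projectivity) where

    private
      M = matrix φ

    -- Once the outer rows are known, a factor `t` splits off the first three coordinates. It is
    -- displayed because it is the source of the factors t² and t removed from the quadrics.
    cubicPoint-· : ∀ t m n → (∀ j → M 0F j ≡ m * I 0F j) → (∀ j → M 3F j ≡ n * I 3F j) →
      let x = coords (cubicPoint t · φ) in
        x 0F ≡ t * (M 2F 0F + M 1F 0F * t + m * (t * t))
      × x 1F ≡ t * (M 2F 1F + M 1F 1F * t)
      × x 2F ≡ t * (M 2F 2F + M 1F 2F * t)
      × x 3F ≡ n + M 2F 3F * t + M 1F 3F * (t * t)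
    cubicPoint-· t m n row₀ row₃ =
        trans (substitute 0F) (solve 5 (λ m n t a b →
          t :^ 3 :* (m :* 𝟏) :+ (t :^ 2 :* a :+ (t :* b :+ (𝟏 :* (n :* 𝟎) :+ 𝟎))) :=
          t :* (b :+ a :* t :+ m :* (t :* t))) refl m n t (M 1F 0F) (M 2F 0F))
      , trans (substitute 1F) (solve 5 (λ m n t a b →
          t :^ 3 :* (m :* 𝟎) :+ (t :^ 2 :* a :+ (t :* b :+ (𝟏 :* (n :* 𝟎) :+ 𝟎))) :=
          t :* (b :+ a :* t)) refl m n t (M 1F 1F) (M 2F 1F))
      , trans (substitute 2F) (solve 5 (λ m n t a b →
          t :^ 3 :* (m :* 𝟎) :+ (t :^ 2 :* a :+ (t :* b :+ (𝟏 :* (n :* 𝟎) :+ 𝟎))) :=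
          t :* (b :+ a :* t)) refl m n t (M 1F 2F) (M 2F 2F))
      , trans (substitute 3F) (solve 5 (λ m n t a b →
          t :^ 3 :* (m :* 𝟎) :+ (t :^ 2 :* a :+ (t :* b :+ (𝟏 :* (n :* 𝟏) :+ 𝟎))) :=
          n :+ b :* t :+ a :* (t :* t)) refl m n t (M 1F 3F) (M 2F 3F))
      where
      substitute : ∀ j → (coords (cubicPoint t) ·ᵥ M) j ≡
        t ^ 3 * (m * I 0F j) + (t ^ 2 * M 1F j + (t * M 2F j + (1# * (n * I 3F j) + 0#)))
      substitute j = cong₂
        (λ x y → t ^ 3 * x + (t ^ 2 * M 1F j + (t * M 2F j + (1# * y + 0#)))) (row₀ j) (row₃ j)

    -- A zero column would annihilate the corresponding diagonal entry of the inverse times the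
    -- matrix. This excludes the degenerate solutions of the quadric equations, the maps into the
    -- line x₁ = x₂ = 0.
    column₁≢0 : M 0F 1F ≡ 0# → M 1F 1F ≡ 0# → M 2F 1F ≡ 0# → ¬ M 3F 1F ≡ 0#
    column₁≢0 e₀ e₁ e₂ e₃ = 1≢0 (begin
      1#
        ≡⟨ inverseˡ φ 1F 1F ⟨
      N 0F * M 0F 1F + (N 1F * M 1F 1F + (N 2F * M 2F 1F + (N 3F * M 3F 1F + 0#)))
        ≡⟨ cong₂ (λ x y → N 0F * x + (N 1F * y + (N 2F * M 2F 1F + (N 3F * M 3F 1F + 0#)))) e₀ e₁ ⟩
      N 0F * 0# + (N 1F * 0# + (N 2F * M 2F 1F + (N 3F * M 3F 1F + 0#)))
        ≡⟨ cong₂ (λ x y → N 0F * 0# + (N 1F * 0# + (N 2F * x + (N 3F * y + 0#)))) e₂ e₃ ⟩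
      N 0F * 0# + (N 1F * 0# + (N 2F * 0# + (N 3F * 0# + 0#)))
        ≡⟨ solve 4 (λ a b c d → a :* 𝟎 :+ (b :* 𝟎 :+ (c :* 𝟎 :+ (d :* 𝟎 :+ 𝟎))) := 𝟎) refl
             (N 0F) (N 1F) (N 2F) (N 3F) ⟩
      0# ∎)
      where
      open ≡-Reasoning
      N = matrix⁻¹ φ 1F

  quadric₀₂-cofactor : ∀ m a₀ a₁ a₂ b₀ b₁ b₂ t → (t * t) *
      cubic (b₀ * b₂ + - (b₁ * b₁)) (b₀ * a₂ + a₀ * b₂ + - (2# * (a₁ * b₁)))
            (a₀ * a₂ + m * b₂ + - (a₁ * a₁)) (m * a₂) t ≡
    (t * (b₀ + a₀ * t + m * (t * t))) * (t * (b₂ + a₂ * t)) +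
    - ((t * (b₁ + a₁ * t)) * (t * (b₁ + a₁ * t)))
  quadric₀₂-cofactor = solve 8 (λ m a₀ a₁ a₂ b₀ b₁ b₂ t → (t :* t) :*
      ((b₀ :* b₂ :+ (:- (b₁ :* b₁)))
      :+ (b₀ :* a₂ :+ a₀ :* b₂ :+ (:- (𝟐 :* (a₁ :* b₁)))) :* t
      :+ (a₀ :* a₂ :+ m :* b₂ :+ (:- (a₁ :* a₁))) :* (t :* t)
      :+ (m :* a₂) :* (t :* t :* t)) :=
    (t :* (b₀ :+ a₀ :* t :+ m :* (t :* t))) :* (t :* (b₂ :+ a₂ :* t)) :+
    (:- ((t :* (b₁ :+ a₁ :* t)) :* (t :* (b₁ :+ a₁ :* t))))) refl

  quadric₁₃-cofactor : ∀ n a₁ a₂ a₃ b₁ b₂ b₃ t → t *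
      cubic (b₁ * n) (b₁ * b₃ + a₁ * n + - (b₂ * b₂))
            (b₁ * a₃ + a₁ * b₃ + - (2# * (a₂ * b₂))) (a₁ * a₃ + - (a₂ * a₂)) t ≡
    (t * (b₁ + a₁ * t)) * (n + b₃ * t + a₃ * (t * t)) +
    - ((t * (b₂ + a₂ * t)) * (t * (b₂ + a₂ * t)))
  quadric₁₃-cofactor = solve 8 (λ n a₁ a₂ a₃ b₁ b₂ b₃ t → t :*
      (b₁ :* n
      :+ (b₁ :* b₃ :+ a₁ :* n :+ (:- (b₂ :* b₂))) :* t
      :+ (b₁ :* a₃ :+ a₁ :* b₃ :+ (:- (𝟐 :* (a₂ :* b₂)))) :* (t :* t)
      :+ (a₁ :* a₃ :+ (:- (a₂ :* a₂))) :* (t :* t :* t)) :=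
    (t :* (b₁ :+ a₁ :* t)) :* (n :+ b₃ :* t :+ a₃ :* (t :* t)) :+
    (:- ((t :* (b₂ :+ a₂ :* t)) :* (t :* (b₂ :+ a₂ :* t))))) refl

  -- Pulled back to the cubic, the quadrics x₀x₂ = x₁² and x₁x₃ = x₂² become
  -- polynomials in t with cubic cofactors of t² and t; these vanish at q − 1 ≥ 4
  -- points, hence identically.
  quadric-coefficients : ∀ {m n a₀ a₁ a₂ a₃ b₀ b₁ b₂ b₃} →
    (∀ t → (t * (b₀ + a₀ * t + m * (t * t))) * (t * (b₂ + a₂ * t)) ≡
           (t * (b₁ + a₁ * t)) * (t * (b₁ + a₁ * t))) →
    (∀ t → (t * (b₁ + a₁ * t)) * (n + b₃ * t + a₃ * (t * t)) ≡
           (t * (b₂ + a₂ * t)) * (t * (b₂ + a₂ * t))) →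
      (b₀ * b₂ + - (b₁ * b₁) ≡ 0#
      × b₀ * a₂ + a₀ * b₂ + - (2# * (a₁ * b₁)) ≡ 0#
      × a₀ * a₂ + m * b₂ + - (a₁ * a₁) ≡ 0#
      × m * a₂ ≡ 0#)
    × (b₁ * n ≡ 0#
      × b₁ * b₃ + a₁ * n + - (b₂ * b₂) ≡ 0#
      × b₁ * a₃ + a₁ * b₃ + - (2# * (a₂ * b₂)) ≡ 0#
      × a₁ * a₃ + - (a₂ * a₂) ≡ 0#)
  quadric-coefficients {m} {n} {a₀} {a₁} {a₂} {a₃} {b₀} {b₁} {b₂} {b₃} e f =
    let r , r-injective , r≢0 = four-nonzero in
      cubic-roots r-injective (λ i → *≡0⇒≡0 (nonzero-* (r≢0 i) (r≢0 i))
        (trans (quadric₀₂-cofactor m a₀ a₁ a₂ b₀ b₁ b₂ (r i)) (x≡y⇒x-y≡0 (e (r i)))))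
    , cubic-roots r-injective (λ i → *≡0⇒≡0 (r≢0 i)
        (trans (quadric₁₃-cofactor n a₁ a₂ a₃ b₁ b₂ b₃ (r i)) (x≡y⇒x-y≡0 (f (r i)))))

  -- The equations are solved from the outside in. The extreme ones give a₂ = 0 and b₁ = 0; then m
  -- b₂ = a₁² and a₁ n = b₂² put m, a₁, b₂, n in geometric progression with ratio d = a₁/m. Since a₁
  -- and b₂ are now nonzero, the other four equations kill a₀, b₀, a₃, b₃.
  diagonal-coefficients : ∀ {m n a₀ a₁ a₂ a₃ b₀ b₁ b₂ b₃} → m ≢ 0# → n ≢ 0# →
      (b₀ * b₂ + - (b₁ * b₁) ≡ 0#
      × b₀ * a₂ + a₀ * b₂ + - (2# * (a₁ * b₁)) ≡ 0#
      × a₀ * a₂ + m * b₂ + - (a₁ * a₁) ≡ 0#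
      × m * a₂ ≡ 0#) →
      (b₁ * n ≡ 0#
      × b₁ * b₃ + a₁ * n + - (b₂ * b₂) ≡ 0#
      × b₁ * a₃ + a₁ * b₃ + - (2# * (a₂ * b₂)) ≡ 0#
      × a₁ * a₃ + - (a₂ * a₂) ≡ 0#) →
    (a₁ ≡ 0# → ¬ b₁ ≡ 0#) →
    ∃[ d ] d ≢ 0# × (a₀ ≡ 0# × a₁ ≡ m * d × a₂ ≡ 0# × a₃ ≡ 0#)
                  × (b₀ ≡ 0# × b₁ ≡ 0# × b₂ ≡ m * d ^ 2 × b₃ ≡ 0#) × n ≡ m * d ^ 3
  diagonal-coefficients {m} {n} {a₀} {a₁} {a₂} {a₃} {b₀} {b₁} {b₂} {b₃}
    m≢0 n≢0 (A₀ , A₁ , A₂ , A₃) (B₀ , B₁ , B₂ , B₃) independent =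
    simplify (*≡0⇒≡0 m≢0 A₃) (*≡0⇒≡0 n≢0 (trans (*-comm n b₁) B₀))
    where
    open ≡-Reasoning
    m⁻¹ = proj₁ (inverse m m≢0)
    d = m⁻¹ * a₁
    a₁≡md : a₁ ≡ m * d
    a₁≡md = begin
      a₁             ≡⟨ *-identityˡ a₁ ⟨
      1# * a₁        ≡⟨ cong (_* a₁) (trans (*-comm m m⁻¹) (proj₂ (inverse m m≢0))) ⟨
      m * m⁻¹ * a₁   ≡⟨ *-assoc m m⁻¹ a₁ ⟩
      m * d          ∎
    simplify : a₂ ≡ 0# → b₁ ≡ 0# →
      ∃[ d ] d ≢ 0# × (a₀ ≡ 0# × a₁ ≡ m * d × a₂ ≡ 0# × a₃ ≡ 0#)
                    × (b₀ ≡ 0# × b₁ ≡ 0# × b₂ ≡ m * d ^ 2 × b₃ ≡ 0#) × n ≡ m * d ^ 3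
    -- Matching replaces `a₂` and `b₁` by zero in the remaining equations; hence the `𝟎` in their
    -- places in the identities below.
    simplify refl refl = d , d≢0
      , (a₀≡0 , a₁≡md , refl , a₃≡0) , (b₀≡0 , refl , b₂≡md² , b₃≡0) , n≡md³
      where
      a₁≢0 : a₁ ≢ 0#
      a₁≢0 e = independent e refl
      d≢0 : d ≢ 0#
      d≢0 = nonzero-* (nonzero-inverse m≢0) a₁≢0
      b₂≡md² : b₂ ≡ m * d ^ 2
      b₂≡md² = *-cancelˡ-nonzero m≢0 (x-y≡0⇒x≡y (begin
        m * b₂ + - (m * (m * d ^ 2))
          ≡⟨ solve 4 (λ a m b d → m :* b :+ (:- (m :* (m :* d :^ 2))) :=
               a :* 𝟎 :+ m :* b :+ (:- ((m :* d) :* (m :* d)))) refl a₀ m b₂ d ⟩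
        a₀ * 0# + m * b₂ + - ((m * d) * (m * d))
          ≡⟨ cong (λ x → a₀ * 0# + m * b₂ + - (x * x)) a₁≡md ⟨
        a₀ * 0# + m * b₂ + - (a₁ * a₁)
          ≡⟨ A₂ ⟩
        0# ∎))
      b₂≢0 : b₂ ≢ 0#
      b₂≢0 e = nonzero-* m≢0 (nonzero-* d≢0 (nonzero-* d≢0 1≢0)) (trans (sym b₂≡md²) e)
      n≡md³ : n ≡ m * d ^ 3
      n≡md³ = *-cancelˡ-nonzero (nonzero-* m≢0 d≢0) (x-y≡0⇒x≡y (begin
        (m * d) * n + - ((m * d) * (m * d ^ 3))
          ≡⟨ solve 4 (λ b m n d → (m :* d) :* n :+ (:- ((m :* d) :* (m :* d :^ 3))) :=
               𝟎 :* b :+ (m :* d) :* n :+ (:- ((m :* d :^ 2) :* (m :* d :^ 2)))) refl b₃ m n d ⟩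
        0# * b₃ + (m * d) * n + - ((m * d ^ 2) * (m * d ^ 2))
          ≡⟨ cong₂ (λ a b → 0# * b₃ + a * n + - (b * b)) a₁≡md b₂≡md² ⟨
        0# * b₃ + a₁ * n + - (b₂ * b₂)
          ≡⟨ B₁ ⟩
        0# ∎))
      a₀≡0 : a₀ ≡ 0#
      a₀≡0 = *≡0⇒≡0 b₂≢0 (trans
        (solve 4 (λ a₀ a₁ b₀ b₂ → b₂ :* a₀ := b₀ :* 𝟎 :+ a₀ :* b₂ :+ (:- (𝟐 :* (a₁ :* 𝟎)))) refl
          a₀ a₁ b₀ b₂) A₁)
      b₀≡0 : b₀ ≡ 0#
      b₀≡0 = *≡0⇒≡0 b₂≢0 (trans
        (solve 2 (λ b₀ b₂ → b₂ :* b₀ := b₀ :* b₂ :+ (:- (𝟎 :* 𝟎))) refl b₀ b₂) A₀)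
      a₃≡0 : a₃ ≡ 0#
      a₃≡0 = *≡0⇒≡0 a₁≢0 (trans
        (solve 2 (λ a₁ a₃ → a₁ :* a₃ := a₁ :* a₃ :+ (:- (𝟎 :* 𝟎))) refl a₁ a₃) B₃)
      b₃≡0 : b₃ ≡ 0#
      b₃≡0 = *≡0⇒≡0 a₁≢0 (trans
        (solve 4 (λ a₁ a₃ b₂ b₃ → a₁ :* b₃ := 𝟎 :* a₃ :+ a₁ :* b₃ :+ (:- (𝟐 :* (𝟎 :* b₂)))) refl
          a₁ a₃ b₂ b₃) B₂)

  G-fixing-O-∞ : ∀ φ → Member φ → O · φ ≈ O → cubicPoint∞ · φ ≈ cubicPoint∞ →
                 ∃[ d ] d ≢ 0# × matrix φ ∝ₘ diagonal d
  G-fixing-O-∞ φ φ∈G (n , n≢0 , O-fixed) (m , m≢0 , ∞-fixed) =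
    let A , B = quadric-coefficients {m} {n} {M 1F 0F} {M 1F 1F} {M 1F 2F} {M 1F 3F}
                  {M 2F 0F} {M 2F 1F} {M 2F 2F} {M 2F 3F} quadric₀₂ quadric₁₃
        d , d≢0 , (a₀ , a₁ , a₂ , a₃) , (b₀ , b₁ , b₂ , b₃) , n≡ =
          diagonal-coefficients {m} {n} {M 1F 0F} {M 1F 1F} {M 1F 2F} {M 1F 3F}
            {M 2F 0F} {M 2F 1F} {M 2F 2F} {M 2F 3F} m≢0 n≢0 A B
            (λ a₁≡0 b₁≡0 → column₁≢0 φ (off 0F (row₀ 1F)) a₁≡0 b₁≡0 (off 3F (row₃ 1F)))
    in d , d≢0 , m , m≢0 , λ
      { 0F j → row₀ j
      ; 1F 0F → zero-entry a₀ ; 1F 1F → a₁ ; 1F 2F → zero-entry a₂ ; 1F 3F → zero-entry a₃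
      ; 2F 0F → zero-entry b₀ ; 2F 1F → zero-entry b₁ ; 2F 2F → b₂ ; 2F 3F → zero-entry b₃
      ; 3F 0F → zero-entry (off 3F (row₃ 0F)) ; 3F 1F → zero-entry (off 3F (row₃ 1F))
      ; 3F 2F → zero-entry (off 3F (row₃ 2F))
      ; 3F 3F → trans (row₃ 3F) (trans (*-identityʳ n) n≡)
      }
    where
    M = matrix φ
    -- The two fixed points are the outer coordinate points, so they determine the outer rows up to
    -- the scalars `m` and `n`.
    row₀ : ∀ j → M 0F j ≡ m * I 0F j
    row₀ j = trans (sym (·ₘ-identityˡ M 0F j)) (∞-fixed j)
    row₃ : ∀ j → M 3F j ≡ n * I 3F j
    row₃ j = trans (sym (·ₘ-identityˡ M 3F j)) (O-fixed j)
    off : ∀ i {j k} → M i j ≡ k * 0# → M i j ≡ 0#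
    off i {k = k} e = trans e (zeroʳ k)
    zero-entry : ∀ {x} → x ≡ 0# → x ≡ m * 0#
    zero-entry e = trans e (sym (zeroʳ m))
    quadrics : ∀ t → let x = coords (cubicPoint t · φ) in
               x 0F * x 2F ≡ x 1F * x 1F × x 1F * x 3F ≡ x 2F * x 2F
    quadrics t = OnCubic⇒quadrics {cubicPoint t · φ}
      (Equivalence.to (φ∈G (cubicPoint t)) (inj₁ (t , ≈.refl {cubicPoint t})))
    x = λ t → cubicPoint-· φ t m n row₀ row₃
    quadric₀₂ : ∀ t → (t * (M 2F 0F + M 1F 0F * t + m * (t * t))) * (t * (M 2F 2F + M 1F 2F * t)) ≡
                      (t * (M 2F 1F + M 1F 1F * t)) * (t * (M 2F 1F + M 1F 1F * t))
    quadric₀₂ t = let x₀ , x₁ , x₂ , _ = x t in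
      trans (sym (cong₂ _*_ x₀ x₂)) (trans (proj₁ (quadrics t)) (cong₂ _*_ x₁ x₁))
    quadric₁₃ : ∀ t → (t * (M 2F 1F + M 1F 1F * t)) * (n + M 2F 3F * t + M 1F 3F * (t * t)) ≡
                      (t * (M 2F 2F + M 1F 2F * t)) * (t * (M 2F 2F + M 1F 2F * t))
    quadric₁₃ t = let _ , x₁ , x₂ , x₃ = x t in
      trans (sym (cong₂ _*_ x₁ x₃)) (trans (proj₂ (quadrics t)) (cong₂ _*_ x₂ x₂))

  -- Decomposition of the elements of `G`.

  ∘∈G : ∀ φ ψ → Member φ → Member ψ → Member (φ ∘ₚ ψ)
  ∘∈G φ ψ = Subgroup.∙-closed G {φ} {ψ}

  ⁻¹∈G : ∀ φ → Member φ → Member (φ ⁻¹ₚ)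
  ⁻¹∈G φ = Subgroup.⁻¹-closed G {φ}

  ·-invert : ∀ P Q φ → P · φ ≈ Q → Q · (φ ⁻¹ₚ) ≈ P
  ·-invert P Q φ e = ≈.trans {Q · (φ ⁻¹ₚ)} {(P · φ) · (φ ⁻¹ₚ)} {P}
    (·-congˡ {Q} {P · φ} (φ ⁻¹ₚ) (≈.sym {P · φ} {Q} e))
    (·-cancel P φ (φ ⁻¹ₚ) (∝ₘ-refl (inverseʳ φ)))

  ∘-fixes : ∀ P Q R φ ψ → P · φ ≈ Q → Q · ψ ≈ R → P · (φ ∘ₚ ψ) ≈ R
  ∘-fixes P Q R φ ψ e f = ≈.trans {P · (φ ∘ₚ ψ)} {(P · φ) · ψ} {R}
    (≈.sym {(P · φ) · ψ} {P · (φ ∘ₚ ψ)} (·-∘ P φ ψ))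
    (≈.trans {(P · φ) · ψ} {Q · ψ} {R} (·-congˡ {P · φ} {Q} ψ e) f)

  ∞≉O : ¬ cubicPoint∞ ≈ O
  ∞≉O (k , _ , e) = 1≢0 (trans (e 0F) (zeroʳ k))

  O·shear : ∀ y → O · shear y ≈ O
  O·shear y = ∝-refl (·ₘ-identityˡ (upper y) 3F)

  -- In homogeneous parameters `O` is (0 : 1), so any other cubic point (a : b) has a ≠ 0 and is the
  -- image of (1 : 0) under the shear by b/a.
  shear-transitive : ∀ Q → OnCubic Q → ¬ Q ≈ O → ∃[ y ] cubicPoint∞ · shear y ≈ Q
  shear-transitive Q on Q≉O =
    let k , a , b , e = OnCubic⇒form {Q} on in
    case k a b e (a ≟ 0#)
    where
    case : ∀ k a b → (∀ i → coords Q i ≡ k * form a b i) → Dec (a ≡ 0#) →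
           ∃[ y ] cubicPoint∞ · shear y ≈ Q
    case k a b e (yes refl) = contradiction (k * (b * b * b) , ∝-nonzero Q e′ , e′) Q≉O
      where
      e′ : ∀ i → coords Q i ≡ k * (b * b * b) * coords O i
      e′ 0F = trans (e 0F) (solve 2 (λ k b → k :* (𝟎 :* 𝟎 :* 𝟎) := k :* (b :* b :* b) :* 𝟎) refl k b)
      e′ 1F = trans (e 1F) (solve 2 (λ k b → k :* (𝟎 :* 𝟎 :* b) := k :* (b :* b :* b) :* 𝟎) refl k b)
      e′ 2F = trans (e 2F) (solve 2 (λ k b → k :* (𝟎 :* b :* b) := k :* (b :* b :* b) :* 𝟎) refl k b)
      e′ 3F = trans (e 3F) (solve 2 (λ k b → k :* (b :* b :* b) := k :* (b :* b :* b) :* 𝟏) refl k b)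
    case k a b e (no a≢0) = y , ≈.sym {Q} {cubicPoint∞ · shear y} (k * (a * a * a) , ∝-nonzero Q e′ , e′)
      where
      a⁻¹ = proj₁ (inverse a a≢0)
      y = b * a⁻¹
      ya≡b : y * a ≡ b
      ya≡b = trans (*-assoc b a⁻¹ a) (trans (cong (b *_) (proj₂ (inverse a a≢0))) (*-identityʳ b))
      homogenise : ∀ y i → k * form a (y * a) i ≡ k * (a * a * a) * upper y 0F i
      homogenise y 0F = solve 3
          (λ k a y → k :* formᴾ a (y :* a) 0F := k :* (a :* a :* a) :* upperᴾ y 0F 0F) refl k a y
      homogenise y 1F = solve 3
          (λ k a y → k :* formᴾ a (y :* a) 1F := k :* (a :* a :* a) :* upperᴾ y 0F 1F) refl k a y
      homogenise y 2F = solve 3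
          (λ k a y → k :* formᴾ a (y :* a) 2F := k :* (a :* a :* a) :* upperᴾ y 0F 2F) refl k a y
      homogenise y 3F = solve 3
          (λ k a y → k :* formᴾ a (y :* a) 3F := k :* (a :* a :* a) :* upperᴾ y 0F 3F) refl k a y
      e′ : ∀ i → coords Q i ≡ k * (a * a * a) * coords (cubicPoint∞ · shear y) i
      e′ i = begin
        coords Q i                                     ≡⟨ e i ⟩
        k * form a b i                                 ≡⟨ cong (λ b → k * form a b i) ya≡b ⟨
        k * form a (y * a) i                           ≡⟨ homogenise y i ⟩
        k * (a * a * a) * upper y 0F i                 ≡⟨ cong (k * (a * a * a) *_) (·ₘ-identityˡ (upper y) 0F i) ⟨
        k * (a * a * a) * (coords cubicPoint∞ ·ᵥ upper y) i ∎
        where open ≡-Reasoning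

  opaque
    -- Factors are removed on the right. Undoing the frame makes `O` fixed; by injectivity the image
    -- of P(1,0,0,0) is then different from `O`, so a shear brings it back, and shears leave `O` in
    -- place.
    G-decomposition : ∀ φ → Member φ → ∃[ r ] ∃[ y ] ∃[ d ] Σ[ d≢0 ∈ d ≢ 0# ]
                      φ ≈ₚ dilation d d≢0 ∘ₚ (shear y ∘ₚ frame r)
    G-decomposition φ φ∈G =
      let r , r≈ = OnCubic⇒frame {O · φ} (Equivalence.to (φ∈G O) O∈cubic)
          f = frame r
          φ′ = φ ∘ₚ (f ⁻¹ₚ)
          φ′∈G = ∘∈G φ (f ⁻¹ₚ) φ∈G (⁻¹∈G f (frame∈G r))
          O-fixed′ = ∘-fixes O (O · φ) O φ (f ⁻¹ₚ) (≈.refl {O · φ}) (·-invert O (O · φ) f r≈)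
          Q = cubicPoint∞ · φ′
          y , y≈ = shear-transitive Q
            (Equivalence.to (φ′∈G cubicPoint∞) (inj₂ (≈.refl {cubicPoint∞})))
            (λ Q≈O → ∞≉O (·-injective φ′ cubicPoint∞ O
              (≈.trans {Q} {O} {O · φ′} Q≈O (≈.sym {O · φ′} {O} O-fixed′))))
          s = shear y
          d , d≢0 , φ″≈ = G-fixing-O-∞ (φ′ ∘ₚ (s ⁻¹ₚ))
            (∘∈G φ′ (s ⁻¹ₚ) φ′∈G (⁻¹∈G s (shear∈G y)))
            (∘-fixes O O O φ′ (s ⁻¹ₚ) O-fixed′ (·-invert O O s (O·shear y)))
            (∘-fixes cubicPoint∞ Q cubicPoint∞ φ′ (s ⁻¹ₚ) (≈.refl {Q}) (·-invert cubicPoint∞ Q s y≈))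
      in r , y , d , d≢0 , //-//⇒∙∙ φ f s {dilation d d≢0} φ″≈

  -- Normal forms of lines and the uniqueness of their parameters.

  motion : Maybe Carrier → Carrier → Projectivity
  motion r y = shear y ∘ₚ frame r

  motion∈G : ∀ r y → Member (motion r y)
  motion∈G r y = ∘∈G (shear y) (frame r) (shear∈G y) (frame∈G r)

  normal : Maybe Carrier → Carrier → Carrier → Line
  normal r y w = lineP₀ w ·ₗ motion r y

  O·motion : ∀ r y → O · motion r y ≈ O · frame r
  O·motion r y = ∘-fixes O O (O · frame r) (shear y) (frame r) (O·shear y) (≈.refl {O · frame r})

  -- On a combination a O + b (1,0,w,0) the quadric x₀x₂ = x₁² reads w b² = 0.
  lineP₀-cubic : ∀ {w} R → w ≢ 0# → R ∈ lineP₀ w → OnCubic R → O ≈ R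
  lineP₀-cubic {w} R w≢0 (a , b , e) on = ≈.sym {R} {O} (a , ∝-nonzero R e′ , e′)
    where
    b≡0 : b ≡ 0#
    b≡0 = x²≡0⇒x≡0 (*≡0⇒≡0 w≢0 (begin
      w * (b * b)
        ≡⟨ solve 3 (λ a b w → w :* (b :* b) := (a :* 𝟎 :+ b :* 𝟏) :* (a :* 𝟎 :+ b :* w)) refl a b w ⟩
      (a * 0# + b * 1#) * (a * 0# + b * w)
        ≡⟨ cong₂ _*_ (e 0F) (e 2F) ⟨
      coords R 0F * coords R 2F
        ≡⟨ proj₁ (OnCubic⇒quadrics {R} on) ⟩
      coords R 1F * coords R 1F
        ≡⟨ cong₂ _*_ (e 1F) (e 1F) ⟩
      (a * 0# + b * 0#) * (a * 0# + b * 0#)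
        ≡⟨ solve 2 (λ a b → (a :* 𝟎 :+ b :* 𝟎) :* (a :* 𝟎 :+ b :* 𝟎) := 𝟎) refl a b ⟩
      0# ∎))
      where open ≡-Reasoning
    e′ : ∀ i → coords R i ≡ a * coords O i
    e′ i = trans (e i) (trans (cong (λ b → a * coords O i + b * coords (p₂ (lineP₀ w)) i) b≡0)
      (solve 3 (λ a x y → a :* x :+ 𝟎 :* y := a :* x) refl a (coords O i) (coords (p₂ (lineP₀ w)) i)))

  ∈-·⁻¹ : ∀ {ℓ v} φ → v ∈ᵥ (ℓ ·ₗ φ) → (v ·ᵥ matrix⁻¹ φ) ∈ᵥ ℓ
  ∈-·⁻¹ {ℓ} φ v∈ = let a , b , e = ∈ᵥ-· {ℓ ·ₗ φ} (φ ⁻¹ₚ) v∈ in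
    a , b , λ i → trans (e i) (cong₂ (λ x y → a * x + b * y)
      (undo (coords (p₁ ℓ)) (matrix φ) (matrix⁻¹ φ) (inverseʳ φ) i)
      (undo (coords (p₂ ℓ)) (matrix φ) (matrix⁻¹ φ) (inverseʳ φ) i))

  lineP₀·-cubic : ∀ {w} φ R → Member φ → w ≢ 0# → R ∈ (lineP₀ w ·ₗ φ) → OnCubic R → O · φ ≈ R
  lineP₀·-cubic {w} φ R φ∈G w≢0 R∈ on = ≈.trans {O · φ} {R′ · φ} {R}
    (·-congˡ {O} {R′} φ (lineP₀-cubic R′ w≢0 (∈-·⁻¹ {lineP₀ w} φ R∈)
      (Equivalence.to (⁻¹∈G φ φ∈G R) on)))
    (·-cancel R (φ ⁻¹ₚ) φ (∝ₘ-refl (inverseˡ φ)))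
    where R′ = R · (φ ⁻¹ₚ)

  -- If the two points agree, the osculating plane at `r′` contains the cubic point of `r`, and its
  -- only cubic point is its own.
  frame-injective : ∀ r r′ → O · frame r ≈ O · frame r′ → r ≡ r′
  frame-injective r r′ (k , _ , e) = osculating-unique r r′ (begin
    sum (λ i → coeffs (osculating r′) i * coords (O · frame r) i)
      ≡⟨ osculating-frame r′ (coords (O · frame r)) ⟩
    (coords (O · frame r) ·ᵥ matrix⁻¹ (frame r′)) 0F
      ≡⟨ ·ᵥ-congʳ (matrix⁻¹ (frame r′)) e 0F ⟩
    ((λ i → k * coords (O · frame r′) i) ·ᵥ matrix⁻¹ (frame r′)) 0F
      ≡⟨ ·ᵥ-scaleˡ k (coords (O · frame r′)) (matrix⁻¹ (frame r′)) 0F ⟩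
    k * (coords (O · frame r′) ·ᵥ matrix⁻¹ (frame r′)) 0F
      ≡⟨ cong (k *_) (undo (coords O) (matrix (frame r′)) (matrix⁻¹ (frame r′)) (inverseʳ (frame r′)) 0F) ⟩
    k * 0#
      ≡⟨ zeroʳ k ⟩
    0# ∎)
    where open ≡-Reasoning

  -- The sheared image of P(1,0,w,0). Modulo `O` the last coordinate is immaterial; the second shows
  -- `y` and the third then shows `w`.
  lineP₀·shear : Carrier → Carrier → Coordinates
  lineP₀·shear y w = 1# ∷ y ∷ y * y + w ∷ y * y * y + 3# * (w * y) ∷ []

  lineP₀·shear-p₁ : ∀ y w j → coords (p₁ (lineP₀ w ·ₗ shear y)) j ≡ coords O j
  lineP₀·shear-p₁ y w = ·ₘ-identityˡ (upper y) 3F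

  lineP₀·shear-p₂ : ∀ y w j → coords (p₂ (lineP₀ w ·ₗ shear y)) j ≡ lineP₀·shear y w j
  lineP₀·shear-p₂ y w 0F = solve 2 (λ y w → ((𝟏 ∷ 𝟎 ∷ w ∷ 𝟎 ∷ []) ·ᴾ upperᴾ y) 0F := 𝟏) refl y w
  lineP₀·shear-p₂ y w 1F = solve 2 (λ y w → ((𝟏 ∷ 𝟎 ∷ w ∷ 𝟎 ∷ []) ·ᴾ upperᴾ y) 1F := y) refl y w
  lineP₀·shear-p₂ y w 2F = solve 2
      (λ y w → ((𝟏 ∷ 𝟎 ∷ w ∷ 𝟎 ∷ []) ·ᴾ upperᴾ y) 2F := y :* y :+ w) refl y w
  lineP₀·shear-p₂ y w 3F = solve 2 (λ y w → ((𝟏 ∷ 𝟎 ∷ w ∷ 𝟎 ∷ []) ·ᴾ upperᴾ y) 3F :=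
    y :* y :* y :+ 𝟑 :* (w :* y)) refl y w

  shear-pencil-injective : ∀ y w y′ w′ →
    (lineP₀ w ·ₗ shear y) ≈ₗ (lineP₀ w′ ·ₗ shear y′) → y ≡ y′ × w ≡ w′
  shear-pencil-injective y w y′ w′ e = y≡y′ , x-y≡0⇒x≡y (begin
      w + - w′
        ≡⟨ solve 3 (λ w w′ y → w :+ (:- w′) := (y :* y :+ w) :+ (:- (y :* y :+ w′))) refl w w′ y ⟩
      (y * y + w) + - (y * y + w′)
        ≡⟨ x≡y⇒x-y≡0 (trans (coordinate 2F refl) (cong (λ y → y * y + w′) (sym y≡y′))) ⟩
      0# ∎)
    where
    open ≡-Reasoning
    ℓ = lineP₀ w ·ₗ shear y
    m = lineP₀ w′ ·ₗ shear y′
    member : coords (p₂ ℓ) ∈ᵥ m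
    member = Equivalence.to (e (p₂ ℓ)) (p₂∈ ℓ)
    a = proj₁ member
    b = proj₁ (proj₂ member)
    combination : ∀ i → lineP₀·shear y w i ≡ a * coords O i + b * lineP₀·shear y′ w′ i
    combination i = trans (sym (lineP₀·shear-p₂ y w i)) (trans (proj₂ (proj₂ member) i)
      (cong₂ (λ u v → a * u + b * v) (lineP₀·shear-p₁ y′ w′ i) (lineP₀·shear-p₂ y′ w′ i)))
    -- Both spanning points have first coordinate 1 while that of `O` is 0, so they can differ only
    -- by a multiple of `O`.
    b≡1 : b ≡ 1#
    b≡1 = trans (solve 2 (λ a b → b := a :* 𝟎 :+ b :* 𝟏) refl a b) (sym (combination 0F))
    coordinate : ∀ i → coords O i ≡ 0# → lineP₀·shear y w i ≡ lineP₀·shear y′ w′ i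
    coordinate i Oi≡0 = trans (combination i) (trans
      (cong₂ (λ u v → a * u + v * lineP₀·shear y′ w′ i) Oi≡0 b≡1)
      (solve 2 (λ a v → a :* 𝟎 :+ 𝟏 :* v := v) refl a (lineP₀·shear y′ w′ i)))
    y≡y′ : y ≡ y′
    y≡y′ = coordinate 1F refl

  normal·frame⁻¹ : ∀ r y w → (normal r y w ·ₗ (frame r ⁻¹ₚ)) ≈ₗ (lineP₀ w ·ₗ shear y)
  normal·frame⁻¹ r y w = ≈ₗ.trans
    {normal r y w ·ₗ (f ⁻¹ₚ)} {((lineP₀ w ·ₗ shear y) ·ₗ f) ·ₗ (f ⁻¹ₚ)} {lineP₀ w ·ₗ shear y}
    (·ₗ-congˡ (f ⁻¹ₚ) {normal r y w} {(lineP₀ w ·ₗ shear y) ·ₗ f}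
      (≈ₗ.sym {(lineP₀ w ·ₗ shear y) ·ₗ f} {normal r y w} (·ₗ-∘ (lineP₀ w) (shear y) f)))
    (·ₗ-cancel (lineP₀ w ·ₗ shear y) f (f ⁻¹ₚ) (∝ₘ-refl (inverseʳ f)))
    where f = frame r

  -- The marked cubic point of the left line lies on the right line, and w′ ≠ 0 leaves only one
  -- cubic point there; this identifies the frames. Cancelling the common frame reduces the rest to
  -- lines through `O`.
  normal-injective : ∀ {r y w r′ y′ w′} → w′ ≢ 0# →
    normal r y w ≈ₗ normal r′ y′ w′ → r ≡ r′ × y ≡ y′ × w ≡ w′
  normal-injective {r} {y} {w} {r′} {y′} {w′} w′≢0 e = finish r≡r′
    where
    g = motion r y
    g′ = motion r′ y′
    r≡r′ : r ≡ r′
    r≡r′ = frame-injective r r′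
      (≈.trans {O · frame r} {O · g} {O · frame r′}
        (≈.sym {O · g} {O · frame r} (O·motion r y))
        (≈.trans {O · g} {O · g′} {O · frame r′}
          (≈.sym {O · g′} {O · g} (lineP₀·-cubic g′ (O · g) (motion∈G r′ y′) w′≢0
            (Equivalence.to (e (O · g)) (p₁∈ (normal r y w)))
            (Equivalence.to (motion∈G r y O) O∈cubic)))
          (O·motion r′ y′)))
    finish : r ≡ r′ → r ≡ r′ × y ≡ y′ × w ≡ w′
    finish refl = refl , shear-pencil-injective y w y′ w′
      (≈ₗ.trans {lineP₀ w ·ₗ shear y} {normal r y w ·ₗ (frame r ⁻¹ₚ)} {lineP₀ w′ ·ₗ shear y′}
        (≈ₗ.sym {normal r y w ·ₗ (frame r ⁻¹ₚ)} {lineP₀ w ·ₗ shear y} (normal·frame⁻¹ r y w))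
        (≈ₗ.trans {normal r y w ·ₗ (frame r ⁻¹ₚ)} {normal r y′ w′ ·ₗ (frame r ⁻¹ₚ)} {lineP₀ w′ ·ₗ shear y′}
          (·ₗ-congˡ (frame r ⁻¹ₚ) {normal r y w} {normal r y′ w′} e) (normal·frame⁻¹ r y′ w′)))

  -- The lines of the class are those with a normal form in which w ≠ 0.

  UnΓ-osculating : ∀ {ℓ} → UnΓ ℓ → ∀ r → ¬ ℓ ⊂ osculating r
  UnΓ-osculating (_ , finite , _)   (just t) = finite t
  UnΓ-osculating (_ , _ , infinite) nothing  = infinite

  UnΓ-resp : ∀ {ℓ m} → ℓ ≈ₗ m → UnΓ m → UnΓ ℓ
  UnΓ-resp {ℓ} {m} e ((P , (on , P∈m) , unique) , finite , infinite) =
      ( P , (on , Equivalence.from (e P) P∈m)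
      , λ {Q} (on′ , Q∈ℓ) → unique {Q} (on′ , Equivalence.to (e Q) Q∈ℓ))
    , (λ t ℓ⊂ → finite t (λ R R∈m → ℓ⊂ R (Equivalence.from (e R) R∈m)))
    , (λ ℓ⊂ → infinite (λ R R∈m → ℓ⊂ R (Equivalence.from (e R) R∈m)))

  -- The first spanning point is a cubic point, so it lies in no osculating plane but its own. There
  -- the second one fails: pulled back by the frame it has first coordinate 1, and the plane becomes
  -- x₀ = 0.
  normal-osculating : ∀ r y w u → ¬ normal r y w ⊂ osculating u
  normal-osculating r y w u ℓ⊂ = second (osculating-unique r u first)
    where
    open ≡-Reasoning
    ℓ = normal r y w
    first : sum (λ i → coeffs (osculating u) i * coords (O · frame r) i) ≡ 0#
    first = let k , k≢0 , e = O·motion r y in *≡0⇒≡0 k≢0 (begin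
      k * sum (λ i → coeffs (osculating u) i * coords (O · frame r) i)
        ≡⟨ cong (k *_) (osculating-frame u (coords (O · frame r))) ⟩
      k * (coords (O · frame r) ·ᵥ matrix⁻¹ (frame u)) 0F
        ≡⟨ ·ᵥ-scaleˡ k (coords (O · frame r)) (matrix⁻¹ (frame u)) 0F ⟨
      ((λ i → k * coords (O · frame r) i) ·ᵥ matrix⁻¹ (frame u)) 0F
        ≡⟨ ·ᵥ-congʳ (matrix⁻¹ (frame u)) e 0F ⟨
      (coords (p₁ ℓ) ·ᵥ matrix⁻¹ (frame u)) 0F
        ≡⟨ osculating-frame u (coords (p₁ ℓ)) ⟨
      sum (λ i → coeffs (osculating u) i * coords (p₁ ℓ) i)
        ≡⟨ ℓ⊂ (p₁ ℓ) (p₁∈ ℓ) ⟩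
      0# ∎)
    second : ¬ r ≡ u
    second refl = 1≢0 (begin
      1#
        ≡⟨ lineP₀·shear-p₂ y w 0F ⟨
      (x ·ᵥ upper y) 0F
        ≡⟨ undo (x ·ᵥ upper y) (matrix (frame r)) (matrix⁻¹ (frame r)) (inverseʳ (frame r)) 0F ⟨
      (((x ·ᵥ upper y) ·ᵥ matrix (frame r)) ·ᵥ matrix⁻¹ (frame r)) 0F
        ≡⟨ ·ᵥ-congʳ (matrix⁻¹ (frame r)) (·ᵥ-assoc x (upper y) (matrix (frame r))) 0F ⟩
      (coords (p₂ ℓ) ·ᵥ matrix⁻¹ (frame r)) 0F
        ≡⟨ osculating-frame r (coords (p₂ ℓ)) ⟨
      sum (λ i → coeffs (osculating r) i * coords (p₂ ℓ) i)
        ≡⟨ ℓ⊂ (p₂ ℓ) (p₂∈ ℓ) ⟩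
      0# ∎)
      where x = coords (p₂ (lineP₀ w))

  normal-UnΓ : ∀ r y {w} → w ≢ 0# → UnΓ (normal r y w)
  normal-UnΓ r y {w} w≢0 =
      ( O · motion r y
      , (Equivalence.to (motion∈G r y O) O∈cubic , p₁∈ (normal r y w))
      , λ {R} (on , R∈) → lineP₀·-cubic (motion r y) R (motion∈G r y) w≢0 R∈ on)
    , (λ t → normal-osculating r y w (just t))
    , normal-osculating r y w nothing

  -- Scaling the first spanning point to (1, y, z, ·) determines `y`; since the shear contributes y²
  -- to the third coordinate, w = z - y². The last coordinate is corrected by a multiple of `O`.
  through-O-p₁ : ∀ m → coords O ∈ᵥ m → coords (p₁ m) 0F ≢ 0# → ∃[ y ] ∃[ w ] m ≈ₗ (lineP₀ w ·ₗ shear y)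
  through-O-p₁ m O∈m@(a , b , O≡) A₀≢0 = y , w , ≈ₗ-intro m n A∈n B∈n
    (∈ᵥ-resp {m} O∈m (lineP₀·shear-p₁ y w))
    (∈ᵥ-combination {m} A₀⁻¹ (x 3F + - (A₀⁻¹ * A 3F)) (p₁∈ m) O∈m
      (λ i → trans (lineP₀·shear-p₂ y w i) (x≡ i)))
    where
    open ≡-Reasoning
    A = coords (p₁ m)
    B = coords (p₂ m)
    A₀⁻¹ = proj₁ (inverse (A 0F) A₀≢0)
    y = A₀⁻¹ * A 1F
    z = A₀⁻¹ * A 2F
    w = z + - (y * y)
    n = lineP₀ w ·ₗ shear y
    x = lineP₀·shear y w
    x≡ : ∀ i → x i ≡ A₀⁻¹ * A i + (x 3F + - (A₀⁻¹ * A 3F)) * coords O i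
    x≡ 0F = trans (sym (proj₂ (inverse (A 0F) A₀≢0)))
      (solve 2 (λ u v → u := u :+ v :* 𝟎) refl (A₀⁻¹ * A 0F) (x 3F + - (A₀⁻¹ * A 3F)))
    x≡ 1F = solve 2 (λ u v → u := u :+ v :* 𝟎) refl (A₀⁻¹ * A 1F) (x 3F + - (A₀⁻¹ * A 3F))
    x≡ 2F = solve 3 (λ y u v → y :* y :+ (u :+ (:- (y :* y))) := u :+ v :* 𝟎) refl
      y (A₀⁻¹ * A 2F) (x 3F + - (A₀⁻¹ * A 3F))
    x≡ 3F = solve 2 (λ u v → u := v :+ (u :+ (:- v)) :* 𝟏) refl (x 3F) (A₀⁻¹ * A 3F)
    O∈n : coords O ∈ᵥ n
    O∈n = ∈ᵥ-resp {n} (p₁∈ n) (sym ∘ lineP₀·shear-p₁ y w)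
    x∈n : x ∈ᵥ n
    x∈n = ∈ᵥ-resp {n} (p₂∈ n) (sym ∘ lineP₀·shear-p₂ y w)
    A∈n : A ∈ᵥ n
    A∈n = ∈ᵥ-combination {n} (A 0F) (- (A 0F * (x 3F + - (A₀⁻¹ * A 3F)))) x∈n O∈n (λ i → sym (begin
      A 0F * x i + - (A 0F * (x 3F + - (A₀⁻¹ * A 3F))) * coords O i
        ≡⟨ cong (λ u → A 0F * u + - (A 0F * (x 3F + - (A₀⁻¹ * A 3F))) * coords O i) (x≡ i) ⟩
      A 0F * (A₀⁻¹ * A i + (x 3F + - (A₀⁻¹ * A 3F)) * coords O i)
        + - (A 0F * (x 3F + - (A₀⁻¹ * A 3F))) * coords O i
        ≡⟨ solve 5 (λ u v s t p → u :* (v :* s :+ t :* p) :+ (:- (u :* t)) :* p := (v :* u) :* s) refl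
             (A 0F) A₀⁻¹ (A i) (x 3F + - (A₀⁻¹ * A 3F)) (coords O i) ⟩
      (A₀⁻¹ * A 0F) * A i
        ≡⟨ cong (_* A i) (proj₂ (inverse (A 0F) A₀≢0)) ⟩
      1# * A i
        ≡⟨ *-identityˡ (A i) ⟩
      A i ∎))
    -- `O` has first coordinate 0 and so is no multiple of `p₁ m`; it can therefore replace `p₂ m`
    -- as a spanning point.
    b≢0 : b ≢ 0#
    b≢0 b≡0 = 1≢0 (begin
      1#                    ≡⟨ O≡aA 3F ⟩
      a * A 3F              ≡⟨ cong (_* A 3F) a≡0 ⟩
      0# * A 3F             ≡⟨ zeroˡ (A 3F) ⟩
      0#                    ∎)
      where
      O≡aA : ∀ i → coords O i ≡ a * A i
      O≡aA i = trans (O≡ i) (trans (cong (λ b → a * A i + b * B i) b≡0)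
        (solve 3 (λ a u v → a :* u :+ 𝟎 :* v := a :* u) refl a (A i) (B i)))
      a≡0 : a ≡ 0#
      a≡0 = *≡0⇒≡0 A₀≢0 (trans (*-comm (A 0F) a) (sym (O≡aA 0F)))
    B∈n : B ∈ᵥ n
    B∈n = let b⁻¹ , b⁻¹b≡1 = inverse b b≢0 in
      ∈ᵥ-combination {n} b⁻¹ (- (b⁻¹ * a)) O∈n A∈n (λ i → sym (begin
        b⁻¹ * coords O i + - (b⁻¹ * a) * A i
          ≡⟨ cong (λ u → b⁻¹ * u + - (b⁻¹ * a) * A i) (O≡ i) ⟩
        b⁻¹ * (a * A i + b * B i) + - (b⁻¹ * a) * A i
          ≡⟨ solve 5 (λ v a b s t → v :* (a :* s :+ b :* t) :+ (:- (v :* a)) :* s := (v :* b) :* t) refl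
               b⁻¹ a b (A i) (B i) ⟩
        (b⁻¹ * b) * B i
          ≡⟨ cong (_* B i) b⁻¹b≡1 ⟩
        1# * B i
          ≡⟨ *-identityˡ (B i) ⟩
        B i ∎))

  swap : Line → Line
  swap ℓ = join (p₂ ℓ) (p₁ ℓ) (distinct ℓ ∘ ≈.sym {p₂ ℓ} {p₁ ℓ})

  swap-≈ₗ : ∀ ℓ → swap ℓ ≈ₗ ℓ
  swap-≈ₗ ℓ = ≈ₗ-intro (swap ℓ) ℓ (p₂∈ ℓ) (p₁∈ ℓ) (p₂∈ (swap ℓ)) (p₁∈ (swap ℓ))

  through-O : ∀ m → coords O ∈ᵥ m → ¬ (coords (p₁ m) 0F ≡ 0# × coords (p₂ m) 0F ≡ 0#) →
               ∃[ y ] ∃[ w ] m ≈ₗ (lineP₀ w ·ₗ shear y)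
  through-O m O∈m ¬zero = case (coords (p₁ m) 0F ≟ 0#) (coords (p₂ m) 0F ≟ 0#)
    where
    case : Dec (coords (p₁ m) 0F ≡ 0#) → Dec (coords (p₂ m) 0F ≡ 0#) →
           ∃[ y ] ∃[ w ] m ≈ₗ (lineP₀ w ·ₗ shear y)
    case (no A₀≢0)  _          = through-O-p₁ m O∈m A₀≢0
    case (yes A₀≡0) (yes B₀≡0) = contradiction (A₀≡0 , B₀≡0) ¬zero
    case (yes _)    (no B₀≢0)  =
      let y , w , e = through-O-p₁ (swap m) (⊆-intro m (swap m) (p₂∈ (swap m)) (p₁∈ (swap m)) O∈m) B₀≢0
      in y , w , ≈ₗ.trans {m} {swap m} {lineP₀ w ·ₗ shear y} (≈ₗ.sym {swap m} {m} (swap-≈ₗ m)) e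

  through-cubic : ∀ ℓ r P → O · frame r ≈ P → P ∈ ℓ → ¬ ℓ ⊂ osculating r →
                  ∃[ y ] ∃[ w ] ℓ ≈ₗ normal r y w
  through-cubic ℓ r P O·f≈P P∈ℓ ℓ⊄ =
    let y , w , m≈ = through-O m O∈m ¬zero
        n = lineP₀ w ·ₗ shear y
    in y , w , ≈ₗ.trans {ℓ} {m ·ₗ f} {normal r y w}
      (≈ₗ.sym {m ·ₗ f} {ℓ} (·ₗ-cancel ℓ (f ⁻¹ₚ) f (∝ₘ-refl (inverseˡ f))))
      (≈ₗ.trans {m ·ₗ f} {n ·ₗ f} {normal r y w}
        (·ₗ-congˡ f {m} {n} m≈) (·ₗ-∘ (lineP₀ w) (shear y) f))
    where
    f = frame r
    m = ℓ ·ₗ (f ⁻¹ₚ)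
    O∈m : coords O ∈ᵥ m
    O∈m = let k , _ , e = ≈.sym {P · (f ⁻¹ₚ)} {O} (·-invert O P f O·f≈P) in
      ∈ᵥ-scale {m} {coords (P · (f ⁻¹ₚ))} {coords O} k (∈ᵥ-· {ℓ} {coords P} (f ⁻¹ₚ) P∈ℓ) e
    -- If both first coordinates vanished, the pulled-back line would lie in x₀ = 0 and the original
    -- line in the osculating plane at `r`.
    ¬zero : ¬ (coords (p₁ m) 0F ≡ 0# × coords (p₂ m) 0F ≡ 0#)
    ¬zero (A₀≡0 , B₀≡0) = ℓ⊄ λ R R∈ℓ →
      let a , b , e = ∈ᵥ-· {ℓ} {coords R} (f ⁻¹ₚ) R∈ℓ in
      trans (osculating-frame r (coords R)) (trans (e 0F) (trans
        (cong₂ (λ u v → a * u + b * v) A₀≡0 B₀≡0)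
        (solve 2 (λ a b → a :* 𝟎 :+ b :* 𝟎 := 𝟎) refl a b)))

  -- The line normal r y 0 also passes through the image of P(1,0,0,0).
  UnΓ-normal⇒≢0 : ∀ ℓ r y w → UnΓ ℓ → ℓ ≈ₗ normal r y w → w ≢ 0#
  UnΓ-normal⇒≢0 ℓ r y w ((P , _ , unique) , _) ℓ≈ w≡0 =
    ∞≉O (·-injective g cubicPoint∞ O
      (≈.trans {cubicPoint∞ · g} {P} {O · g}
        (≈.sym {P} {cubicPoint∞ · g} (unique {cubicPoint∞ · g} (∞on , ∞∈)))
        (unique {O · g} (Oon , O∈))))
    where
    g = motion r y
    ∞on : OnCubic (cubicPoint∞ · g)
    ∞on = Equivalence.to (motion∈G r y cubicPoint∞) (inj₂ (≈.refl {cubicPoint∞}))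
    Oon : OnCubic (O · g)
    Oon = Equivalence.to (motion∈G r y O) O∈cubic
    ∞∈lineP₀ : cubicPoint∞ ∈ lineP₀ w
    ∞∈lineP₀ = ∈ᵥ-resp {lineP₀ w} (p₂∈ (lineP₀ w)) λ
      { 0F → refl ; 1F → refl ; 2F → sym w≡0 ; 3F → refl }
    ∞∈ : cubicPoint∞ · g ∈ ℓ
    ∞∈ = Equivalence.from (ℓ≈ (cubicPoint∞ · g)) (∈ᵥ-· {lineP₀ w} {coords cubicPoint∞} g ∞∈lineP₀)
    O∈ : O · g ∈ ℓ
    O∈ = Equivalence.from (ℓ≈ (O · g)) (p₁∈ (normal r y w))

  opaque
    UnΓ⇒normal : ∀ ℓ → UnΓ ℓ → ∃[ r ] ∃[ y ] ∃[ w ] w ≢ 0# × ℓ ≈ₗ normal r y w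
    UnΓ⇒normal ℓ unΓ@((P , (on , P∈ℓ) , _) , _) =
      let r , O·r≈P = OnCubic⇒frame {P} on
          y , w , ℓ≈ = through-cubic ℓ r P O·r≈P P∈ℓ (UnΓ-osculating {ℓ} unΓ r)
      in r , y , w , UnΓ-normal⇒≢0 ℓ r y w unΓ ℓ≈ , ℓ≈

  -- Orbits in terms of normal forms.

  lineP₀·dilation : ∀ s d (d≢0 : d ≢ 0#) → (lineP₀ s ·ₗ dilation d d≢0) ≈ₗ lineP₀ (s * (d * d))
  lineP₀·dilation s d d≢0 = ≈ₗ-points {lineP₀ s ·ₗ dilation d d≢0} {lineP₀ (s * (d * d))}
    (d ^ 3 , nonzero-* d≢0 (nonzero-* d≢0 (nonzero-* d≢0 1≢0)) , λ
      { 0F → trans (diagonal-· d (coords O) 0F) (sym (zeroʳ (d ^ 3)))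
      ; 1F → trans (diagonal-· d (coords O) 1F) (solve 1 (λ d → 𝟎 :* d := d :^ 3 :* 𝟎) refl d)
      ; 2F → trans (diagonal-· d (coords O) 2F) (solve 1 (λ d → 𝟎 :* d :^ 2 := d :^ 3 :* 𝟎) refl d)
      ; 3F → trans (diagonal-· d (coords O) 3F) (solve 1 (λ d → 𝟏 :* d :^ 3 := d :^ 3 :* 𝟏) refl d)
      })
    (∝-refl λ
      { 0F → diagonal-· d x 0F
      ; 1F → trans (diagonal-· d x 1F) (zeroˡ d)
      ; 2F → trans (diagonal-· d x 2F) (solve 2 (λ s d → s :* d :^ 2 := s :* (d :* d)) refl s d)
      ; 3F → trans (diagonal-· d x 3F) (zeroˡ (d ^ 3))
      })
    where x = coords (p₂ (lineP₀ s))

  lineP₀·dilation-motion : ∀ s r y d (d≢0 : d ≢ 0#) →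
    (lineP₀ s ·ₗ (dilation d d≢0 ∘ₚ motion r y)) ≈ₗ normal r y (s * (d * d))
  lineP₀·dilation-motion s r y d d≢0 =
    ≈ₗ.trans {lineP₀ s ·ₗ (δ ∘ₚ g)} {(lineP₀ s ·ₗ δ) ·ₗ g} {normal r y (s * (d * d))}
      (≈ₗ.sym {(lineP₀ s ·ₗ δ) ·ₗ g} {lineP₀ s ·ₗ (δ ∘ₚ g)} (·ₗ-∘ (lineP₀ s) δ g))
      (·ₗ-congˡ g {lineP₀ s ·ₗ δ} {lineP₀ (s * (d * d))} (lineP₀·dilation s d d≢0))
    where
    δ = dilation d d≢0
    g = motion r y

  opaque
    Orbit⇒normal : ∀ {s ℓ} → Orbit (lineP₀ s) ℓ →
                   ∃[ r ] ∃[ y ] ∃[ d ] d ≢ 0# × ℓ ≈ₗ normal r y (s * (d * d))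
    Orbit⇒normal {s} {ℓ} (φ , φ∈G , ℓ≈) =
      let r , y , d , d≢0 , φ≈ = G-decomposition φ φ∈G
          ψ = dilation d d≢0 ∘ₚ motion r y
      in r , y , d , d≢0 , ≈ₗ.trans {ℓ} {lineP₀ s ·ₗ φ} {normal r y (s * (d * d))} ℓ≈
           (≈ₗ.trans {lineP₀ s ·ₗ φ} {lineP₀ s ·ₗ ψ} {normal r y (s * (d * d))}
             (·ₗ-congʳ (lineP₀ s) {φ} {ψ} φ≈) (lineP₀·dilation-motion s r y d d≢0))

  normal⇒Orbit : ∀ {s ℓ r y d} → d ≢ 0# → ℓ ≈ₗ normal r y (s * (d * d)) → Orbit (lineP₀ s) ℓ
  normal⇒Orbit {s} {ℓ} {r} {y} {d} d≢0 ℓ≈ =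
      ψ , ∘∈G (dilation d d≢0) (motion r y) (dilation∈G d d≢0) (motion∈G r y)
    , ≈ₗ.trans {ℓ} {normal r y (s * (d * d))} {lineP₀ s ·ₗ ψ} ℓ≈
        (≈ₗ.sym {lineP₀ s ·ₗ ψ} {normal r y (s * (d * d))} (lineP₀·dilation-motion s r y d d≢0))
    where ψ = dilation d d≢0 ∘ₚ motion r y

  Orbit⇒UnΓ : ∀ {s} → s ≢ 0# → ∀ ℓ → Orbit (lineP₀ s) ℓ → UnΓ ℓ
  Orbit⇒UnΓ {s} s≢0 ℓ orbit =
    let r , y , d , d≢0 , ℓ≈ = Orbit⇒normal {s} {ℓ} orbit in
    UnΓ-resp {ℓ} {normal r y (s * (d * d))} ℓ≈
      (normal-UnΓ r y (nonzero-* s≢0 (nonzero-* d≢0 d≢0)))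

  UnΓ⇔Orbits : ∀ {ρ} → NonSquare ρ → ρ ≢ 0# → ∀ ℓ → UnΓ ℓ ⇔ (Orbit ℓ₁ ℓ ⊎ Orbit (ℓ₂ ρ) ℓ)
  UnΓ⇔Orbits {ρ} ρ-nonsquare ρ≢0 ℓ = mk⇔ classify [ Orbit⇒UnΓ 1≢0 ℓ , Orbit⇒UnΓ ρ≢0 ℓ ]′
    where
    classify : UnΓ ℓ → Orbit ℓ₁ ℓ ⊎ Orbit (ℓ₂ ρ) ℓ
    classify unΓ =
      let r , y , w , w≢0 , ℓ≈ = UnΓ⇒normal ℓ unΓ
          in-orbit : ∀ {s} → ∃[ u ] (u ≢ 0# × w ≡ s * (u * u)) → Orbit (lineP₀ s) ℓ
          in-orbit {s} (u , u≢0 , w≡) = normal⇒Orbit {s} {ℓ} {r} {y} {u} u≢0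
            (subst (λ w → ℓ ≈ₗ normal r y w) w≡ ℓ≈)
      in [ inj₁ ∘ in-orbit , inj₂ ∘ in-orbit ]′ (square-classes ρ-nonsquare w≢0)

  Orbits-disjoint : ∀ {ρ} → NonSquare ρ → ρ ≢ 0# → ∀ ℓ → ¬ (Orbit ℓ₁ ℓ × Orbit (ℓ₂ ρ) ℓ)
  Orbits-disjoint {ρ} ρ-nonsquare ρ≢0 ℓ (orbit₁ , orbit₂) =
    let r , y , u , u≢0 , ℓ≈ = Orbit⇒normal {1#} {ℓ} orbit₁
        r′ , y′ , v , v≢0 , ℓ≈′ = Orbit⇒normal {ρ} {ℓ} orbit₂
        _ , _ , u²≡ρv² = normal-injective {r} {y} {1# * (u * u)} {r′} {y′} {ρ * (v * v)}
          (nonzero-* ρ≢0 (nonzero-* v≢0 v≢0))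
          (≈ₗ.trans {normal r y (1# * (u * u))} {ℓ} {normal r′ y′ (ρ * (v * v))}
            (≈ₗ.sym {ℓ} {normal r y (1# * (u * u))} ℓ≈) ℓ≈′)
        v⁻¹ , v⁻¹v≡1 = inverse v v≢0
    -- A common line would have u² and ρ v² as its parameter w, making ρ the square of u/v.
    in ρ-nonsquare (u * v⁻¹) (begin
      (u * v⁻¹) * (u * v⁻¹)
        ≡⟨ solve 2 (λ u v → (u :* v) :* (u :* v) := (v :* v) :* (𝟏 :* (u :* u))) refl u v⁻¹ ⟩
      (v⁻¹ * v⁻¹) * (1# * (u * u))
        ≡⟨ cong ((v⁻¹ * v⁻¹) *_) u²≡ρv² ⟩
      (v⁻¹ * v⁻¹) * (ρ * (v * v))
        ≡⟨ solve 3
            (λ ρ v v⁻¹ → (v⁻¹ :* v⁻¹) :* (ρ :* (v :* v)) := (v⁻¹ :* v) :* (v⁻¹ :* v) :* ρ) refl ρ v v⁻¹ ⟩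
      (v⁻¹ * v) * (v⁻¹ * v) * ρ
        ≡⟨ cong (λ z → z * z * ρ) v⁻¹v≡1 ⟩
      1# * 1# * ρ
        ≡⟨ solve 1 (λ ρ → 𝟏 :* 𝟏 :* ρ := ρ) refl ρ ⟩
      ρ ∎)
    where open ≡-Reasoning

  -- The size of an orbit.

  -- The parameter w runs over s d², where d matters only up to sign; hence the last component
  -- indexes `half`.
  Parameters : Set c
  Parameters = Maybe Carrier × Carrier × Fin size

  Fin↔Parameters : Fin (suc q ℕ.* (q ℕ.* size)) ↔ Parameters
  Fin↔Parameters = ↔-trans Fin.*↔× (Fin↔Maybe ×-↔ ↔-trans Fin.*↔× (↔-sym F↔Fin ×-↔ ↔-id (Fin size)))
    where
    open Inverse F↔Fin using (to; from; strictlyInverseˡ; strictlyInverseʳ)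
    Fin↔Maybe : Fin (suc q) ↔ Maybe Carrier
    Fin↔Maybe = mk↔ₛ′
      (λ { 0F → nothing ; (Fin.suc i) → just (from i) })
      (λ { nothing → 0F ; (just t) → Fin.suc (to t) })
      (λ { nothing → refl ; (just t) → cong just (strictlyInverseʳ t) })
      (λ { 0F → refl ; (Fin.suc i) → cong Fin.suc (strictlyInverseˡ i) })

  -- With q = 2 `size` + 1, twice the left side is (q + 1) q (q - 1).
  count : suc q ℕ.* (q ℕ.* size) ≡ (q ℕ.^ 3 ℕ.∸ q) ℕ./ 2
  count = begin
    suc q ℕ.* (q ℕ.* size)
      ≡⟨ m*n/n≡m (suc q ℕ.* (q ℕ.* size)) 2 ⟨
    (suc q ℕ.* (q ℕ.* size)) ℕ.* 2 ℕ./ 2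
      ≡⟨ cong (ℕ._/ 2) (ℕ.m+n∸m≡n q _) ⟨
    (q ℕ.+ (suc q ℕ.* (q ℕ.* size)) ℕ.* 2 ℕ.∸ q) ℕ./ 2
      ≡⟨ cong (λ x → (x ℕ.∸ q) ℕ./ 2) cube ⟩
    (q ℕ.^ 3 ℕ.∸ q) ℕ./ 2 ∎
    where
    open ≡-Reasoning
    open ℕSolver.+-*-Solver renaming
      (solve to ℕsolve; _:+_ to _⊕_; _:*_ to _⊗_; _:=_ to _⊜_; con to constant; _:^_ to _⊛_)
    -- The subtraction is truncated, so the identity is proved with `q` added on the other side.
    cube : q ℕ.+ (suc q ℕ.* (q ℕ.* size)) ℕ.* 2 ≡ q ℕ.^ 3
    cube = subst (λ q → q ℕ.+ (suc q ℕ.* (q ℕ.* size)) ℕ.* 2 ≡ q ℕ.^ 3) order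
      (ℕsolve 1 (λ n → let q = constant 1 ⊕ (n ⊕ n) in
        q ⊕ ((constant 1 ⊕ q) ⊗ (q ⊗ n)) ⊗ constant 2 ⊜ q ⊛ 3) refl size)

  Orbit-size : ∀ {s} → s ≢ 0# → HasSize lines (Orbit (lineP₀ s)) (suc q ℕ.* (q ℕ.* size))
  Orbit-size {s} s≢0 = HasSize-enumeration lines (line ∘ to) (in-orbit ∘ to) injective′ surjective′
    where
    open Inverse Fin↔Parameters using (to; from; strictlyInverseˡ; strictlyInverseʳ)
    weight : Fin size → Carrier
    weight k = s * (half k * half k)
    line : Parameters → Line
    line (r , y , k) = normal r y (weight k)
    in-orbit : ∀ p → Orbit (lineP₀ s) (line p)
    in-orbit (r , y , k) =
      normal⇒Orbit {s} {normal r y (weight k)} {r} {y} {half k} (half≢0 k) (≈ₗ.refl {normal r y (weight k)})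
    line-injective : ∀ p p′ → line p ≈ₗ line p′ → p ≡ p′
    line-injective (r , y , k) (r′ , y′ , k′) e =
      let r≡ , y≡ , w≡ = normal-injective {r} {y} {weight k} {r′} {y′} {weight k′}
                           (nonzero-* s≢0 (nonzero-* (half≢0 k′) (half≢0 k′))) e
      in cong₂ _,_ r≡ (cong₂ _,_ y≡ (half-square-injective (*-cancelˡ-nonzero s≢0 w≡)))
    injective′ : ∀ i j → line (to i) ≈ₗ line (to j) → i ≡ j
    injective′ i j e = trans (sym (strictlyInverseʳ i))
      (trans (cong from (line-injective (to i) (to j) e)) (strictlyInverseʳ j))
    surjective′ : ∀ ℓ → Orbit (lineP₀ s) ℓ → ∃[ i ] line (to i) ≈ₗ ℓ
    surjective′ ℓ orbit = enumerate (Orbit⇒normal {s} {ℓ} orbit)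
      where
      enumerate : (∃[ r ] ∃[ y ] ∃[ d ] d ≢ 0# × ℓ ≈ₗ normal r y (s * (d * d))) →
                  ∃[ i ] line (to i) ≈ₗ ℓ
      enumerate (r , y , d , d≢0 , ℓ≈) = index (half-squares d≢0)
        where
        index : ∃[ k ] half k * half k ≡ d * d → ∃[ i ] line (to i) ≈ₗ ℓ
        index (k , k≡) = from (r , y , k)
          , subst (λ p → line p ≈ₗ ℓ) (sym (strictlyInverseˡ (r , y , k)))
              (≈ₗ.sym {ℓ} {line (r , y , k)}
                (subst (λ w → ℓ ≈ₗ normal r y (s * w)) (sym k≡) ℓ≈))

  -- Stabilisers.

  motion-trivial : motion (just 0#) 0# ≈ₚ idₚ
  motion-trivial = ∝ₘ-refl λ i j →
    trans (sym (·ₘ-identityˡ (upper 0# ·ₘ lower 0#) i j))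
    (trans (sym (·ᵥ-assoc (I i) (upper 0#) (lower 0#) j)) (lemma (I i) j))
    where
    lemma : ∀ x j → ((x ·ᵥ upper 0#) ·ᵥ lower 0#) j ≡ x j
    lemma x 0F = solve 4 (λ a b c d →
      ((a ∷ b ∷ c ∷ d ∷ []) ·ᴾ upperᴾ 𝟎 ·ᴾ lowerᴾ 𝟎) 0F := a) refl (x 0F) (x 1F) (x 2F) (x 3F)
    lemma x 1F = solve 4 (λ a b c d →
      ((a ∷ b ∷ c ∷ d ∷ []) ·ᴾ upperᴾ 𝟎 ·ᴾ lowerᴾ 𝟎) 1F := b) refl (x 0F) (x 1F) (x 2F) (x 3F)
    lemma x 2F = solve 4 (λ a b c d →
      ((a ∷ b ∷ c ∷ d ∷ []) ·ᴾ upperᴾ 𝟎 ·ᴾ lowerᴾ 𝟎) 2F := c) refl (x 0F) (x 1F) (x 2F) (x 3F)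
    lemma x 3F = solve 4 (λ a b c d →
      ((a ∷ b ∷ c ∷ d ∷ []) ·ᴾ upperᴾ 𝟎 ·ᴾ lowerᴾ 𝟎) 3F := d) refl (x 0F) (x 1F) (x 2F) (x 3F)

  -- Places `lineP₀ w` itself among the normal forms, so that `normal-injective` applies to an
  -- element fixing it.
  normal-trivial : ∀ w → normal (just 0#) 0# w ≈ₗ lineP₀ w
  normal-trivial w = ≈ₗ.trans {normal (just 0#) 0# w} {lineP₀ w ·ₗ idₚ} {lineP₀ w}
    (·ₗ-congʳ (lineP₀ w) {motion (just 0#) 0#} {idₚ} motion-trivial) (·ₗ-id (lineP₀ w))

  stabiliser : Line → Subgroup PGL c
  stabiliser ℓ = record
    { Member    = λ φ → Member φ × ℓ ·ₗ φ ≈ₗ ℓ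
    ; respects  = λ {φ} {ψ} φ≈ψ (φ∈G , e) → Subgroup.respects G {φ} {ψ} φ≈ψ φ∈G
        , ≈ₗ.trans {ℓ ·ₗ ψ} {ℓ ·ₗ φ} {ℓ}
            (≈ₗ.sym {ℓ ·ₗ φ} {ℓ ·ₗ ψ} (·ₗ-congʳ ℓ {φ} {ψ} φ≈ψ)) e
    ; ε-closed  = Subgroup.ε-closed G , ·ₗ-id ℓ
    ; ∙-closed  = λ {φ} {ψ} (φ∈G , e) (ψ∈G , f) → ∘∈G φ ψ φ∈G ψ∈G
        , ≈ₗ.trans {ℓ ·ₗ (φ ∘ₚ ψ)} {(ℓ ·ₗ φ) ·ₗ ψ} {ℓ}
            (≈ₗ.sym {(ℓ ·ₗ φ) ·ₗ ψ} {ℓ ·ₗ (φ ∘ₚ ψ)} (·ₗ-∘ ℓ φ ψ))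
            (≈ₗ.trans {(ℓ ·ₗ φ) ·ₗ ψ} {ℓ ·ₗ ψ} {ℓ} (·ₗ-congˡ ψ {ℓ ·ₗ φ} {ℓ} e) f)
    ; ⁻¹-closed = λ {φ} (φ∈G , e) → ⁻¹∈G φ φ∈G
        , ≈ₗ.trans {ℓ ·ₗ (φ ⁻¹ₚ)} {(ℓ ·ₗ φ) ·ₗ (φ ⁻¹ₚ)} {ℓ}
            (·ₗ-congˡ (φ ⁻¹ₚ) {ℓ} {ℓ ·ₗ φ} (≈ₗ.sym {ℓ ·ₗ φ} {ℓ} e))
            (·ₗ-cancel ℓ φ (φ ⁻¹ₚ) (∝ₘ-refl (inverseʳ φ)))
    }

  SignDiagonal : Projectivity → Set c
  SignDiagonal φ = ∃[ d ] ((d ≡ 1# ⊎ d ≡ - 1#) × matrix φ ∝ₘ diagonal d)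

  module ∝ₘ = IsEquivalence ∝ₘ-isEquivalence

  -1≢0 : - 1# ≢ 0#
  -1≢0 = x≢0⇒-x≢0 1≢0

  ∘-motion-trivial : ∀ φ δ r y → φ ≈ₚ δ ∘ₚ motion r y → r ≡ just 0# → y ≡ 0# → φ ≈ₚ δ
  ∘-motion-trivial φ δ _ _ φ≈ refl refl = PGL.trans {φ} {δ ∘ₚ motion (just 0#) 0#} {δ} φ≈
    (PGL.trans {δ ∘ₚ motion (just 0#) 0#} {δ ∘ₚ idₚ} {δ}
      (PGL.∙-cong {δ} {δ} {motion (just 0#) 0#} {idₚ} (PGL.refl {δ}) motion-trivial)
      (PGL.identityʳ δ))

  fixed-normal : ∀ s φ r y d (d≢0 : d ≢ 0#) → φ ≈ₚ dilation d d≢0 ∘ₚ motion r y →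
                 lineP₀ s ·ₗ φ ≈ₗ lineP₀ s → normal r y (s * (d * d)) ≈ₗ normal (just 0#) 0# s
  fixed-normal s φ r y d d≢0 φ≈ fixed =
    ≈ₗ.trans {normal r y (s * (d * d))} {lineP₀ s ·ₗ ψ} {normal (just 0#) 0# s}
      (≈ₗ.sym {lineP₀ s ·ₗ ψ} {normal r y (s * (d * d))} (lineP₀·dilation-motion s r y d d≢0))
      (≈ₗ.trans {lineP₀ s ·ₗ ψ} {lineP₀ s ·ₗ φ} {normal (just 0#) 0# s}
        (≈ₗ.sym {lineP₀ s ·ₗ φ} {lineP₀ s ·ₗ ψ} (·ₗ-congʳ (lineP₀ s) {φ} {ψ} φ≈))
        (≈ₗ.trans {lineP₀ s ·ₗ φ} {lineP₀ s} {normal (just 0#) 0# s} fixed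
          (≈ₗ.sym {normal (just 0#) 0# s} {lineP₀ s} (normal-trivial s))))
    where ψ = dilation d d≢0 ∘ₚ motion r y

  -- The fixed line has the parameters of its image and also 0, 0, s. Uniqueness makes the motion
  -- trivial and gives s d² = s; cancelling `s` leaves a condition free of it, which is why both
  -- lines have the same stabiliser.
  stabiliser⇒sign : ∀ {s} → s ≢ 0# → ∀ φ → Member φ × lineP₀ s ·ₗ φ ≈ₗ lineP₀ s → SignDiagonal φ
  stabiliser⇒sign {s} s≢0 φ (φ∈G , fixed) = decompose (G-decomposition φ φ∈G)
    where
    decompose : (∃[ r ] ∃[ y ] ∃[ d ] Σ[ d≢0 ∈ d ≢ 0# ]
                  φ ≈ₚ dilation d d≢0 ∘ₚ (shear y ∘ₚ frame r)) → SignDiagonal φ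
    decompose (r , y , d , d≢0 , φ≈) =
      let r≡ , y≡ , sd²≡s = normal-injective {r} {y} {s * (d * d)} {just 0#} {0#} {s} s≢0
                              (fixed-normal s φ r y d d≢0 φ≈ fixed)
      in d
        , x²≡y²⇒x≡±y (trans (*-cancelˡ-nonzero s≢0 (trans sd²≡s (sym (*-identityʳ s))))
                            (sym (*-identityˡ 1#)))
        , ∘-motion-trivial φ (dilation d d≢0) r y φ≈ r≡ y≡

  sign⇒stabiliser : ∀ s φ → SignDiagonal φ → Member φ × lineP₀ s ·ₗ φ ≈ₗ lineP₀ s
  sign⇒stabiliser s φ (d , d≡±1 , φ≈) =
      Subgroup.respects G {δ} {φ} (∝ₘ.sym {matrix φ} {diagonal d} φ≈) (dilation∈G d d≢0)
    , ≈ₗ.trans {lineP₀ s ·ₗ φ} {lineP₀ s ·ₗ δ} {lineP₀ s} (·ₗ-congʳ (lineP₀ s) {φ} {δ} φ≈)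
        (subst (λ w → lineP₀ s ·ₗ δ ≈ₗ lineP₀ w)
          (trans (cong (s *_) d²≡1) (*-identityʳ s)) (lineP₀·dilation s d d≢0))
    where
    d≢0 : d ≢ 0#
    d≢0 = [ (λ e → 1≢0 ∘ trans (sym e)) , (λ e → -1≢0 ∘ trans (sym e)) ]′ d≡±1
    d²≡1 : d * d ≡ 1#
    d²≡1 = [ (λ e → trans (cong₂ _*_ e e) (*-identityˡ 1#))
           , (λ e → trans (cong₂ _*_ e e) (solve 0 ((:- 𝟏) :* (:- 𝟏) := 𝟏) refl)) ]′ d≡±1
    δ = dilation d d≢0

  stabiliser⇔sign : ∀ {s} → s ≢ 0# → ∀ φ → SignDiagonal φ ⇔ (Member φ × lineP₀ s ·ₗ φ ≈ₗ lineP₀ s)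
  stabiliser⇔sign {s} s≢0 φ = mk⇔ (sign⇒stabiliser s φ) (stabiliser⇒sign s≢0 φ)

  -- The closure laws are transported from the stabiliser of `ℓ₁`, where they are formal, instead of
  -- being computed with matrices.
  signs : Subgroup PGL c
  signs = record
    { Member    = SignDiagonal
    ; respects  = λ {φ} {ψ} e h → from ψ (H.respects {φ} {ψ} e (to φ h))
    ; ε-closed  = from idₚ H.ε-closed
    ; ∙-closed  = λ {φ} {ψ} h k → from (φ ∘ₚ ψ) (H.∙-closed {φ} {ψ} (to φ h) (to ψ k))
    ; ⁻¹-closed = λ {φ} h → from (φ ⁻¹ₚ) (H.⁻¹-closed {φ} (to φ h))
    }
    where
    module H = Subgroup (stabiliser ℓ₁)
    to   = λ φ → Equivalence.to (stabiliser⇔sign 1≢0 φ)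
    from = λ φ → Equivalence.from (stabiliser⇔sign 1≢0 φ)

  -- The corner entry 1 forces the scalar to be 1. As 1 ≠ -1, the two sign matrices are therefore
  -- different projectivities.
  diagonal-injective : ∀ {d e} → diagonal d ∝ₘ diagonal e → d ≡ e
  diagonal-injective {d} {e} (k , _ , f) = begin
    d       ≡⟨ f 1F 1F ⟩
    k * e   ≡⟨ cong (_* e) (trans (f 0F 0F) (*-identityʳ k)) ⟨
    1# * e  ≡⟨ *-identityˡ e ⟩
    e       ∎
    where open ≡-Reasoning

  SignDiagonal-size : HasSize (Group.setoid PGL) SignDiagonal 2
  SignDiagonal-size = HasSize-enumeration (Group.setoid PGL) δ
    (λ { 0F → 1# , inj₁ refl , ∝ₘ.refl {diagonal 1#} ; 1F → - 1# , inj₂ refl , ∝ₘ.refl {diagonal (- 1#)} })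
    (λ { 0F 0F _ → refl ; 1F 1F _ → refl
       ; 0F 1F e → contradiction (x≡-x⇒x≡0 (diagonal-injective {1#} { - 1#} e)) 1≢0
       ; 1F 0F e → contradiction (x≡-x⇒x≡0 (sym (diagonal-injective { - 1#} {1#} e))) 1≢0 })
    (λ { φ (d , inj₁ refl , e) → 0F , ∝ₘ.sym {matrix φ} {diagonal 1#} e
       ; φ (d , inj₂ refl , e) → 1F , ∝ₘ.sym {matrix φ} {diagonal (- 1#)} e })
    where
    δ : Fin 2 → Projectivity
    δ 0F = dilation 1# 1≢0
    δ 1F = dilation (- 1#) -1≢0

open import Data.Nat.Base using (_≤_; _∸_; _^_)

theorem6p7 : ∀ {c} (F : Field c) (q : ℕ) → Field.Carrier F ↔ Fin q →
    5 ≤ q → ¬ (2 ∣ q) →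
    let open PG3 F hiding (_^_) in
    let open Subgroup using (Member) in
    ∀ (ρ : Carrier) → NonSquare ρ →
    (∀ ℓ → UnΓ ℓ ⇔ (Orbit ℓ₁ ℓ ⊎ Orbit (ℓ₂ ρ) ℓ))
    × (∀ ℓ → ¬ (Orbit ℓ₁ ℓ × Orbit (ℓ₂ ρ) ℓ))
    × HasSize lines (Orbit ℓ₁) ((q ^ 3 ∸ q) / 2)
    × HasSize lines (Orbit (ℓ₂ ρ)) ((q ^ 3 ∸ q) / 2)
    × (Σ[ H ∈ Subgroup PGL c ]
    (∀ φ → Member H φ ⇔ (Member G φ × ℓ₁ ·ₗ φ ≈ₗ ℓ₁))
    × (∀ φ → Member H φ ⇔ (Member G φ × ℓ₂ ρ ·ₗ φ ≈ₗ ℓ₂ ρ))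
    × HasSize (Group.setoid PGL) (Member H) 2
    × (∀ φ → Member H φ →
    ∃[ d ] ((d ≡ 1# ⊎ d ≡ - 1#) × matrix φ ∝ₘ diagonal d)))
theorem6p7 F q F↔Fin 5≤q 2∤q ρ ρ-nonsquare =
    UnΓ⇔Orbits ρ-nonsquare ρ≢0
  , Orbits-disjoint ρ-nonsquare ρ≢0
  , subst (HasSize lines (Orbit ℓ₁)) count (Orbit-size 1≢0)
  , subst (HasSize lines (Orbit (ℓ₂ ρ))) count (Orbit-size ρ≢0)
  , signs
  , stabiliser⇔sign 1≢0
  , stabiliser⇔sign ρ≢0
  , SignDiagonal-size
  , λ _ → id
  where
  open PG3 F hiding (_^_)
  open TwistedCubic F F↔Fin 5≤q 2∤q
  ρ≢0 : ρ ≢ 0#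
  ρ≢0 e = ρ-nonsquare 0# (trans (zeroˡ 0#) (sym e))
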